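{- Let $p$ be an odd prime. Suppose that either $p = 40k_1 + 3$ for some integer $k_1$ such that $5k_1+1$ is a perfect square, or $p = 40k_2+27$ for some integer $k_2$ such that $5k_2+4$ is a perfect square. Then the elliptic curve $E_p : y^2 = x^3 - 5px$ has rank exactly one over $\mathbb{Q}$.
   Context: The rank of an elliptic curve $E$ over a field $K$ is the rank $r$ of the finitely generated abelian group $E(K) \cong \mathbb{Z}^r \oplus E(K)_{\mathrm{tors}}$. -}

module Defs where

open import Data.Nat using (ℕ; zero; suc)
open import Data.Integer as ℤ using (ℤ; +_; -[1+_])
open import Data.Rational using (NonZero; ℚ; 0ℚ; 1ℚ; _+_; _*_; _-_; -_; _÷_; ≢-nonZero)
open import Data.Rational.Properties using (_≟_)
open import Data.Fin using (Fin)
open import Data.Product using (Σ; ∃; _×_; _,_)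
open import Relation.Nullary using (¬_; yes; no)
open import Relation.Binary.PropositionalEquality using (_≡_)

data Point : Set where
  O  : Point
  pt : ℚ → ℚ → Point

record Weierstrass : Set where
  constructor weierstrass
  field
    A : ℚ
    B : ℚ
open Weierstrass public

OnCurve : Weierstrass → Point → Set
OnCurve E O         = Data.Unit.⊤ where import Data.Unit
OnCurve E (pt x y)  = y * y ≡ x * x * x + A E * x + B E

RatPoint : Weierstrass → Set
RatPoint E = Σ Point (OnCurve E)

2ℚ 3ℚ : ℚ
2ℚ = 1ℚ + 1ℚ
3ℚ = 2ℚ + 1ℚ

neg : Point → Point
neg O        = O
neg (pt x y) = pt x (- y)

-- Chord-and-tangent group law (identity O).  The fall-back branches
-- returning O when a denominator vanishes are only reached by points that
-- are not on the curve (or for P + (-P) = O, resp. 2P = O when y = 0).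
add : Weierstrass → Point → Point → Point
add E O Q = Q
add E P O = P
add E (pt x₁ y₁) (pt x₂ y₂) with (x₂ - x₁) ≟ 0ℚ
... | no d≢0 =
  let instance nz = ≢-nonZero d≢0
      l  = (y₂ - y₁) ÷ (x₂ - x₁)
      x₃ = l * l - x₁ - x₂
  in pt x₃ (l * (x₁ - x₃) - y₁)
... | yes _ with (y₁ + y₂) ≟ 0ℚ
...   | yes _ = O
...   | no _ with (2ℚ * y₁) ≟ 0ℚ
...     | yes _ = O
...     | no 2y₁≢0 =
  let instance nz = ≢-nonZero 2y₁≢0
      l  = (3ℚ * x₁ * x₁ + A E) ÷ (2ℚ * y₁)
      x₃ = l * l - x₁ - x₂
  in pt x₃ (l * (x₁ - x₃) - y₁)

mulℕ : Weierstrass → ℕ → Point → Point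
mulℕ E zero    P = O
mulℕ E (suc n) P = add E P (mulℕ E n P)

mulℤ : Weierstrass → ℤ → Point → Point
mulℤ E (+ n)     P = mulℕ E n P
mulℤ E -[1+ n ]  P = neg (mulℕ E (suc n) P)

lincomb : Weierstrass → (r : ℕ) → (Fin r → ℤ) → (Fin r → Point) → Point
lincomb E zero    c P = O
lincomb E (suc r) c P =
  add E (mulℤ E (c Fin.zero) (P Fin.zero))
        (lincomb E r (λ i → c (Fin.suc i)) (λ i → P (Fin.suc i)))
  where import Data.Fin as Fin

Independent : (E : Weierstrass) → (r : ℕ) → (Fin r → RatPoint E) → Set
Independent E r P =
  (c : Fin r → ℤ) → lincomb E r c (λ i → Data.Product.proj₁ (P i)) ≡ O → (i : Fin r) → c i ≡ + 0
  where import Data.Product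

-- rank E(ℚ) = r : the maximal number of ℤ-independent elements of E(ℚ)
-- (equivalently, E(ℚ) ≅ ℤ^r ⊕ finite, since E(ℚ) is finitely generated).
HasRank : Weierstrass → ℕ → Set
HasRank E r =
  (Σ (Fin r → RatPoint E) (Independent E r)) ×
  ((P : Fin (suc r) → RatPoint E) → ¬ Independent E (suc r) P)

Ep : ℕ → Weierstrass
Ep p = weierstrass (- ((+ (5 Data.Nat.* p)) Data.Rational./ 1)) 0ℚ
  where import Data.Nat

{-# OPTIONS --safe #-}

-- In both cases p + 5 = 8 m², so that E contains the point (4 m² , m (p - 5)), and p ≡ 3 mod 4, p ≡ ± 2 mod 5.
--
-- Put d = 20 p. The map u = x / y, w = (x² + 5 p) / (x² - 5 p) embeds E(ℚ) into the curve w² = 1 + d u⁴, where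
--   u₃ = (u₁ w₂ + u₂ w₁) / D,  w₃ = (w₁ w₂ (1 + d u₁² u₂²) + 2 d u₁ u₂ (u₁² + u₂²)) / D²,  D = 1 - d u₁² u₂².
-- Since d is not a square, D never vanishes: the addition law has no exceptions and the group axioms are
-- polynomial identities. The 2-torsion point 𝕋 = (0 , -1) acts by (u , w) ↦ (-u , -w).
--
-- In lowest terms u = a / e and w = v / e² with v² = e⁴ + d a⁴, and |v| serves as a height: writing v(Q) for v,
--   |v(2 Q)| ≥ |v(Q)|⁴  and  |v(Q₁ + Q₂) v(Q₁ - Q₂)| ≤ 2 v(Q₁)² v(Q₂)².
-- The first inequality forces points of finite order to have a = 0. For the upper bound on the rank, factor
-- v² - e⁴ = d a⁴ twice. Modulo 4 and 5 only two possibilities survive: up to 𝕋, either Q = 2 R, or Q is the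
-- duplicate of a point of the twist ω² = 10 + 2 p ν⁴, and a sum of two points of the latter kind is again
-- divisible by 2. So, up to 𝕋, one of Q₁, Q₂ is 2 R, or both of Q₁ ± Q₂ are; by the second inequality some such
-- R is smaller than the larger one of Q₁, Q₂, and it may replace that one in an independent pair. Infinite
-- descent excludes independent pairs.
module Submission where

open import Algebra.Bundles using (AbelianGroup)
open import Data.Empty using (⊥; ⊥-elim)
open import Data.Fin.Patterns
import Data.Integer.Properties as ℤₚ
open import Data.List using (List; []; _∷_)
open import Data.List.Relation.Unary.All using (All; []; _∷_)
open import Data.Nat as ℕ using (ℕ; zero; suc)
import Data.Nat.Divisibility as ℕ
import Data.Nat.Properties as ℕₚ
open import Data.Product using (Σ; _×_; _,_; ∃; ∃₂; proj₁; proj₂)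
open import Data.Sum using (_⊎_; inj₁; inj₂; [_,_]′)
open import Data.Unit using (⊤; tt)
open import Data.Vec as Vec using (Vec; []; _∷_; lookup)
open import Level using (0ℓ)
open import Relation.Nullary using (¬_; Dec; yes; no)

-- The two factorisations are descent by 2-isogeny in both directions. The first, of v² - e⁴,
-- replaces Q by a point (s / r , e / r²) of w² = 1 - 5 p u⁴, a model of the isogenous curve y² = x³
-- + 20 p x. The second, of r⁴ - e², leads back to the curve itself or to a twist of it; the
-- constants of the twist come from 2 r² = 5 m⁴ + p n⁴, multiplied by 2. After adjoining √10 the
-- twist becomes the curve: (ν , ω) / √10 lies on it, and in a sum of two such points the roots
-- cancel. If Q₁ = 2 ρ₁ and Q₂ = 2 ρ₂ with ρ₁, ρ₂ on the twist, then ρ₁ ± ρ₂ are rational and halve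
-- Q₁ ± Q₂. The height inequalities are strong enough because halving takes a fourth root: a product
-- of at most 2 y⁴ for the heights of Q₁ ± Q₂ leaves one half with height at most (2 y⁴)^(1/8), less
-- than y as soon as y ≥ 2. Halves are known only up to 𝕋, which a further doubling removes; so a
-- replacement H satisfies 4 H = 2 Q₁ + l Q₂, and this still transfers independence.

-- Polynomial identities, verified by normalisation in towers over ℤ.

module PolynomialIdentities where

  open import Algebra.Bundles using (CommutativeRing)
  open import Data.Bool using (Bool; true; false; _∧_)
  open import Data.Fin using (Fin; zero; suc)
  open import Data.Integer as ℤ using (ℤ; 0ℤ; 1ℤ; -1ℤ)
  open import Relation.Binary.PropositionalEquality using (_≡_; refl; sym; trans; cong; cong₂; module ≡-Reasoning)
  open import Algebra.Structures using (IsCommutativeRing)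

  infixl 6 _:+_ _:-_
  infixl 7 _:*_
  data Expr (n : ℕ) : Set where
    con : ℤ → Expr n
    var : Fin n → Expr n
    _:+_ _:-_ _:*_ : Expr n → Expr n → Expr n

  infix 9 #_
  #_ : ∀ {n} → ℕ → Expr n
  # k = con (ℤ.+ k)

  pattern $0 = var 0F
  pattern $1 = var 1F
  pattern $2 = var 2F
  pattern $3 = var 3F
  pattern $4 = var 4F
  pattern $5 = var 5F
  pattern $6 = var 6F
  pattern $7 = var 7F
  pattern $8 = var 8F
  pattern $9 = var 9F

  -- Extensions of ℤ: T [X] adjoins an indeterminate, T [√ g ] an element with square g; the element adjoined
  -- last is the variable $0.
  data Tower : ℕ → Set where
    base  : Tower 0
    _[X]  : ∀ {n} → Tower n → Tower (suc n)
    _[√_] : ∀ {n} → Tower n → Expr n → Tower (suc n)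

  free : ∀ n → Tower n
  free zero    = base
  free (suc n) = free n [X]

  ⟪_⟫ : ∀ {n} → Tower n → Set
  ⟪ base ⟫     = ℤ
  ⟪ T [X] ⟫    = List ⟪ T ⟫
  ⟪ T [√ g ] ⟫ = ⟪ T ⟫ × ⟪ T ⟫

  zeroᵀ : ∀ {n} (T : Tower n) → ⟪ T ⟫
  zeroᵀ base       = 0ℤ
  zeroᵀ (T [X])    = []
  zeroᵀ (T [√ g ]) = zeroᵀ T , zeroᵀ T

  const : ∀ {n} (T : Tower n) → ℤ → ⟪ T ⟫
  const base z       = z
  const (T [X]) z    = const T z ∷ []
  const (T [√ g ]) z = const T z , zeroᵀ T

  plus : ∀ {n} (T : Tower n) → ⟪ T ⟫ → ⟪ T ⟫ → ⟪ T ⟫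
  plus base a b = a ℤ.+ b
  plus (T [X]) [] q = q
  plus (T [X]) (a ∷ p) [] = a ∷ p
  plus (T [X]) (a ∷ p) (b ∷ q) = plus T a b ∷ plus (T [X]) p q
  plus (T [√ g ]) (a , b) (a' , b') = plus T a a' , plus T b b'

  -- Coefficient lists may carry trailing zeros, so vanishing is tested coefficient by coefficient
  -- and not by comparison with `zeroᵀ`.
  isZero : ∀ {n} (T : Tower n) → ⟪ T ⟫ → Bool
  isZero base ℤ.+0         = true
  isZero base _             = false
  isZero (T [X]) []         = true
  isZero (T [X]) (a ∷ p)    = isZero T a ∧ isZero (T [X]) p
  isZero (T [√ g ]) (a , b) = isZero T a ∧ isZero T b

  mutual
    times : ∀ {n} (T : Tower n) → ⟪ T ⟫ → ⟪ T ⟫ → ⟪ T ⟫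
    times base a b = a ℤ.* b
    times (T [X]) [] q = []
    times (T [X]) (a ∷ p) [] = []
    times (T [X]) (a ∷ p) q@(_ ∷ _) = plus (T [X]) (scale T a q) (zeroᵀ T ∷ times (T [X]) p q)
    times (T [√ g ]) (a , b) (a' , b') =
      plus T (times T a a') (times T (norm T g) (times T b b')) ,
      plus T (times T a b') (times T b a')

    scale : ∀ {n} (T : Tower n) → ⟪ T ⟫ → List ⟪ T ⟫ → List ⟪ T ⟫
    scale T a []      = []
    scale T a (b ∷ q) = times T a b ∷ scale T a q

    gen : ∀ {n} (T : Tower n) → Fin n → ⟪ T ⟫
    gen (T [X]) zero       = zeroᵀ T ∷ const T 1ℤ ∷ []
    gen (T [X]) (suc i)    = gen T i ∷ []
    gen (T [√ g ]) zero    = zeroᵀ T , const T 1ℤ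
    gen (T [√ g ]) (suc i) = gen T i , zeroᵀ T

    norm : ∀ {n} (T : Tower n) → Expr n → ⟪ T ⟫
    norm T (con z)  = const T z
    norm T (var i)  = gen T i
    norm T (a :+ b) = plus T (norm T a) (norm T b)
    norm T (a :- b) = plus T (norm T a) (times T (const T -1ℤ) (norm T b))
    norm T (a :* b) = times T (norm T a) (norm T b)

  module Solver
    {R : Set} {_+_ _*_ : R → R → R} { -_ : R → R} {0# 1# : R}
    (isRing : IsCommutativeRing _≡_ _+_ _*_ -_ 0# 1#)
    (ι : ℤ → R)
    (ι-+ : ∀ a b → ι (a ℤ.+ b) ≡ ι a + ι b)
    (ι-* : ∀ a b → ι (a ℤ.* b) ≡ ι a * ι b)
    (ι-0 : ι 0ℤ ≡ 0#)
    (ι-1 : ι 1ℤ ≡ 1#)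
    where

    private
      ring : CommutativeRing 0ℓ 0ℓ
      ring = record { isCommutativeRing = isRing }
    open CommutativeRing ring using (+-identityʳ; +-identityˡ; zeroˡ; zeroʳ; *-identityʳ; *-identityˡ;
      -‿inverseʳ; -‿inverseˡ; +-assoc; commutativeSemiring; distribʳ; distribˡ; *-comm)
    open import Algebra.Solver.Ring.NaturalCoefficients.Default commutativeSemiring
      using (solve) renaming (_:=_ to _⊜_; _:+_ to _⊕_; _:*_ to _⊗_)
    open import Algebra.Properties.Ring (CommutativeRing.ring ring) using (-1*x≈-x)
    open ≡-Reasoning

    ⟦_⟧ : ∀ {n} → Expr n → Vec R n → R
    ⟦ con z ⟧ ρ  = ι z
    ⟦ var i ⟧ ρ  = lookup ρ i
    ⟦ a :+ b ⟧ ρ = ⟦ a ⟧ ρ + ⟦ b ⟧ ρ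
    ⟦ a :- b ⟧ ρ = ⟦ a ⟧ ρ + (- ⟦ b ⟧ ρ)
    ⟦ a :* b ⟧ ρ = ⟦ a ⟧ ρ * ⟦ b ⟧ ρ

    Valid : ∀ {n} → Tower n → Vec R n → Set
    Valid base ρ = ⊤
    Valid (T [X]) (x ∷ ρ) = Valid T ρ
    Valid (T [√ g ]) (x ∷ ρ) = (x * x ≡ ⟦ g ⟧ ρ) × Valid T ρ

    eval : ∀ {n} (T : Tower n) → Vec R n → ⟪ T ⟫ → R
    eval base ρ z = ι z
    eval (T [X]) (x ∷ ρ) [] = 0#
    eval (T [X]) (x ∷ ρ) (a ∷ p) = eval T ρ a + (x * eval (T [X]) (x ∷ ρ) p)
    eval (T [√ g ]) (x ∷ ρ) (a , b) = eval T ρ a + (x * eval T ρ b)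

    zero-ok : ∀ {n} (T : Tower n) ρ → eval T ρ (zeroᵀ T) ≡ 0#
    zero-ok base ρ             = ι-0
    zero-ok (T [X]) (x ∷ ρ)    = refl
    zero-ok (T [√ g ]) (x ∷ ρ) =
      trans (cong₂ _+_ (zero-ok T ρ) (trans (cong (x *_) (zero-ok T ρ)) (zeroʳ x))) (+-identityʳ 0#)

    const-ok : ∀ {n} (T : Tower n) ρ z → eval T ρ (const T z) ≡ ι z
    const-ok base ρ z = refl
    const-ok (T [X]) (x ∷ ρ) z =
      trans (cong₂ _+_ (const-ok T ρ z) (zeroʳ x)) (+-identityʳ _)
    const-ok (T [√ g ]) (x ∷ ρ) z =
      trans (cong₂ _+_ (const-ok T ρ z)
               (trans (cong (x *_) (zero-ok T ρ)) (zeroʳ x)))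
            (+-identityʳ _)

    private
      interchange : ∀ a b x c e → (a + c) + (x * (b + e)) ≡ (a + (x * b)) + (c + (x * e))
      interchange = solve 5 (λ a b x c e → (a ⊕ c) ⊕ (x ⊗ (b ⊕ e)) ⊜ (a ⊕ (x ⊗ b)) ⊕ (c ⊕ (x ⊗ e))) refl

      horner-scale : ∀ a b x q → (a * b) + (x * (a * q)) ≡ a * (b + (x * q))
      horner-scale = solve 4 (λ a b x q → (a ⊗ b) ⊕ (x ⊗ (a ⊗ q)) ⊜ a ⊗ (b ⊕ (x ⊗ q))) refl

      horner-times : ∀ a q x p → (a * q) + (x * (p * q)) ≡ (a + (x * p)) * q
      horner-times = solve 4 (λ a q x p → (a ⊗ q) ⊕ (x ⊗ (p ⊗ q)) ⊜ (a ⊕ (x ⊗ p)) ⊗ q) refl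

      quad-times : ∀ a b x c e → ((a * c) + ((x * x) * (b * e))) + (x * ((a * e) + (b * c)))
                   ≡ (a + (x * b)) * (c + (x * e))
      quad-times = solve 5 (λ a b x c e →
        ((a ⊗ c) ⊕ ((x ⊗ x) ⊗ (b ⊗ e))) ⊕ (x ⊗ ((a ⊗ e) ⊕ (b ⊗ c)))
        ⊜ (a ⊕ (x ⊗ b)) ⊗ (c ⊕ (x ⊗ e))) refl

      ι-neg1 : ι -1ℤ ≡ - 1#
      ι-neg1 = begin
        ι -1ℤ ≡⟨ sym (+-identityʳ _) ⟩
        ι -1ℤ + 0# ≡⟨ cong (_ +_) (sym (-‿inverseʳ 1#)) ⟩
        ι -1ℤ + (1# + (- 1#)) ≡⟨ sym (+-assoc _ _ _) ⟩
        (ι -1ℤ + 1#) + (- 1#) ≡⟨ cong (λ t → (ι -1ℤ + t) + (- 1#)) (sym ι-1) ⟩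
        (ι -1ℤ + ι 1ℤ) + (- 1#) ≡⟨ cong (_+ (- 1#)) (trans (sym (ι-+ -1ℤ 1ℤ)) ι-0) ⟩
        0# + (- 1#) ≡⟨ +-identityˡ _ ⟩
        - 1# ∎

    plus-ok : ∀ {n} (T : Tower n) ρ p q → eval T ρ (plus T p q) ≡ eval T ρ p + eval T ρ q
    plus-ok base ρ p q = ι-+ p q
    plus-ok (T [X]) (x ∷ ρ) [] q = sym (+-identityˡ _)
    plus-ok (T [X]) (x ∷ ρ) (a ∷ p) [] = sym (+-identityʳ _)
    plus-ok (T [X]) (x ∷ ρ) (a ∷ p) (b ∷ q) =
      trans (cong₂ (λ s t → s + (x * t)) (plus-ok T ρ a b) (plus-ok (T [X]) (x ∷ ρ) p q))
            (interchange _ _ x _ _)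
    plus-ok (T [√ g ]) (x ∷ ρ) (a , b) (c , e) =
      trans (cong₂ (λ s t → s + (x * t)) (plus-ok T ρ a c) (plus-ok T ρ b e))
            (interchange _ _ x _ _)

    isZero-ok : ∀ {n} (T : Tower n) ρ p → isZero T p ≡ true → eval T ρ p ≡ 0#
    isZero-ok base ρ ℤ.+0 h = ι-0
    isZero-ok (T [X]) (x ∷ ρ) [] h = refl
    isZero-ok (T [X]) (x ∷ ρ) (a ∷ p) h with isZero T a in ha | isZero (T [X]) p in hp
    ... | true | true =
      trans (cong₂ (λ s t → s + (x * t)) (isZero-ok T ρ a ha) (isZero-ok (T [X]) (x ∷ ρ) p hp))
            (trans (+-identityˡ _) (zeroʳ x))
    isZero-ok (T [√ g ]) (x ∷ ρ) (a , b) h with isZero T a in ha | isZero T b in hb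
    ... | true | true =
      trans (cong₂ (λ s t → s + (x * t)) (isZero-ok T ρ a ha) (isZero-ok T ρ b hb))
            (trans (+-identityˡ _) (zeroʳ x))

    mutual
      times-ok : ∀ {n} (T : Tower n) ρ → Valid T ρ → ∀ p q → eval T ρ (times T p q) ≡ eval T ρ p * eval T ρ q
      times-ok base ρ v p q = ι-* p q
      times-ok (T [X]) (x ∷ ρ) v [] q = sym (zeroˡ _)
      times-ok (T [X]) (x ∷ ρ) v (a ∷ p) [] = sym (zeroʳ _)
      times-ok (T [X]) (x ∷ ρ) v (a ∷ p) q@(_ ∷ _) = begin
        eval (T [X]) (x ∷ ρ) (plus (T [X]) (scale T a q) (zeroᵀ T ∷ times (T [X]) p q))
          ≡⟨ plus-ok (T [X]) (x ∷ ρ) (scale T a q) (zeroᵀ T ∷ times (T [X]) p q) ⟩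
        eval (T [X]) (x ∷ ρ) (scale T a q) + (eval T ρ (zeroᵀ T) + (x * eval (T [X]) (x ∷ ρ) (times (T [X]) p q)))
          ≡⟨ cong₂ _+_ (scale-ok T x ρ v a q)
               (trans (cong₂ (λ s t → s + (x * t)) (zero-ok T ρ) (times-ok (T [X]) (x ∷ ρ) v p q))
                      (+-identityˡ _)) ⟩
        (eval T ρ a * eval (T [X]) (x ∷ ρ) q) + (x * (eval (T [X]) (x ∷ ρ) p * eval (T [X]) (x ∷ ρ) q))
          ≡⟨ horner-times _ _ x _ ⟩
        (eval T ρ a + (x * eval (T [X]) (x ∷ ρ) p)) * eval (T [X]) (x ∷ ρ) q ∎
      times-ok (T [√ g ]) (x ∷ ρ) (x² , v) (a , b) (c , e) = trans
        (cong₂ (λ s t → s + (x * t))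
          (trans (plus-ok T ρ (times T a c) _)
            (cong₂ _+_ (times-ok T ρ v a c)
              (trans (times-ok T ρ v (norm T g) (times T b e))
                (cong₂ _*_ (trans (norm-ok T ρ v g) (sym x²)) (times-ok T ρ v b e)))))
          (trans (plus-ok T ρ (times T a e) _) (cong₂ _+_ (times-ok T ρ v a e) (times-ok T ρ v b c))))
        (quad-times _ _ x _ _)

      scale-ok : ∀ {n} (T : Tower n) x ρ → Valid T ρ → ∀ a q →
        eval (T [X]) (x ∷ ρ) (scale T a q) ≡ eval T ρ a * eval (T [X]) (x ∷ ρ) q
      scale-ok T x ρ v a [] = sym (zeroʳ _)
      scale-ok T x ρ v a (b ∷ q) =
        trans (cong₂ (λ s t → s + (x * t)) (times-ok T ρ v a b) (scale-ok T x ρ v a q))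
              (horner-scale _ _ x _)

      gen-ok : ∀ {n} (T : Tower n) ρ i → eval T ρ (gen T i) ≡ lookup ρ i
      gen-ok (T [X]) (x ∷ ρ) zero =
        trans (cong₂ (λ s t → s + (x * t)) (zero-ok T ρ)
                 (trans (cong₂ _+_ (trans (const-ok T ρ 1ℤ) ι-1) (zeroʳ x)) (+-identityʳ _)))
              (trans (+-identityˡ _) (*-identityʳ x))
      gen-ok (T [X]) (x ∷ ρ) (suc i) = trans (cong₂ _+_ (gen-ok T ρ i) (zeroʳ x)) (+-identityʳ _)
      gen-ok (T [√ g ]) (x ∷ ρ) zero =
        trans (cong₂ (λ s t → s + (x * t)) (zero-ok T ρ) (trans (const-ok T ρ 1ℤ) ι-1))
              (trans (+-identityˡ _) (*-identityʳ x))
      gen-ok (T [√ g ]) (x ∷ ρ) (suc i) =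
        trans (cong₂ (λ s t → s + (x * t)) (gen-ok T ρ i) (zero-ok T ρ))
              (trans (cong (_ +_) (zeroʳ x)) (+-identityʳ _))

      norm-ok : ∀ {n} (T : Tower n) ρ → Valid T ρ → ∀ e → eval T ρ (norm T e) ≡ ⟦ e ⟧ ρ
      norm-ok T ρ v (con z)  = const-ok T ρ z
      norm-ok T ρ v (var i)  = gen-ok T ρ i
      norm-ok T ρ v (a :+ b) = trans (plus-ok T ρ (norm T a) _) (cong₂ _+_ (norm-ok T ρ v a) (norm-ok T ρ v b))
      norm-ok T ρ v (a :- b) = trans (plus-ok T ρ (norm T a) _)
        (cong₂ _+_ (norm-ok T ρ v a)
          (trans (times-ok T ρ v (const T -1ℤ) (norm T b))
            (trans (cong₂ _*_ (trans (const-ok T ρ -1ℤ) ι-neg1) (norm-ok T ρ v b)) (-1*x≈-x _))))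
      norm-ok T ρ v (a :* b) = trans (times-ok T ρ v (norm T a) _) (cong₂ _*_ (norm-ok T ρ v a) (norm-ok T ρ v b))

    -- An entry c ∙ l ≔ r by eq contributes c (l - r) to the certificate.
    infixr 4 _∙_≔_by_∷_
    data Hyps {n} (ρ : Vec R n) : Set where
      []          : Hyps ρ
      _∙_≔_by_∷_ : (c l r : Expr n) → ⟦ l ⟧ ρ ≡ ⟦ r ⟧ ρ → Hyps ρ → Hyps ρ

    combination : ∀ {n} {ρ : Vec R n} → Hyps ρ → Expr n
    combination [] = con 0ℤ
    combination (c ∙ l ≔ r by _ ∷ hs) = c :* (l :- r) :+ combination hs

    private
      difference-zero : ∀ {x y} → x ≡ y → x + (- y) ≡ 0#
      difference-zero refl = -‿inverseʳ _

      combination-zero : ∀ {n} {ρ : Vec R n} (hs : Hyps ρ) → ⟦ combination hs ⟧ ρ ≡ 0#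
      combination-zero [] = ι-0
      combination-zero {ρ = ρ} (c ∙ l ≔ r by eq ∷ hs) =
        trans (cong₂ _+_ (trans (cong (⟦ c ⟧ ρ *_) (difference-zero eq)) (zeroʳ _)) (combination-zero hs))
              (+-identityʳ 0#)

      difference-zero⁻¹ : ∀ x y → x + (- y) ≡ 0# → x ≡ y
      difference-zero⁻¹ x y h = begin
        x                 ≡⟨ sym (+-identityʳ x) ⟩
        x + 0#            ≡⟨ cong (x +_) (sym (-‿inverseˡ y)) ⟩
        x + ((- y) + y)   ≡⟨ sym (+-assoc x _ y) ⟩
        (x + (- y)) + y   ≡⟨ cong (_+ y) h ⟩
        0# + y            ≡⟨ +-identityˡ y ⟩
        y                 ∎

    -- The check is a computation with integer coefficients, and `eval` transports it to every ring
    -- where the adjoined roots have the prescribed squares. Curve equations enter through `T`,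
    -- where they act as rewriting rules; other hypotheses need explicit cofactors in `hs`.
    certify-over : ∀ {n} (T : Tower n) (ρ : Vec R n) → Valid T ρ → (l r : Expr n) (hs : Hyps ρ) →
      isZero T (norm T (l :- r :- combination hs)) ≡ true → ⟦ l ⟧ ρ ≡ ⟦ r ⟧ ρ
    certify-over T ρ v l r hs check = difference-zero⁻¹ _ _ (begin
      ⟦ l :- r ⟧ ρ
        ≡⟨ difference-zero⁻¹ _ _ (trans (sym (norm-ok T ρ v (l :- r :- combination hs))) (isZero-ok T ρ _ check)) ⟩
      ⟦ combination hs ⟧ ρ ≡⟨ combination-zero hs ⟩
      0# ∎)

    certify : ∀ {n} (ρ : Vec R n) (l r : Expr n) (hs : Hyps ρ) →
      isZero (free n) (norm (free n) (l :- r :- combination hs)) ≡ true → ⟦ l ⟧ ρ ≡ ⟦ r ⟧ ρ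
    certify {n} ρ = certify-over (free n) ρ (free-valid ρ)
      where
      free-valid : ∀ {n} (ρ : Vec R n) → Valid (free n) ρ
      free-valid []      = tt
      free-valid (x ∷ ρ) = free-valid ρ

-- Fields with decidable equality.

module DiscreteFields where

  open PolynomialIdentities
  open import Algebra.Structures using (IsCommutativeRing)
  open import Data.Integer as ℤ using (ℤ; 0ℤ; 1ℤ)
  open import Relation.Binary.Definitions using (DecidableEquality)
  open import Relation.Binary.PropositionalEquality

  -- Zero and one are images of integers under `ι`, so that numerals of `Expr` evaluate to them
  -- directly; `inv` is total and constrained only away from zero.
  record DiscreteField : Set₁ where
    infix  8 -_
    infixl 7 _*_
    infixl 6 _+_ _-_
    infix  4 _≟_
    field
      F                 : Set
      _+_ _*_           : F → F → F
      -_                : F → F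
      ι                 : ℤ → F

      isCommutativeRing : IsCommutativeRing _≡_ _+_ _*_ -_ (ι 0ℤ) (ι 1ℤ)
      ι-+               : ∀ a b → ι (a ℤ.+ b) ≡ ι a + ι b
      ι-*               : ∀ a b → ι (a ℤ.* b) ≡ ι a * ι b
      inv               : F → F
      *-inv             : ∀ {x} → x ≢ ι 0ℤ → x * inv x ≡ ι 1ℤ
      _≟_               : DecidableEquality F

    0# 1# : F
    0# = ι 0ℤ
    1# = ι 1ℤ

    _-_ : F → F → F
    x - y = x + (- y)

    -- The form in which the conditions are used: d v² = 1 would make a denominator of the addition
    -- law vanish, and v² + a = 0 the denominator of the map from the cubic to the quartic.
    ReciprocalNonSquare NegativeNonSquare : F → Set
    ReciprocalNonSquare d = ∀ v → d * (v * v) ≢ 1#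
    NegativeNonSquare a   = ∀ v → v * v + a ≢ 0#

    open Solver isCommutativeRing ι ι-+ ι-* refl refl public
    open IsCommutativeRing isCommutativeRing using (*-identityʳ; *-assoc; zeroˡ)

    *-cancelʳ : ∀ {x y z} → z ≢ 0# → x * z ≡ y * z → x ≡ y
    *-cancelʳ {x} {y} {z} z≢0 eq = begin
      x                 ≡⟨ sym (*-identityʳ x) ⟩
      x * 1#            ≡⟨ cong (x *_) (sym (*-inv z≢0)) ⟩
      x * (z * inv z)   ≡⟨ sym (*-assoc x z _) ⟩
      (x * z) * inv z   ≡⟨ cong (_* inv z) eq ⟩
      (y * z) * inv z   ≡⟨ *-assoc y z _ ⟩
      y * (z * inv z)   ≡⟨ cong (y *_) (*-inv z≢0) ⟩
      y * 1#            ≡⟨ *-identityʳ y ⟩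
      y ∎
      where open ≡-Reasoning

    no-zero-divisors : ∀ {x y} → x * y ≡ 0# → x ≡ 0# ⊎ y ≡ 0#
    no-zero-divisors {x} {y} eq with y ≟ 0#
    ... | yes y≡0 = inj₂ y≡0
    ... | no y≢0  = inj₁ (*-cancelʳ y≢0 (trans eq (sym (zeroˡ y))))

    *-≢0 : ∀ {x y} → x ≢ 0# → y ≢ 0# → x * y ≢ 0#
    *-≢0 x≢0 y≢0 eq with no-zero-divisors eq
    ... | inj₁ x≡0 = x≢0 x≡0
    ... | inj₂ y≡0 = y≢0 y≡0

-- The addition law on w² = c + δ u⁴ as a relation between coordinates.

module QuarticAddition where

  open PolynomialIdentities
  open DiscreteFields
  open import Data.Integer as ℤ using (ℤ; +_)
  open import Relation.Binary.PropositionalEquality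

  -- The same formulas serve in a field, in ℤ and as solver expressions; abstracting over the
  -- operations makes these readings agree definitionally.
  record Operations (X : Set) : Set where
    infixl 6 _⊞_ _⊟_
    infixl 7 _⊠_
    field
      _⊞_ _⊟_ _⊠_ : X → X → X
      literal     : ℤ → X

  module Formulas {X : Set} (ops : Operations X) where
    open Operations ops

    quartic : X → X → X → X
    quartic c δ u = c ⊞ δ ⊠ (u ⊠ u ⊠ (u ⊠ u))

    sumA : X → X → X → X → X
    sumA u₁ w₁ u₂ w₂ = u₁ ⊠ w₂ ⊞ u₂ ⊠ w₁

    sumD : X → X → X → X → X
    sumD c δ u₁ u₂ = c ⊟ δ ⊠ (u₁ ⊠ u₁ ⊠ (u₂ ⊠ u₂))

    sumB : X → X → X → X → X → X → X
    sumB c δ u₁ w₁ u₂ w₂ =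
      w₁ ⊠ w₂ ⊠ (c ⊞ δ ⊠ (u₁ ⊠ u₁ ⊠ (u₂ ⊠ u₂))) ⊞ literal (+ 2) ⊠ c ⊠ δ ⊠ (u₁ ⊠ u₂) ⊠ (u₁ ⊠ u₁ ⊞ u₂ ⊠ u₂)

    -- In homogeneous coordinates (a : e : v), which stand for the point (a / e , v / e²).
    homA : X → X → X → X → X → X → X
    homA a₁ e₁ v₁ a₂ e₂ v₂ = a₁ ⊠ e₁ ⊠ v₂ ⊞ a₂ ⊠ e₂ ⊠ v₁

    homE : X → X → X → X → X → X
    homE d a₁ e₁ a₂ e₂ = e₁ ⊠ e₁ ⊠ (e₂ ⊠ e₂) ⊟ d ⊠ (a₁ ⊠ a₁ ⊠ (a₂ ⊠ a₂))

    homV : X → X → X → X → X → X → X → X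
    homV d a₁ e₁ v₁ a₂ e₂ v₂ =
      v₁ ⊠ v₂ ⊠ (e₁ ⊠ e₁ ⊠ (e₂ ⊠ e₂) ⊞ d ⊠ (a₁ ⊠ a₁ ⊠ (a₂ ⊠ a₂)))
      ⊞ literal (+ 2) ⊠ d ⊠ (a₁ ⊠ a₂ ⊠ (e₁ ⊠ e₂)) ⊠ (a₁ ⊠ a₁ ⊠ (e₂ ⊠ e₂) ⊞ a₂ ⊠ a₂ ⊠ (e₁ ⊠ e₁))

  expressions : ∀ {n} → Operations (Expr n)
  expressions = record { _⊞_ = _:+_ ; _⊟_ = _:-_ ; _⊠_ = _:*_ ; literal = con }

  module 𝔼 {n} = Formulas {Expr n} expressions

  module Sums (𝔽 : DiscreteField) where
    open DiscreteField 𝔽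

    operations : Operations F
    operations = record { _⊞_ = _+_ ; _⊟_ = _-_ ; _⊠_ = _*_ ; literal = ι }

    open Formulas operations public

    -- The relation (u₃ , w₃) = (u₁ , w₁) + (u₂ , w₂), on the curve w² = 1 + d u⁴ when c = 1 and δ = d.
    -- In general both summands lie on the twist w² = c + δ u⁴, that is, (uᵢ , wᵢ) / √c lies on
    -- w² = 1 + c δ u⁴.
    record IsSum (c δ u₁ w₁ u₂ w₂ u₃ w₃ : F) : Set where
      constructor isSum
      field
        nonzero : sumD c δ u₁ u₂ ≢ 0#
        u-eq    : u₃ * sumD c δ u₁ u₂ ≡ sumA u₁ w₁ u₂ w₂
        w-eq    : w₃ * (sumD c δ u₁ u₂ * sumD c δ u₁ u₂) ≡ sumB c δ u₁ w₁ u₂ w₂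

    fractions : ∀ {D} A B → D ≢ 0# → (A * inv D) * D ≡ A × (B * (inv D * inv D)) * (D * D) ≡ B
    fractions {D} A B D≢0 =
      certify (D ∷ inv D ∷ A ∷ B ∷ [])
        (a :* i :* D′) a
        (a ∙ D′ :* i ≔ # 1 by *-inv D≢0 ∷ []) refl ,
      certify (D ∷ inv D ∷ A ∷ B ∷ [])
        (b :* (i :* i) :* (D′ :* D′)) b
        (b :* (D′ :* i :+ # 1) ∙ D′ :* i ≔ # 1 by *-inv D≢0 ∷ []) refl
      where
      D′ = $0; i = $1; a = $2; b = $3

    isSum-exists : ∀ c δ u₁ w₁ u₂ w₂ → sumD c δ u₁ u₂ ≢ 0# →
      let D = sumD c δ u₁ u₂ in
      IsSum c δ u₁ w₁ u₂ w₂ (sumA u₁ w₁ u₂ w₂ * inv D) (sumB c δ u₁ w₁ u₂ w₂ * (inv D * inv D))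
    isSum-exists c δ u₁ w₁ u₂ w₂ D≢0 = isSum D≢0 (proj₁ eqs) (proj₂ eqs)
      where eqs = fractions (sumA u₁ w₁ u₂ w₂) (sumB c δ u₁ w₁ u₂ w₂) D≢0

    isSum-unique : ∀ {c δ u₁ w₁ u₂ w₂ u₃ w₃ u₃′ w₃′} → IsSum c δ u₁ w₁ u₂ w₂ u₃ w₃ →
      IsSum c δ u₁ w₁ u₂ w₂ u₃′ w₃′ → u₃ ≡ u₃′ × w₃ ≡ w₃′
    isSum-unique (isSum nz p q) (isSum _ p′ q′) =
      *-cancelʳ nz (trans p (sym p′)) , *-cancelʳ (*-≢0 nz nz) (trans q (sym q′))

    -- The factors 1 / √c of the two summands combine to 1 / c, so the sum needs no root and lies on
    -- the quartic with coefficient c δ. After clearing D⁴ this is B² = D⁴ + c δ A⁴.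
    isSum-closed : ∀ {c δ u₁ w₁ u₂ w₂ u₃ w₃} → w₁ * w₁ ≡ quartic c δ u₁ → w₂ * w₂ ≡ quartic c δ u₂ →
      IsSum c δ u₁ w₁ u₂ w₂ u₃ w₃ → w₃ * w₃ ≡ quartic 1# (c * δ) u₃
    isSum-closed {c} {δ} {u₁} {w₁} {u₂} {w₂} {u₃} {w₃} on₁ on₂ (isSum nz p q) =
      *-cancelʳ (*-≢0 (*-≢0 nz nz) (*-≢0 nz nz)) (clear p q numerators)
      where
      D = sumD c δ u₁ u₂
      numerators : sumB c δ u₁ w₁ u₂ w₂ * sumB c δ u₁ w₁ u₂ w₂ ≡
        D * D * (D * D) + c * δ * (sumA u₁ w₁ u₂ w₂ * sumA u₁ w₁ u₂ w₂ * (sumA u₁ w₁ u₂ w₂ * sumA u₁ w₁ u₂ w₂))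
      numerators = certify-over T (w₁ ∷ w₂ ∷ u₁ ∷ u₂ ∷ c ∷ δ ∷ []) (on₁ , on₂ , tt)
        (eB :* eB) (eD :* eD :* (eD :* eD) :+ k :* e :* (eA :* eA :* (eA :* eA))) [] refl
        where
        T = base [X] [X] [X] [X] [√ 𝔼.quartic $2 $3 $1 ] [√ 𝔼.quartic $3 $4 $1 ]
        x = $0; y = $1; s = $2; t = $3; k = $4; e = $5
        eA = 𝔼.sumA s x t y
        eB = 𝔼.sumB k e s x t y
        eD = 𝔼.sumD k e s t
      clear : ∀ {D A B} → u₃ * D ≡ A → w₃ * (D * D) ≡ B → B * B ≡ D * D * (D * D) + c * δ * (A * A * (A * A)) →
        w₃ * w₃ * (D * D * (D * D)) ≡ quartic 1# (c * δ) u₃ * (D * D * (D * D))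
      clear {D} refl refl h = certify (u₃ ∷ w₃ ∷ D ∷ c ∷ δ ∷ [])
        (w :* w :* (eD :* eD :* (eD :* eD))) (𝔼.quartic (# 1) (k :* e) u :* (eD :* eD :* (eD :* eD)))
        (# 1 ∙ eB :* eB ≔ eD :* eD :* (eD :* eD) :+ k :* e :* (eA :* eA :* (eA :* eA)) by h ∷ []) refl
        where
        u = $0; w = $1; eD = $2; k = $3; e = $4
        eA = u :* eD
        eB = w :* (eD :* eD)

    -- A sum has the shape u = A / D, w = B / D² again, so its numerators and denominator can be fed
    -- back as (a : e : v). Iterated sums thereby become comparable as polynomials.
    isSum-homogeneous : ∀ {d u₁ w₁ u₂ w₂ u w a₁ e₁ v₁ a₂ e₂ v₂} → e₁ ≢ 0# → e₂ ≢ 0# →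
      u₁ * e₁ ≡ a₁ → w₁ * (e₁ * e₁) ≡ v₁ → u₂ * e₂ ≡ a₂ → w₂ * (e₂ * e₂) ≡ v₂ →
      IsSum 1# d u₁ w₁ u₂ w₂ u w →
      homE d a₁ e₁ a₂ e₂ ≢ 0# ×
      u * homE d a₁ e₁ a₂ e₂ ≡ homA a₁ e₁ v₁ a₂ e₂ v₂ ×
      w * (homE d a₁ e₁ a₂ e₂ * homE d a₁ e₁ a₂ e₂) ≡ homV d a₁ e₁ v₁ a₂ e₂ v₂
    isSum-homogeneous {d} {u₁} {w₁} {u₂} {w₂} {u} {w} {e₁ = e₁} {e₂ = e₂} e₁≢0 e₂≢0 refl refl refl refl (isSum nz p q) =
      (λ eq → *-≢0 (*-≢0 (*-≢0 e₁≢0 e₁≢0) (*-≢0 e₂≢0 e₂≢0)) nz (trans (sym E-eq) eq)) ,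
      certify ρ (eu :* eE) (𝔼.homA a1 e1 v1 a2 e2 v2)
        (k ∙ eu :* eD ≔ 𝔼.sumA u1 w1 u2 w2 by p ∷ []) refl ,
      certify ρ (ew :* (eE :* eE)) (𝔼.homV ed a1 e1 v1 a2 e2 v2)
        (k :* k ∙ ew :* (eD :* eD) ≔ 𝔼.sumB (# 1) ed u1 w1 u2 w2 by q ∷ []) refl
      where
      ρ = u₁ ∷ w₁ ∷ u₂ ∷ w₂ ∷ u ∷ w ∷ e₁ ∷ e₂ ∷ d ∷ []
      u1 = $0; w1 = $1; u2 = $2; w2 = $3; eu = $4; ew = $5; e1 = $6; e2 = $7; ed = $8
      a1 = u1 :* e1
      v1 = w1 :* (e1 :* e1)
      a2 = u2 :* e2
      v2 = w2 :* (e2 :* e2)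
      k  = e1 :* e1 :* (e2 :* e2)
      eD = 𝔼.sumD (# 1) ed u1 u2
      eE = 𝔼.homE ed a1 e1 a2 e2
      E-eq : homE d (u₁ * e₁) e₁ (u₂ * e₂) e₂ ≡ e₁ * e₁ * (e₂ * e₂) * sumD 1# d u₁ u₂
      E-eq = certify ρ eE (k :* eD) [] refl

    cross-cancel : ∀ {x y V V′ U U′} → V ≢ 0# → V′ ≢ 0# → x * V ≡ U → y * V′ ≡ U′ → U * V′ ≡ U′ * V → x ≡ y
    cross-cancel {x} {y} {V} {V′} V≢0 V′≢0 refl refl eq = *-cancelʳ (*-≢0 V≢0 V′≢0)
      (certify (x ∷ y ∷ V ∷ V′ ∷ [])
        ($0 :* ($2 :* $3)) ($1 :* ($2 :* $3))
        (# 1 ∙ $0 :* $2 :* $3 ≔ $1 :* $3 :* $2 by eq ∷ []) refl)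

    1#≢0-of : ∀ {x} → x ≢ 0# → 1# ≢ 0#
    1#≢0-of {x} x≢0 eq = x≢0 (certify (x ∷ []) $0 (# 0)
      ($0 ∙ # 1 ≔ # 0 by eq ∷ []) refl)

    denominator-one : ∀ u w → u * 1# ≡ u × w * (1# * 1#) ≡ w
    denominator-one u w =
      certify (u ∷ w ∷ []) ($0 :* # 1) $0 [] refl ,
      certify (u ∷ w ∷ []) ($1 :* (# 1 :* # 1)) $1 [] refl

    -- Compares (P₁ + P₂) + P₃ with (P₃ + P₂) + P₁: both sides then have one shape, exchanged by P₁
    -- ↔ P₃, and commutativity supplies the usual form. Cross-multiplication leaves two identities
    -- modulo the three curve equations.
    isSum-assoc : ∀ {d u₁ w₁ u₂ w₂ u₃ w₃ u₁₂ w₁₂ u₃₂ w₃₂ u w u′ w′} →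
      w₁ * w₁ ≡ quartic 1# d u₁ → w₂ * w₂ ≡ quartic 1# d u₂ → w₃ * w₃ ≡ quartic 1# d u₃ →
      IsSum 1# d u₁ w₁ u₂ w₂ u₁₂ w₁₂ → IsSum 1# d u₁₂ w₁₂ u₃ w₃ u w →
      IsSum 1# d u₃ w₃ u₂ w₂ u₃₂ w₃₂ → IsSum 1# d u₃₂ w₃₂ u₁ w₁ u′ w′ →
      u ≡ u′ × w ≡ w′
    isSum-assoc {d} {u₁} {w₁} {u₂} {w₂} {u₃} {w₃} on₁ on₂ on₃ (isSum n₁₂ p₁₂ q₁₂) s (isSum n₃₂ p₃₂ q₃₂) s′ =
      cross-cancel nz nz′ p p′ (certify-over T ρ (on₁ , on₂ , on₃ , tt) (eU :* eV′) (eU′ :* eV) [] refl) ,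
      cross-cancel (*-≢0 nz nz) (*-≢0 nz′ nz′) q q′
        (certify-over T ρ (on₁ , on₂ , on₃ , tt) (eW :* (eV′ :* eV′)) (eW′ :* (eV :* eV)) [] refl)
      where
      L  = isSum-homogeneous n₁₂ (1#≢0-of n₁₂) p₁₂ q₁₂ (proj₁ (denominator-one u₃ w₃)) (proj₂ (denominator-one u₃ w₃)) s
      L′ = isSum-homogeneous n₃₂ (1#≢0-of n₃₂) p₃₂ q₃₂ (proj₁ (denominator-one u₁ w₁)) (proj₂ (denominator-one u₁ w₁)) s′
      nz = proj₁ L; nz′ = proj₁ L′
      p = proj₁ (proj₂ L); p′ = proj₁ (proj₂ L′)
      q = proj₂ (proj₂ L); q′ = proj₂ (proj₂ L′)
      ρ = w₁ ∷ w₂ ∷ w₃ ∷ u₁ ∷ u₂ ∷ u₃ ∷ d ∷ []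
      T = base [X] [X] [X] [X] [√ 𝔼.quartic (# 1) $3 $2 ]
        [√ 𝔼.quartic (# 1) $4 $2 ] [√ 𝔼.quartic (# 1) $5 $2 ]
      x = $0; y = $1; z = $2; r = $3; t = $4; l = $5; e = $6
      eA  = 𝔼.sumA r x t y
      eB  = 𝔼.sumB (# 1) e r x t y
      eD  = 𝔼.sumD (# 1) e r t
      eU  = 𝔼.homA eA eD eB l (# 1) z
      eV  = 𝔼.homE e eA eD l (# 1)
      eW  = 𝔼.homV e eA eD eB l (# 1) z
      eA′ = 𝔼.sumA l z t y
      eB′ = 𝔼.sumB (# 1) e l z t y
      eD′ = 𝔼.sumD (# 1) e l t
      eU′ = 𝔼.homA eA′ eD′ eB′ r (# 1) x
      eV′ = 𝔼.homE e eA′ eD′ r (# 1)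
      eW′ = 𝔼.homV e eA′ eD′ eB′ r (# 1) x

    -- This is 2 (P₁ + P₂) = 2 P₁ + 2 P₂ for points of the twist. These do not lie on the curve, so
    -- the group axioms do not apply to them and the identity is verified directly.
    isSum-interchange : ∀ {c δ u₁ w₁ u₂ w₂ u₁₂ w₁₂ u₁₁ w₁₁ u₂₂ w₂₂ u w u′ w′} →
      w₁ * w₁ ≡ quartic c δ u₁ → w₂ * w₂ ≡ quartic c δ u₂ →
      IsSum c δ u₁ w₁ u₂ w₂ u₁₂ w₁₂ → IsSum c δ u₁ w₁ u₁ w₁ u₁₁ w₁₁ → IsSum c δ u₂ w₂ u₂ w₂ u₂₂ w₂₂ →
      IsSum 1# (c * δ) u₁₂ w₁₂ u₁₂ w₁₂ u w → IsSum 1# (c * δ) u₁₁ w₁₁ u₂₂ w₂₂ u′ w′ →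
      u ≡ u′ × w ≡ w′
    isSum-interchange {c} {δ} {u₁} {w₁} {u₂} {w₂} on₁ on₂ (isSum n₁₂ p₁₂ q₁₂) (isSum n₁₁ p₁₁ q₁₁) (isSum n₂₂ p₂₂ q₂₂) s s′ =
      cross-cancel nz nz′ p p′ (certify-over T ρ (on₁ , on₂ , tt) (eU :* eV′) (eU′ :* eV) [] refl) ,
      cross-cancel (*-≢0 nz nz) (*-≢0 nz′ nz′) q q′
        (certify-over T ρ (on₁ , on₂ , tt) (eW :* (eV′ :* eV′)) (eW′ :* (eV :* eV)) [] refl)
      where
      L  = isSum-homogeneous n₁₂ n₁₂ p₁₂ q₁₂ p₁₂ q₁₂ s
      L′ = isSum-homogeneous n₁₁ n₂₂ p₁₁ q₁₁ p₂₂ q₂₂ s′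
      nz = proj₁ L; nz′ = proj₁ L′
      p = proj₁ (proj₂ L); p′ = proj₁ (proj₂ L′)
      q = proj₂ (proj₂ L); q′ = proj₂ (proj₂ L′)
      ρ = w₁ ∷ w₂ ∷ u₁ ∷ u₂ ∷ c ∷ δ ∷ []
      T = base [X] [X] [X] [X] [√ 𝔼.quartic $2 $3 $1 ] [√ 𝔼.quartic $3 $4 $1 ]
      x = $0; y = $1; r = $2; t = $3; k = $4; e = $5
      eA  = 𝔼.sumA r x t y
      eB  = 𝔼.sumB k e r x t y
      eD  = 𝔼.sumD k e r t
      eA₁ = 𝔼.sumA r x r x
      eB₁ = 𝔼.sumB k e r x r x
      eD₁ = 𝔼.sumD k e r r
      eA₂ = 𝔼.sumA t y t y
      eB₂ = 𝔼.sumB k e t y t y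
      eD₂ = 𝔼.sumD k e t t
      eU  = 𝔼.homA eA eD eB eA eD eB
      eV  = 𝔼.homE (k :* e) eA eD eA eD
      eW  = 𝔼.homV (k :* e) eA eD eB eA eD eB
      eU′ = 𝔼.homA eA₁ eD₁ eB₁ eA₂ eD₂ eB₂
      eV′ = 𝔼.homE (k :* e) eA₁ eD₁ eA₂ eD₂
      eW′ = 𝔼.homV (k :* e) eA₁ eD₁ eB₁ eA₂ eD₂ eB₂

-- The abelian group of points of w² = 1 + d u⁴ for nonsquare d.

module QuarticGroups where

  open PolynomialIdentities
  open DiscreteFields
  open QuarticAddition
  open import Data.Integer as ℤ using ()
  open import Relation.Nullary.Decidable using (recompute)
  open import Relation.Binary.PropositionalEquality

  module QuarticGroup (𝔽 : DiscreteField) (d : DiscreteField.F 𝔽)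
                      (nonsquare : DiscreteField.ReciprocalNonSquare 𝔽 d) where
    open DiscreteField 𝔽
    open Sums 𝔽

    sumD≢0 : ∀ u₁ u₂ → sumD 1# d u₁ u₂ ≢ 0#
    sumD≢0 u₁ u₂ eq = nonsquare (u₁ * u₂) (certify (u₁ ∷ u₂ ∷ d ∷ [])
      ($2 :* ($0 :* $1 :* ($0 :* $1))) (# 1)
      (con ℤ.-1ℤ ∙ 𝔼.sumD (# 1) $2 $0 $1 ≔ # 0 by eq ∷ []) refl)

    -- The equation is irrelevant, so that points with equal coordinates are equal; `on!` recovers
    -- it by deciding equality in the field.
    record 𝕁 : Set where
      constructor jac
      field
        u w : F
        .on : w * w ≡ quartic 1# d u
    open 𝕁 public

    on! : ∀ P → w P * w P ≡ quartic 1# d (u P)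
    on! (jac u w on) = recompute (w * w ≟ quartic 1# d u) on

    𝕁-≡ : ∀ {P Q} → u P ≡ u Q × w P ≡ w Q → P ≡ Q
    𝕁-≡ {jac _ _ _} {jac _ _ _} (refl , refl) = refl

    closed : ∀ {u₁ w₁ u₂ w₂ u₃ w₃} → w₁ * w₁ ≡ quartic 1# d u₁ → w₂ * w₂ ≡ quartic 1# d u₂ →
      IsSum 1# d u₁ w₁ u₂ w₂ u₃ w₃ → w₃ * w₃ ≡ quartic 1# d u₃
    closed {u₃ = u₃} {w₃} on₁ on₂ s = trans (isSum-closed on₁ on₂ s)
      (certify (u₃ ∷ d ∷ [])
        (𝔼.quartic (# 1) (# 1 :* $1) $0) (𝔼.quartic (# 1) $1 $0) [] refl)

    Sum : 𝕁 → 𝕁 → 𝕁 → Set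
    Sum P Q R = IsSum 1# d (u P) (w P) (u Q) (w Q) (u R) (w R)

    infixl 6 _⊕_
    infix  8 ⊖_
    _⊕_ : 𝕁 → 𝕁 → 𝕁
    P ⊕ Q = jac _ _ (closed (on! P) (on! Q) (isSum-exists 1# d (u P) (w P) (u Q) (w Q) (sumD≢0 (u P) (u Q))))

    ⊕-sum : ∀ P Q → Sum P Q (P ⊕ Q)
    ⊕-sum P Q = isSum-exists 1# d (u P) (w P) (u Q) (w Q) (sumD≢0 (u P) (u Q))

    ⊕-unique : ∀ P Q R → Sum P Q R → P ⊕ Q ≡ R
    ⊕-unique P Q R s = 𝕁-≡ (isSum-unique (⊕-sum P Q) s)

    𝕆 𝕋 : 𝕁
    𝕆 = jac 0# 1# (certify (d ∷ [])
      (# 1 :* # 1) (𝔼.quartic (# 1) $0 (# 0)) [] refl)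
    𝕋 = jac 0# (0# - 1#) (certify (d ∷ [])
      ((# 0 :- # 1) :* (# 0 :- # 1)) (𝔼.quartic (# 1) $0 (# 0)) [] refl)

    ⊖_ : 𝕁 → 𝕁
    ⊖ P = jac (0# - u P) (w P) (trans (on! P) (certify (u P ∷ d ∷ [])
      (𝔼.quartic (# 1) $1 $0) (𝔼.quartic (# 1) $1 (# 0 :- $0)) [] refl))

    Sum-comm : ∀ {P Q R} → Sum P Q R → Sum Q P R
    Sum-comm {P} {Q} {R} (isSum nz p q) = isSum
      (λ eq → nz (trans D-eq eq))
      (certify ρ ($4 :* eD₂₁) (𝔼.sumA $2 $3 $0 $1)
        (# 1 ∙ $4 :* eD₁₂ ≔ 𝔼.sumA $0 $1 $2 $3 by p ∷ []) refl)
      (certify ρ ($5 :* (eD₂₁ :* eD₂₁)) (𝔼.sumB (# 1) $6 $2 $3 $0 $1)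
        (# 1 ∙ $5 :* (eD₁₂ :* eD₁₂) ≔ 𝔼.sumB (# 1) $6 $0 $1 $2 $3 by q ∷ []) refl)
      where
      ρ = u P ∷ w P ∷ u Q ∷ w Q ∷ u R ∷ w R ∷ d ∷ []
      eD₁₂ = 𝔼.sumD (# 1) $6 $0 $2
      eD₂₁ = 𝔼.sumD (# 1) $6 $2 $0
      D-eq : sumD 1# d (u P) (u Q) ≡ sumD 1# d (u Q) (u P)
      D-eq = certify ρ eD₁₂ eD₂₁ [] refl

    ⊕-comm : ∀ P Q → P ⊕ Q ≡ Q ⊕ P
    ⊕-comm P Q = ⊕-unique P Q (Q ⊕ P) (Sum-comm {Q} {P} {Q ⊕ P} (⊕-sum Q P))

    ⊕-assoc : ∀ P Q R → (P ⊕ Q) ⊕ R ≡ P ⊕ (Q ⊕ R)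
    ⊕-assoc P Q R = begin
      (P ⊕ Q) ⊕ R ≡⟨ 𝕁-≡ (isSum-assoc (on! P) (on! Q) (on! R) (⊕-sum P Q) (⊕-sum (P ⊕ Q) R)
                                      (⊕-sum R Q) (⊕-sum (R ⊕ Q) P)) ⟩
      (R ⊕ Q) ⊕ P ≡⟨ ⊕-comm (R ⊕ Q) P ⟩
      P ⊕ (R ⊕ Q) ≡⟨ cong (P ⊕_) (⊕-comm R Q) ⟩
      P ⊕ (Q ⊕ R) ∎
      where open ≡-Reasoning

    ⊕-identityˡ : ∀ P → 𝕆 ⊕ P ≡ P
    ⊕-identityˡ P = ⊕-unique 𝕆 P P (isSum (sumD≢0 0# (u P))
      (certify ρ ($0 :* eD) (𝔼.sumA (# 0) (# 1) $0 $1) [] refl)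
      (certify ρ ($1 :* (eD :* eD))
        (𝔼.sumB (# 1) $2 (# 0) (# 1) $0 $1) [] refl))
      where
      ρ = u P ∷ w P ∷ d ∷ []
      eD = 𝔼.sumD (# 1) $2 (# 0) $0

    ⊕-inverseˡ : ∀ P → (⊖ P) ⊕ P ≡ 𝕆
    ⊕-inverseˡ P = ⊕-unique (⊖ P) P 𝕆 (isSum (sumD≢0 (0# - u P) (u P))
      (certify-over T ρ (on! P , tt) (# 0 :* eD) (𝔼.sumA eu⁻ ew eu ew) [] refl)
      (certify-over T ρ (on! P , tt) (# 1 :* (eD :* eD)) (𝔼.sumB (# 1) ed eu⁻ ew eu ew) [] refl))
      where
      T = base [X] [X] [√ 𝔼.quartic (# 1) $1 $0 ]
      ρ = w P ∷ u P ∷ d ∷ []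
      ew = $0; eu = $1; ed = $2
      eu⁻ = # 0 :- eu
      eD = 𝔼.sumD (# 1) ed eu⁻ eu

    abelianGroup : AbelianGroup 0ℓ 0ℓ
    abelianGroup = record
      { Carrier = 𝕁
      ; _≈_ = _≡_
      ; _∙_ = _⊕_
      ; ε = 𝕆
      ; _⁻¹ = ⊖_
      ; isAbelianGroup = record
        { isGroup = record
          { isMonoid = record
            { isSemigroup = record
              { isMagma = record { isEquivalence = isEquivalence ; ∙-cong = cong₂ _⊕_ }
              ; assoc = ⊕-assoc
              }
            ; identity = ⊕-identityˡ , λ P → trans (⊕-comm P 𝕆) (⊕-identityˡ P)
            }
          ; inverse = ⊕-inverseˡ , λ P → trans (⊕-comm P (⊖ P)) (⊕-inverseˡ P)
          ; ⁻¹-cong = cong ⊖_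
          }
        ; comm = ⊕-comm
        }
      }

    u-⊕𝕋 : ∀ P → u (P ⊕ 𝕋) ≡ 0# - u P
    w-⊕𝕋 : ∀ P → w (P ⊕ 𝕋) ≡ 0# - w P
    private
      translate : ∀ P → P ⊕ 𝕋 ≡ jac (0# - u P) (0# - w P) (trans (certify (w P ∷ [])
        ((# 0 :- $0) :* (# 0 :- $0)) ($0 :* $0) [] refl) (on! (⊖ P)))
      translate P = ⊕-unique P 𝕋 _ (isSum (sumD≢0 (u P) 0#)
        (certify ρ ((# 0 :- $0) :* eD)
          (𝔼.sumA $0 $1 (# 0) (# 0 :- # 1)) [] refl)
        (certify ρ ((# 0 :- $1) :* (eD :* eD))
          (𝔼.sumB (# 1) $2 $0 $1 (# 0) (# 0 :- # 1)) [] refl))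
        where
        ρ = u P ∷ w P ∷ d ∷ []
        eD = 𝔼.sumD (# 1) $2 $0 (# 0)
    u-⊕𝕋 P = cong u (translate P)
    w-⊕𝕋 P = cong w (translate P)

    𝕋⊕𝕋 : 𝕋 ⊕ 𝕋 ≡ 𝕆
    𝕋⊕𝕋 = 𝕁-≡ (trans (u-⊕𝕋 𝕋) (certify [] (# 0 :- # 0) (# 0) [] refl) ,
               trans (w-⊕𝕋 𝕋) (certify [] (# 0 :- (# 0 :- # 1)) (# 1) [] refl))

    u≡0⇒2-torsion : ∀ P → u P ≡ 0# → P ⊕ P ≡ 𝕆
    u≡0⇒2-torsion P@(jac _ w _) refl = ⊕-unique P P 𝕆 (isSum (sumD≢0 0# 0#)
      (certify-over T ρ (on! P , tt) (# 0 :* eD) (𝔼.sumA (# 0) $0 (# 0) $0) [] refl)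
      (certify-over T ρ (on! P , tt) (# 1 :* (eD :* eD)) (𝔼.sumB (# 1) $1 (# 0) $0 (# 0) $0) [] refl))
      where
      T = base [X] [√ 𝔼.quartic (# 1) $0 (# 0) ]
      ρ = w ∷ d ∷ []
      eD = 𝔼.sumD (# 1) $1 (# 0) (# 0)

-- The homomorphism from the cubic to the quartic.

module CurveToQuartic where

  open PolynomialIdentities
  open DiscreteFields
  open QuarticAddition
  open QuarticGroups
  open import Data.Integer as ℤ using (+_)
  open import Relation.Binary.PropositionalEquality
  open import Algebra.Structures using (IsCommutativeRing)

  -- The curve y² = x³ + a x embeds into w² = 1 - 4 a u⁴ by u = x / y = y / (x² + a) and w = (x² - a) / (x² + a).
  module CurveMap (𝔽 : DiscreteField) (a : DiscreteField.F 𝔽)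
                  (nonsquare : DiscreteField.NegativeNonSquare 𝔽 a) where
    open DiscreteField 𝔽
    open Sums 𝔽

    d : F
    d = 0# - ι (+ 4) * a

    d-nonsquare : ∀ v → d * (v * v) ≢ 1#
    d-nonsquare v eq = nonsquare (ι (+ 2) * a * v) (certify (a ∷ v ∷ [])
      (# 2 :* e :* x :* (# 2 :* e :* x) :+ e) (# 0)
      (# 0 :- e ∙ (# 0 :- # 4 :* e) :* (x :* x) ≔ # 1 by eq ∷ []) refl)
      where e = $0; x = $1

    open QuarticGroup 𝔽 d d-nonsquare public

    OnE : F → F → Set
    OnE x y = y * y ≡ x * x * x + a * x + 0#

    g h : F → F
    g x = x * x + a
    h x = x * x - a

    𝔼g 𝔼h : ∀ {n} → Expr n → Expr n → Expr n
    𝔼g e x = x :* x :+ e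
    𝔼h e x = x :* x :- e

    𝔼on : ∀ {n} → Expr n → Expr n → Expr n
    𝔼on e x = x :* x :* x :+ e :* x :+ # 0

    -- The first and third equations say that the image is (y : g x : h x * g x) in the homogeneous
    -- coordinates of `isSum-homogeneous`.
    coordinates : ∀ x y → (y * inv (g x)) * g x ≡ y × (h x * inv (g x)) * g x ≡ h x ×
      (h x * inv (g x)) * (g x * g x) ≡ h x * g x
    coordinates x y = lemma y , lemma (h x) , trans (sym (*-assoc _ _ _)) (cong (_* g x) (lemma (h x)))
      where
      open IsCommutativeRing isCommutativeRing using (*-assoc)
      lemma : ∀ b → b * inv (g x) * g x ≡ b
      lemma b = certify (b ∷ g x ∷ inv (g x) ∷ [])
        ($0 :* $2 :* $1) $0
        ($0 ∙ $1 :* $2 ≔ # 1 by *-inv (nonsquare x) ∷ []) refl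

    image : ∀ x y → OnE x y → 𝕁
    image x y on = jac (y * inv (g x)) (h x * inv (g x)) (*-cancelʳ {z = g x * g x * (g x * g x)} (*-≢0 g²≢0 g²≢0)
      (clear (proj₁ (coordinates x y)) (proj₁ (proj₂ (coordinates x y)))))
      where
      g²≢0 = *-≢0 (nonsquare x) (nonsquare x)
      clear : ∀ {u w} → u * g x ≡ y → w * g x ≡ h x →
        w * w * (g x * g x * (g x * g x)) ≡ quartic 1# d u * (g x * g x * (g x * g x))
      clear {u} {w} p q = certify-over (base [X] [X] [X] [X] [√ 𝔼on $0 $1 ])
        (y ∷ a ∷ x ∷ u ∷ w ∷ []) (on , tt)
        (ew :* ew :* G⁴) (𝔼.quartic (# 1) (# 0 :- # 4 :* ea) eu :* G⁴)
        (G :* G :* (ew :* G :+ H) ∙ ew :* G ≔ H by q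
        ∷ # 4 :* ea :* (eu :* G :* (eu :* G) :+ ey :* ey) :* (eu :* G :+ ey) ∙ eu :* G ≔ ey by p ∷ []) refl
        where
        ey = $0; ea = $1; ex = $2; eu = $3; ew = $4
        G = 𝔼g ea ex
        H = 𝔼h ea ex
        G⁴ = G :* G :* (G :* G)

    -- Writing x₃ = X / Δ² and y₃ = Y / Δ³ covers the chord, Δ = x₂ - x₁, and the tangent, Δ = 2 y,
    -- at once; compatibility with addition becomes two polynomial identities free of the slope.
    module _ {x₁ y₁ x₂ y₂ x₃ y₃ Δ X Y} (on₁ : OnE x₁ y₁) (on₂ : OnE x₂ y₂) (on₃ : OnE x₃ y₃)
             (Δ≢0 : Δ ≢ 0#) (x-eq : x₃ * (Δ * Δ) ≡ X) (y-eq : y₃ * (Δ * Δ * Δ) ≡ Y) where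
      private
        A = homA y₁ (g x₁) (h x₁ * g x₁) y₂ (g x₂) (h x₂ * g x₂)
        E = homE d y₁ (g x₁) y₂ (g x₂)
        V = homV d y₁ (g x₁) (h x₁ * g x₁) y₂ (g x₂) (h x₂ * g x₂)
        Δ⁴ = Δ * Δ * (Δ * Δ)

      image-sum : A * (X * X + a * Δ⁴) ≡ Y * Δ * E → V * (X * X + a * Δ⁴) ≡ (X * X - a * Δ⁴) * (E * E) →
        image x₃ y₃ on₃ ≡ image x₁ y₁ on₁ ⊕ image x₂ y₂ on₂
      image-sum A-eq V-eq = 𝕁-≡
        ( cross-cancel G≢0 (proj₁ hom) u₃-eq (proj₁ (proj₂ hom)) (sym A-eq)
        , cross-cancel G≢0 (*-≢0 (proj₁ hom) (proj₁ hom)) w₃-eq (proj₂ (proj₂ hom)) (sym V-eq) )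
        where
        P₁ = image x₁ y₁ on₁
        P₂ = image x₂ y₂ on₂
        P₃ = image x₃ y₃ on₃
        hom = isSum-homogeneous (nonsquare x₁) (nonsquare x₂)
          (proj₁ (coordinates x₁ y₁)) (proj₂ (proj₂ (coordinates x₁ y₁)))
          (proj₁ (coordinates x₂ y₂)) (proj₂ (proj₂ (coordinates x₂ y₂))) (⊕-sum P₁ P₂)
        ρ = u P₃ ∷ w P₃ ∷ x₃ ∷ y₃ ∷ Δ ∷ a ∷ []
        eu = $0; ew = $1; ex = $2; ey = $3; eΔ = $4; ea = $5
        eX = ex :* (eΔ :* eΔ)
        eΔ⁴ = eΔ :* eΔ :* (eΔ :* eΔ)
        G≢0 : X * X + a * Δ⁴ ≢ 0#
        G≢0 eq = *-≢0 (nonsquare x₃) (*-≢0 (*-≢0 Δ≢0 Δ≢0) (*-≢0 Δ≢0 Δ≢0))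
          (trans (subst (λ X → g x₃ * Δ⁴ ≡ X * X + a * Δ⁴) x-eq
            (certify ρ (𝔼g ea ex :* eΔ⁴) (eX :* eX :+ ea :* eΔ⁴) [] refl)) eq)
        u₃-eq : u P₃ * (X * X + a * Δ⁴) ≡ Y * Δ
        u₃-eq = subst₂ (λ X Y → u P₃ * (X * X + a * Δ⁴) ≡ Y * Δ) x-eq y-eq
          (certify ρ (eu :* (eX :* eX :+ ea :* eΔ⁴)) (ey :* (eΔ :* eΔ :* eΔ) :* eΔ)
            (eΔ⁴ ∙ eu :* 𝔼g ea ex ≔ ey by proj₁ (coordinates x₃ y₃) ∷ []) refl)
        w₃-eq : w P₃ * (X * X + a * Δ⁴) ≡ X * X - a * Δ⁴
        w₃-eq = subst (λ X → w P₃ * (X * X + a * Δ⁴) ≡ X * X - a * Δ⁴) x-eq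
          (certify ρ (ew :* (eX :* eX :+ ea :* eΔ⁴)) (eX :* eX :- ea :* eΔ⁴)
            (eΔ⁴ ∙ ew :* 𝔼g ea ex ≔ 𝔼h ea ex by proj₁ (proj₂ (coordinates x₃ y₃)) ∷ []) refl)

    module Line (l x₁ y₁ x₂ : F) where
      x₃ y₃ : F
      x₃ = l * l - x₁ - x₂
      y₃ = l * (x₁ - x₃) - y₁

    chord : ∀ {l x₁ y₁ x₂ y₂} (on₁ : OnE x₁ y₁) (on₂ : OnE x₂ y₂) → x₂ - x₁ ≢ 0# → l * (x₂ - x₁) ≡ y₂ - y₁ →
      let open Line l x₁ y₁ x₂ in Σ (OnE x₃ y₃) λ on₃ → image x₃ y₃ on₃ ≡ image x₁ y₁ on₁ ⊕ image x₂ y₂ on₂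
    chord {l} {x₁} {y₁} {x₂} {y₂} on₁ on₂ Δ≢0 slope = on₃ , image-sum on₁ on₂ on₃ Δ≢0 x-eq y-eq
        (certify-over T ρ (on₁ , on₂ , tt) (eA :* (eX :* eX :+ ea :* eΔ⁴)) (eY :* eΔ :* eE) [] refl)
        (certify-over T ρ (on₁ , on₂ , tt) (eV :* (eX :* eX :+ ea :* eΔ⁴)) ((eX :* eX :- ea :* eΔ⁴) :* (eE :* eE)) [] refl)
      where
      open Line l x₁ y₁ x₂
      T = base [X] [X] [X] [√ 𝔼on $0 $2 ] [√ 𝔼on $1 $2 ]
      ρ = y₁ ∷ y₂ ∷ a ∷ x₁ ∷ x₂ ∷ []
      -- Needed over two environments: without the slope, where y₁ and y₂ are square roots of the
      -- tower, and with the slope l, whose equation is a hypothesis.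
      module Exprs {n} (ey₁ ey₂ ea ex₁ ex₂ : Expr n) where
        eΔ = ex₂ :- ex₁
        eX = (ey₂ :- ey₁) :* (ey₂ :- ey₁) :- (ex₁ :+ ex₂) :* (eΔ :* eΔ)
        eY = (ey₂ :- ey₁) :* (ex₁ :* (eΔ :* eΔ) :- eX) :- ey₁ :* (eΔ :* eΔ :* eΔ)
        eΔ⁴ = eΔ :* eΔ :* (eΔ :* eΔ)
        g₁ = 𝔼g ea ex₁
        g₂ = 𝔼g ea ex₂
        ed = # 0 :- # 4 :* ea
        eA = 𝔼.homA ey₁ g₁ (𝔼h ea ex₁ :* g₁) ey₂ g₂ (𝔼h ea ex₂ :* g₂)
        eE = 𝔼.homE ed ey₁ g₁ ey₂ g₂
        eV = 𝔼.homV ed ey₁ g₁ (𝔼h ea ex₁ :* g₁) ey₂ g₂ (𝔼h ea ex₂ :* g₂)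
      open Exprs {5} $0 $1 $2 $3 $4
      ea : Expr 5
      ea = $2
      module L {n} (l x₁ y₁ x₂ : Expr n) where
        ex₃ = l :* l :- x₁ :- x₂
        ey₃ = l :* (x₁ :- ex₃) :- y₁
      ρ′ = l ∷ y₁ ∷ y₂ ∷ a ∷ x₁ ∷ x₂ ∷ []
      el = $0; f₁ = $1; f₂ = $2; fa = $3; e₁ = $4; e₂ = $5
      module E′ = Exprs {6} f₁ f₂ fa e₁ e₂
      module L′ = L {6} el e₁ f₁ e₂
      lΔ = el :* E′.eΔ
      dy = f₂ :- f₁
      x-eq : x₃ * ((x₂ - x₁) * (x₂ - x₁)) ≡ ⟦ eX ⟧ ρ
      x-eq = certify ρ′ (L′.ex₃ :* (E′.eΔ :* E′.eΔ)) E′.eX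
        (lΔ :+ dy ∙ lΔ ≔ dy by slope ∷ []) refl
      y-eq : y₃ * ((x₂ - x₁) * (x₂ - x₁) * (x₂ - x₁)) ≡ ⟦ eY ⟧ ρ
      y-eq = certify ρ′ (L′.ey₃ :* (E′.eΔ :* E′.eΔ :* E′.eΔ)) E′.eY
        (((e₁ :* (E′.eΔ :* E′.eΔ)) :- L′.ex₃ :* (E′.eΔ :* E′.eΔ)) :- dy :* (lΔ :+ dy) ∙ lΔ ≔ dy by slope ∷ []) refl
      on₃ : OnE x₃ y₃
      -- Since x₁ + x₂ + x₃ = l², the square of the line minus the cubic differs from - (x - x₁) (x
      -- - x₂) (x - x₃) by a linear polynomial. Its value at x₃ is interpolated from those at x₁ and
      -- x₂, which explains the first two cofactors and the multiplication by Δ.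
      on₃ = *-cancelʳ Δ≢0 (certify ρ′
        (L′.ey₃ :* L′.ey₃ :* E′.eΔ) (𝔼on fa L′.ex₃ :* E′.eΔ)
        ( e₂ :- L′.ex₃ ∙ f₁ :* f₁ ≔ 𝔼on fa e₁ by on₁
        ∷ L′.ex₃ :- e₁ ∙ f₂ :* f₂ ≔ 𝔼on fa e₂ by on₂
        ∷ (L′.ex₃ :- e₁) :* (lΔ :+ f₁ :+ f₂) ∙ lΔ ≔ dy by slope ∷ []) refl)

    tangent : ∀ {l x y} (on : OnE x y) → (1# + 1#) * y ≢ 0# → l * ((1# + 1#) * y) ≡ (1# + 1# + 1#) * x * x + a →
      let open Line l x y x in Σ (OnE x₃ y₃) λ on₃ → image x₃ y₃ on₃ ≡ image x y on ⊕ image x y on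
    tangent {l} {x} {y} on Δ≢0 slope = on₃ , image-sum on on on₃ Δ≢0 x-eq y-eq
        (certify-over T ρ (on , tt) (eA :* (eX :* eX :+ ea :* eΔ⁴)) (eY :* eΔ :* eE) [] refl)
        (certify-over T ρ (on , tt) (eV :* (eX :* eX :+ ea :* eΔ⁴)) ((eX :* eX :- ea :* eΔ⁴) :* (eE :* eE)) [] refl)
      where
      open Line l x y x
      T = base [X] [X] [√ 𝔼on $0 $1 ]
      ρ = y ∷ a ∷ x ∷ []
      module Exprs {n} (ey ea ex : Expr n) where
        eΔ = (# 1 :+ # 1) :* ey
        dy = (# 1 :+ # 1 :+ # 1) :* ex :* ex :+ ea
        eX = dy :* dy :- (ex :+ ex) :* (eΔ :* eΔ)
        eY = dy :* (ex :* (eΔ :* eΔ) :- eX) :- ey :* (eΔ :* eΔ :* eΔ)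
        eΔ⁴ = eΔ :* eΔ :* (eΔ :* eΔ)
        eg = 𝔼g ea ex
        ed = # 0 :- # 4 :* ea
        eA = 𝔼.homA ey eg (𝔼h ea ex :* eg) ey eg (𝔼h ea ex :* eg)
        eE = 𝔼.homE ed ey eg ey eg
        eV = 𝔼.homV ed ey eg (𝔼h ea ex :* eg) ey eg (𝔼h ea ex :* eg)
      ea : Expr 3
      ea = $1
      open Exprs {3} $0 ea $2
      ρ′ = l ∷ y ∷ a ∷ x ∷ []
      el = $0; f = $1; fa = $2; e = $3
      module E′ = Exprs {4} f fa e
      ex₃ = el :* el :- e :- e
      ey₃ = el :* (e :- ex₃) :- f
      lΔ = el :* E′.eΔ
      x-eq : x₃ * ((1# + 1#) * y * ((1# + 1#) * y)) ≡ ⟦ eX ⟧ ρ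
      x-eq = certify ρ′ (ex₃ :* (E′.eΔ :* E′.eΔ)) E′.eX
        (lΔ :+ E′.dy ∙ lΔ ≔ E′.dy by slope ∷ []) refl
      y-eq : y₃ * ((1# + 1#) * y * ((1# + 1#) * y) * ((1# + 1#) * y)) ≡ ⟦ eY ⟧ ρ
      y-eq = certify ρ′ (ey₃ :* (E′.eΔ :* E′.eΔ :* E′.eΔ)) E′.eY
        (((e :* (E′.eΔ :* E′.eΔ)) :- ex₃ :* (E′.eΔ :* E′.eΔ)) :- E′.dy :* (lΔ :+ E′.dy) ∙ lΔ ≔ E′.dy by slope ∷ []) refl
      on₃ : OnE x₃ y₃
      -- The same linear remainder, now determined by its value and its derivative at x.
      on₃ = certify ρ′ (ey₃ :* ey₃) (𝔼on fa ex₃)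
        ( # 1 ∙ f :* f ≔ 𝔼on fa e by on
        ∷ ex₃ :- e ∙ lΔ ≔ E′.dy by slope ∷ []) refl

    negate : ∀ y → - y ≡ 0# - y
    negate y = sym (IsCommutativeRing.+-identityˡ isCommutativeRing (- y))

    neg-OnE : ∀ {x y} → OnE x y → OnE x (- y)
    neg-OnE {x} {y} on = trans (certify (- y ∷ y ∷ []) ($0 :* $0) ($1 :* $1)
      ($0 :- $1 ∙ $0 ≔ # 0 :- $1 by negate y ∷ []) refl) on

    image-neg : ∀ {x y} (on : OnE x y) → image x (- y) (neg-OnE on) ≡ ⊖ image x y on
    image-neg {x} {y} on = 𝕁-≡ (certify (- y ∷ y ∷ inv (g x) ∷ [])
      ($0 :* $2) (# 0 :- $1 :* $2)
      ($2 ∙ $0 ≔ # 0 :- $1 by negate y ∷ []) refl , refl)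

    -- At 𝕆 the coordinate w is 1, which would mean x² - a = x² + a, that is 2 a = 0.
    image≢𝕆 : ι (+ 2) ≢ 0# → ∀ {x y} (on : OnE x y) → image x y on ≢ 𝕆
    image≢𝕆 2≢0 {x} {y} on eq = *-≢0 2≢0 a≢0 (certify (w (image x y on) ∷ a ∷ x ∷ [])
      (# 2 :* $1) (# 0)
      ( # 0 :- 𝔼g $1 $2 ∙ $0 ≔ # 1 by cong w eq
      ∷ # 1 ∙ $0 :* 𝔼g $1 $2 ≔ 𝔼h $1 $2 by proj₁ (proj₂ (coordinates x y)) ∷ []) refl)
      where
      a≢0 : a ≢ 0#
      a≢0 a≡0 = nonsquare 0# (certify (a ∷ []) (# 0 :* # 0 :+ $0) (# 0)
        (# 1 ∙ $0 ≔ # 0 by a≡0 ∷ []) refl)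

    u-image≢0 : ∀ {x y} (on : OnE x y) → y ≢ 0# → u (image x y on) ≢ 0#
    u-image≢0 {x} {y} on y≢0 eq = y≢0 (certify (u (image x y on) ∷ g x ∷ y ∷ [])
      $2 (# 0)
      ( $1 ∙ $0 ≔ # 0 by eq
      ∷ con ℤ.-1ℤ ∙ $0 :* $1 ≔ $2 by proj₁ (coordinates x y) ∷ []) refl)

-- Congruences decided by exhausting residues.

module Congruences where

  open PolynomialIdentities
  open import Data.Bool using (Bool; true; _∧_; _∨_; not)
  open import Data.Fin using (zero; suc)
  open import Data.Integer as ℤ using (ℤ; +_; 0ℤ; _+_; _*_; _-_; -_; ∣_∣)
  open import Data.Integer.Divisibility.Signed
  open import Data.Integer.DivMod using (_%ℕ_; _/ℕ_; n%ℕd<d; a≡a%ℕn+[a/ℕn]*n)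
  open import Data.Nat using (NonZero)
  import Data.Nat.GCD as ℕ
  open import Data.Vec.Properties using (lookup-map)
  open import Relation.Binary.PropositionalEquality hiding ([_])
  open import Relation.Nullary using (does)
  open import Relation.Nullary.Decidable using (dec-true)

  module ℤ-Solver = Solver ℤₚ.+-*-isCommutativeRing (λ z → z) (λ _ _ → refl) (λ _ _ → refl) refl refl
  open ℤ-Solver

  module _ (m : ℕ) .{{_ : NonZero m}} where

    residue : ℤ → ℤ
    residue z = + (z %ℕ m)

    residue-∣ : ∀ z → + m ∣ z - residue z
    residue-∣ z = divides (z /ℕ m) (certify (z ∷ residue z ∷ z /ℕ m * + m ∷ [])
      ($0 :- $1) $2 (# 1 ∙ $0 ≔ $1 :+ $2 by a≡a%ℕn+[a/ℕn]*n z m ∷ []) refl)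

    eval-residue : ∀ {n} (e : Expr n) ρ → + m ∣ ⟦ e ⟧ ρ - ⟦ e ⟧ (Vec.map residue ρ)
    eval-residue (con z) ρ = divides 0ℤ (ℤₚ.+-inverseʳ z)
    eval-residue (var i) ρ rewrite lookup-map i residue ρ = residue-∣ (lookup ρ i)
    eval-residue (a :+ b) ρ = subst (+ m ∣_) (regroup (⟦ a ⟧ ρ) _ (⟦ b ⟧ ρ) _) (∣m∣n⇒∣m+n (eval-residue a ρ) (eval-residue b ρ))
      where
      regroup : ∀ x x′ y y′ → (x - x′) + (y - y′) ≡ (x + y) - (x′ + y′)
      regroup x x′ y y′ = certify (x ∷ x′ ∷ y ∷ y′ ∷ [])
        (($0 :- $1) :+ ($2 :- $3)) (($0 :+ $2) :- ($1 :+ $3)) [] refl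
    eval-residue (a :- b) ρ = subst (+ m ∣_) (regroup (⟦ a ⟧ ρ) _ (⟦ b ⟧ ρ) _) (∣m∣n⇒∣m-n (eval-residue a ρ) (eval-residue b ρ))
      where
      regroup : ∀ x x′ y y′ → (x - x′) - (y - y′) ≡ (x - y) - (x′ - y′)
      regroup x x′ y y′ = certify (x ∷ x′ ∷ y ∷ y′ ∷ [])
        (($0 :- $1) :- ($2 :- $3)) (($0 :- $2) :- ($1 :- $3)) [] refl
    eval-residue (a :* b) ρ = subst (+ m ∣_) (regroup (⟦ a ⟧ ρ) _ (⟦ b ⟧ ρ) _)
      (∣m∣n⇒∣m+n (∣m⇒∣m*n (⟦ b ⟧ ρ) (eval-residue a ρ)) (∣n⇒∣m*n (⟦ a ⟧ (Vec.map residue ρ)) (eval-residue b ρ)))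
      where
      regroup : ∀ x x′ y y′ → (x - x′) * y + x′ * (y - y′) ≡ x * y - x′ * y′
      regroup x x′ y y′ = certify (x ∷ x′ ∷ y ∷ y′ ∷ [])
        (($0 :- $1) :* $2 :+ $1 :* ($2 :- $3)) ($0 :* $2 :- $1 :* $3) [] refl

    allBelow : ℕ → (ℤ → Bool) → Bool
    allBelow zero    f = true
    allBelow (suc k) f = f (+ k) ∧ allBelow k f

    allResidues : ∀ n → (Vec ℤ n → Bool) → Bool
    allResidues zero    f = f []
    allResidues (suc n) f = allBelow m (λ r → allResidues n (λ ρ → f (r ∷ ρ)))

    divisible : ℤ → Bool
    divisible z = does (+ m ∣? z)

    implication : ∀ {n} → List (Expr n) → Expr n → Vec ℤ n → Bool
    implication []       c ρ = divisible (⟦ c ⟧ ρ)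
    implication (e ∷ es) c ρ = not (divisible (⟦ e ⟧ ρ)) ∨ implication es c ρ

    private
      ∧-elim : ∀ {a b} → a ∧ b ≡ true → a ≡ true × b ≡ true
      ∧-elim {true} {true} refl = refl , refl

      allBelow-sound : ∀ k f → allBelow k f ≡ true → ∀ {r} → r ℕ.< k → f (+ r) ≡ true
      allBelow-sound (suc k) f h {r} r<1+k with r ℕₚ.≟ k
      ... | yes refl = proj₁ (∧-elim h)
      ... | no r≢k   = allBelow-sound k f (proj₂ (∧-elim {f (+ k)} h)) (ℕₚ.≤∧≢⇒< (ℕ.s≤s⁻¹ r<1+k) r≢k)

      allResidues-sound : ∀ n f → allResidues n f ≡ true → ∀ ρ → f (Vec.map residue ρ) ≡ true
      allResidues-sound zero    f h []      = h
      allResidues-sound (suc n) f h (z ∷ ρ) =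
        allResidues-sound n _ (allBelow-sound m _ h (n%ℕd<d z m)) ρ

      to-residue : ∀ {n} (e : Expr n) ρ → + m ∣ ⟦ e ⟧ ρ → + m ∣ ⟦ e ⟧ (Vec.map residue ρ)
      to-residue e ρ h = subst (+ m ∣_) (certify (⟦ e ⟧ ρ ∷ ⟦ e ⟧ (Vec.map residue ρ) ∷ [])
        ($0 :- ($0 :- $1)) $1 [] refl) (∣m∣n⇒∣m-n h (eval-residue e ρ))

      from-residue : ∀ {n} (e : Expr n) ρ → + m ∣ ⟦ e ⟧ (Vec.map residue ρ) → + m ∣ ⟦ e ⟧ ρ
      from-residue e ρ h = subst (+ m ∣_) (certify (⟦ e ⟧ ρ ∷ ⟦ e ⟧ (Vec.map residue ρ) ∷ [])
        (($0 :- $1) :+ $1) $0 [] refl) (∣m∣n⇒∣m+n (eval-residue e ρ) h)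

      ∨-elim : ∀ {a b} → a ≡ true → not a ∨ b ≡ true → b ≡ true
      ∨-elim refl h = h

      does-true : ∀ {P : Set} (P? : Dec P) → does P? ≡ true → P
      does-true (yes p) _ = p

      implication-sound : ∀ {n} es (c : Expr n) ρ → implication es c (Vec.map residue ρ) ≡ true →
        All (λ e → + m ∣ ⟦ e ⟧ ρ) es → + m ∣ ⟦ c ⟧ ρ
      implication-sound [] c ρ h [] = from-residue c ρ (does-true (+ m ∣? _) h)
      implication-sound (e ∷ es) c ρ h (p ∷ ps) =
        implication-sound es c ρ (∨-elim (dec-true (+ m ∣? _) (to-residue e ρ p)) h) ps

    -- Divisibility of a polynomial value depends only on the residues of the variables, and `refl`
    -- runs through all m ^ n vectors of them. Callers keep n small by passing compound terms such
    -- as `quad s` as single variables.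
    congruence : ∀ {n} (ρ : Vec ℤ n) es c → allResidues n (implication es c) ≡ true →
      All (λ e → + m ∣ ⟦ e ⟧ ρ) es → + m ∣ ⟦ c ⟧ ρ
    congruence {n} ρ es c h = implication-sound es c ρ (allResidues-sound n _ h ρ)

    -- Hypotheses without a common solution modulo m imply even m ∣ 1.
    inconsistent : ∀ {n} (ρ : Vec ℤ n) es → allResidues n (implication es (# 1)) ≡ true →
      m ≢ 1 → ¬ All (λ e → + m ∣ ⟦ e ⟧ ρ) es
    inconsistent ρ es check m≢1 hs = m≢1 (ℕ.∣1⇒≡1 (∣⇒∣ᵤ (congruence ρ es (# 1) check hs)))

  ≡0⇒∣ : ∀ m {x} → x ≡ 0ℤ → + m ∣ x
  ≡0⇒∣ m refl = divides 0ℤ refl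

-- Coprime factors of squares and of multiples of fourth powers.

module CoprimeFactors where

  open import Data.Nat
  open import Data.Nat.Coprimality as C using (Coprime)
  open import Data.Nat.Divisibility
  open import Data.Nat.GCD
  open import Data.Nat.Primality using (Prime; euclidsLemma; prime⇒nonZero)
  open import Data.Nat.Properties
  open import Data.Nat.Solver using (module +-*-Solver)
  open import Relation.Binary.PropositionalEquality
  open +-*-Solver using (solve; _:=_; _:+_; _:*_; con)

  coprime-∣ˡ : ∀ {a b x} → x ∣ a → Coprime a b → Coprime x b
  coprime-∣ˡ x∣a c (d∣x , d∣b) = c (∣-trans d∣x x∣a , d∣b)

  coprime-*ˡ : ∀ {a b x} → Coprime a x → Coprime b x → Coprime (a * b) x
  coprime-*ˡ {a} {b} ca cb (d∣ab , d∣x) = cb (C.coprime-divisor (coprime-∣ˡ d∣x (C.sym ca)) d∣ab , d∣x)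

  coprime-*ʳ : ∀ {a b x} → Coprime x a → Coprime x b → Coprime x (a * b)
  coprime-*ʳ ca cb = C.sym (coprime-*ˡ (C.sym ca) (C.sym cb))

  quadℕ : ℕ → ℕ
  quadℕ n = n * n * (n * n)

  coprime-quadʳ : ∀ {x y} → Coprime x y → Coprime x (quadℕ y)
  coprime-quadʳ c = coprime-*ʳ (coprime-*ʳ c c) (coprime-*ʳ c c)

  *-≢0ℕ : ∀ {m n} → m ≢ 0 → n ≢ 0 → m * n ≢ 0
  *-≢0ℕ {m} m≢0 n≢0 eq with m*n≡0⇒m≡0∨n≡0 m eq
  ... | inj₁ m≡0 = m≢0 m≡0
  ... | inj₂ n≡0 = n≢0 n≡0

  -- Let g = gcd x c and x = a g, c = b g with a, b coprime. Then a y = b² g, so a divides g; the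
  -- cofactor g / a divides both x and y, hence is 1, and x = g², y = b².
  coprime-square : ∀ {x y c} → Coprime x y → x * y ≡ c * c → c ≢ 0 →
    ∃₂ λ g k → x ≡ g * g × y ≡ k * k × c ≡ g * k
  coprime-square {x} {y} {c} cop eq c≢0 = via-gcd (gcd x c) (gcd[m,n]∣m x c) (gcd[m,n]∣n x c) (gcd-GCD x c)
    where
    via-gcd : ∀ g → g ∣ x → g ∣ c → GCD x c g → ∃₂ λ g k → x ≡ g * g × y ≡ k * k × c ≡ g * k
    via-gcd g (divides a x≡ag) (divides b c≡bg) gcdG = conclude a∣g
     where
      g≢0 : g ≢ 0
      g≢0 g≡0 = c≢0 (trans c≡bg (trans (cong (b *_) g≡0) (*-zeroʳ b)))
      x≢0 : x ≢ 0
      x≢0 x≡0 = *-≢0ℕ c≢0 c≢0 (trans (sym eq) (cong (_* y) x≡0))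
      a≢0 : a ≢ 0
      a≢0 a≡0 = x≢0 (trans x≡ag (cong (_* g) a≡0))
      instance
        _ = ≢-nonZero g≢0
        _ = ≢-nonZero a≢0
      ay≡bbg : a * y ≡ b * (b * g)
      ay≡bbg = *-cancelʳ-≡ (a * y) (b * (b * g)) g (begin
        a * y * g         ≡⟨ solve 3 (λ a y g → a :* y :* g := a :* g :* y) refl a y g ⟩
        a * g * y         ≡⟨ cong (_* y) (sym x≡ag) ⟩
        x * y             ≡⟨ eq ⟩
        c * c             ≡⟨ cong₂ _*_ c≡bg c≡bg ⟩
        b * g * (b * g)   ≡⟨ solve 2 (λ b g → b :* g :* (b :* g) := b :* (b :* g) :* g) refl b g ⟩
        b * (b * g) * g   ∎)
        where open ≡-Reasoning
      a⊥b : Coprime a b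
      a⊥b = C.GCD≡1⇒coprime (GCD-* {c = g} (subst (GCD (a * g) (b * g)) (sym (*-identityˡ g))
        (subst₂ (λ s t → GCD s t g) x≡ag c≡bg gcdG)))
      a∣g : a ∣ g
      a∣g = C.coprime-divisor a⊥b (C.coprime-divisor a⊥b (divides y (trans (sym ay≡bbg) (*-comm a y))))
      conclude : a ∣ g → ∃₂ λ g k → x ≡ g * g × y ≡ k * k × c ≡ g * k
      conclude (divides k g≡ka) = g , b , trans x≡ag (cong (_* g) a≡g) , y≡bb , trans c≡bg (*-comm b g)
        where
        open ≡-Reasoning
        y≡kbb : y ≡ k * (b * b)
        y≡kbb = *-cancelʳ-≡ y (k * (b * b)) a (begin
          y * a               ≡⟨ *-comm y a ⟩
          a * y               ≡⟨ ay≡bbg ⟩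
          b * (b * g)         ≡⟨ cong (λ g → b * (b * g)) g≡ka ⟩
          b * (b * (k * a))   ≡⟨ solve 3 (λ b k a → b :* (b :* (k :* a)) := k :* (b :* b) :* a) refl b k a ⟩
          k * (b * b) * a     ∎)
        k≡1 : k ≡ 1
        k≡1 = cop (∣-trans (divides a (trans g≡ka (*-comm k a))) (divides a x≡ag) , divides (b * b) (trans y≡kbb (*-comm k _)))
        a≡g : a ≡ g
        a≡g = sym (trans g≡ka (trans (cong (_* a) k≡1) (*-identityˡ a)))
        y≡bb : y ≡ b * b
        y≡bb = trans y≡kbb (trans (cong (_* (b * b)) k≡1) (*-identityˡ _))

  -- Two applications of `coprime-square`: the square roots of x and y are coprime again and have
  -- product z².
  coprime-quad : ∀ {x y z} → Coprime x y → x * y ≡ quadℕ z → z ≢ 0 →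
    ∃₂ λ r s → z ≡ r * s × x ≡ quadℕ r × y ≡ quadℕ s
  coprime-quad {x} {y} {z} cop eq z≢0 = step₁ (coprime-square cop eq (*-≢0ℕ z≢0 z≢0))
    where
    step₂ : ∀ {g k} → x ≡ g * g → y ≡ k * k → (∃₂ λ r s → g ≡ r * r × k ≡ s * s × z ≡ r * s) →
      ∃₂ λ r s → z ≡ r * s × x ≡ quadℕ r × y ≡ quadℕ s
    step₂ x≡gg y≡kk (r , s , g≡rr , k≡ss , z≡rs) =
      r , s , z≡rs , trans x≡gg (cong₂ _*_ g≡rr g≡rr) , trans y≡kk (cong₂ _*_ k≡ss k≡ss)
    step₁ : (∃₂ λ g k → x ≡ g * g × y ≡ k * k × z * z ≡ g * k) → ∃₂ λ r s → z ≡ r * s × x ≡ quadℕ r × y ≡ quadℕ s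
    step₁ (g , k , x≡gg , y≡kk , zz≡gk) = step₂ x≡gg y≡kk
      (coprime-square (coprime-∣ˡ (divides g x≡gg) (C.sym (coprime-∣ˡ (divides k y≡kk) (C.sym cop)))) (sym zz≡gk) z≢0)

  cancel-factorˡ : ∀ {q x x′ y n} → Prime q → x ≡ x′ * q → x * y ≡ q * n → x′ * y ≡ n
  cancel-factorˡ {q} {x} {x′} {y} {n} pq x≡x′q eq = *-cancelˡ-≡ (x′ * y) n q
    (trans (solve 3 (λ q x′ y → q :* (x′ :* y) := x′ :* q :* y) refl q x′ y) (trans (cong (_* y) (sym x≡x′q)) eq))
    where instance _ = prime⇒nonZero pq

  PrimeSplit : ℕ → ℕ → ℕ → ℕ → Set
  PrimeSplit p x y z = ∃₂ λ r s → z ≡ r * s × ((x ≡ p * quadℕ r × y ≡ quadℕ s) ⊎ (x ≡ quadℕ r × y ≡ p * quadℕ s))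

  -- Euclid's lemma places p in one of the factors; once it is cancelled, two coprime factors of a
  -- fourth power remain.
  prime-quad : ∀ {p x y z} → Prime p → Coprime x y → x * y ≡ p * quadℕ z → z ≢ 0 →
    PrimeSplit p x y z
  prime-quad {p} {x} {y} {z} pp cop eq z≢0 = cases (euclidsLemma x y pp (divides (quadℕ z) (trans eq (*-comm p _))))
    where
    left : ∀ {x′} → x ≡ x′ * p → (∃₂ λ r s → z ≡ r * s × x′ ≡ quadℕ r × y ≡ quadℕ s) → PrimeSplit p x y z
    left {x′} x≡x′p (r , s , z≡rs , x′≡ , y≡) =
      r , s , z≡rs , inj₁ (trans x≡x′p (trans (*-comm x′ p) (cong (p *_) x′≡)) , y≡)
    right : ∀ {y′} → y ≡ y′ * p → (∃₂ λ r s → z ≡ r * s × y′ ≡ quadℕ r × x ≡ quadℕ s) → PrimeSplit p x y z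
    right {y′} y≡y′p (r , s , z≡rs , y′≡ , x≡) =
      s , r , trans z≡rs (*-comm r s) , inj₂ (x≡ , trans y≡y′p (trans (*-comm y′ p) (cong (p *_) y′≡)))
    cases : p ∣ x ⊎ p ∣ y → PrimeSplit p x y z
    cases (inj₁ (divides x′ x≡x′p)) = left x≡x′p (coprime-quad
      (coprime-∣ˡ {x = x′} (divides p (trans x≡x′p (*-comm x′ p))) cop) (cancel-factorˡ {x′ = x′} pp x≡x′p eq) z≢0)
    cases (inj₂ (divides y′ y≡y′p)) = right y≡y′p (coprime-quad
      (coprime-∣ˡ {x = y′} (divides p (trans y≡y′p (*-comm y′ p))) (C.sym cop)) (cancel-factorˡ {x′ = y′} pp y≡y′p (trans (*-comm y x) eq)) z≢0)

  TwoPrimesSplit : ℕ → ℕ → ℕ → ℕ → ℕ → Set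
  TwoPrimesSplit q p x y z = ∃₂ λ r s → z ≡ r * s × ((x ≡ quadℕ r × y ≡ q * p * quadℕ s) ⊎ (x ≡ q * quadℕ r × y ≡ p * quadℕ s) ⊎
    (x ≡ p * quadℕ r × y ≡ q * quadℕ s) ⊎ (x ≡ q * p * quadℕ r × y ≡ quadℕ s))

  two-primes-quad : ∀ {q p x y z} → Prime q → Prime p → Coprime x y → x * y ≡ q * p * quadℕ z → z ≢ 0 →
    TwoPrimesSplit q p x y z
  two-primes-quad {q} {p} {x} {y} {z} pq pp cop eq z≢0 =
    cases (euclidsLemma x y pq (divides (p * quadℕ z) (trans eq′ (*-comm q _))))
    where
    eq′ : x * y ≡ q * (p * quadℕ z)
    eq′ = trans eq (*-assoc q p _)
    absorb : ∀ {t t′ n} → t ≡ t′ * q → t′ ≡ n → t ≡ q * n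
    absorb {t′ = t′} t≡t′q t′≡n = trans t≡t′q (trans (*-comm t′ q) (cong (q *_) t′≡n))
    left : ∀ {x′} → x ≡ x′ * q →
      PrimeSplit p x′ y z → TwoPrimesSplit q p x y z
    left x≡x′q (r , s , z≡rs , inj₁ (a , b)) =
      r , s , z≡rs , inj₂ (inj₂ (inj₂ (trans (absorb x≡x′q a) (sym (*-assoc q p _)) , b)))
    left x≡x′q (r , s , z≡rs , inj₂ (a , b)) = r , s , z≡rs , inj₂ (inj₁ (absorb x≡x′q a , b))
    right : ∀ {y′} → y ≡ y′ * q →
      PrimeSplit p y′ x z → TwoPrimesSplit q p x y z
    right y≡y′q (r , s , z≡rs , inj₁ (a , b)) =
      s , r , trans z≡rs (*-comm r s) , inj₁ (b , trans (absorb y≡y′q a) (sym (*-assoc q p _)))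
    right y≡y′q (r , s , z≡rs , inj₂ (a , b)) =
      s , r , trans z≡rs (*-comm r s) , inj₂ (inj₂ (inj₁ (b , absorb y≡y′q a)))
    cases : q ∣ x ⊎ q ∣ y → TwoPrimesSplit q p x y z
    cases (inj₁ (divides x′ x≡x′q)) = left x≡x′q (prime-quad pp
      (coprime-∣ˡ {x = x′} (divides q (trans x≡x′q (*-comm x′ q))) cop) (cancel-factorˡ {x′ = x′} pq x≡x′q eq′) z≢0)
    cases (inj₂ (divides y′ y≡y′q)) = right y≡y′q (prime-quad pp
      (coprime-∣ˡ {x = y′} (divides q (trans y≡y′q (*-comm y′ q))) (C.sym cop)) (cancel-factorˡ {x′ = y′} pq y≡y′q (trans (*-comm y x) eq′)) z≢0)

-- Two successive factorisations of v² = e⁴ + 20 p a⁴ over ℤ.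

module TwoDescent where

  open PolynomialIdentities
  open Congruences
  open CoprimeFactors
  open ℤ-Solver
  open import Data.Integer as ℤ using (ℤ; +_; -[1+_]; 0ℤ; 1ℤ; _+_; _*_; _-_; -_) renaming (∣_∣ to abs)
  open import Data.Integer.Divisibility.Signed
  open import Data.Nat.Coprimality as C using (Coprime)
  open import Data.Nat.Primality using (Prime; prime?; euclidsLemma; prime⇒irreducible; prime⇒nonTrivial)
  open import Relation.Binary.PropositionalEquality hiding ([_])
  open import Relation.Nullary.Decidable using (toWitness)

  euclidℤ : ∀ {q} x y → Prime q → + q ∣ x * y → + q ∣ x ⊎ + q ∣ y
  euclidℤ {q} x y pq h = convert (euclidsLemma (abs x) (abs y) pq (subst (q ℕ.∣_) (ℤₚ.abs-* x y) (∣⇒∣ᵤ h)))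
    where
    convert : q ℕ.∣ abs x ⊎ q ℕ.∣ abs y → + q ∣ x ⊎ + q ∣ y
    convert (inj₁ q∣x) = inj₁ (∣ᵤ⇒∣ q∣x)
    convert (inj₂ q∣y) = inj₂ (∣ᵤ⇒∣ q∣y)

  prime-∤⇒coprime : ∀ {q n} → Prime q → ¬ q ℕ.∣ n → Coprime n q
  prime-∤⇒coprime {q} pq q∤n (d∣n , d∣q) = cases (prime⇒irreducible pq d∣q) d∣n
    where
    cases : ∀ {d} → d ≡ 1 ⊎ d ≡ q → d ℕ.∣ _ → d ≡ 1
    cases (inj₁ d≡1) _    = d≡1
    cases (inj₂ refl) q∣n = ⊥-elim (q∤n q∣n)

  prime-2 : Prime 2
  prime-2 = toWitness {a? = prime? 2} tt

  prime-5 : Prime 5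
  prime-5 = toWitness {a? = prime? 5} tt

  odd⇒ : ∀ {x} → ¬ + 2 ∣ x → + 2 ∣ x - 1ℤ
  odd⇒ {x} 2∤x = [ (λ h → ⊥-elim (2∤x h)) , (λ h → h) ]′ (euclidℤ x (x - 1ℤ) prime-2
    (congruence 2 (x ∷ []) [] ($0 :* ($0 :- # 1)) refl []))

  q⁴ : ∀ {n} → Expr n → Expr n
  q⁴ x = x :* x :* (x :* x)

  quad : ℤ → ℤ
  quad x = x * x * (x * x)

  abs-square : ∀ x → + abs x * + abs x ≡ x * x
  abs-square (+ n)    = refl
  abs-square -[1+ n ] = refl

  square-abs : ∀ r → r * r ≡ + abs (r * r)
  square-abs (+ zero)  = refl
  square-abs (+ suc n) = refl
  square-abs -[1+ n ]  = refl

  abs-quad : ∀ x → + quadℕ (abs x) ≡ quad x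
  abs-quad x = trans (ℤₚ.pos-* (abs x ℕ.* abs x) _) (cong₂ _*_ lemma lemma)
    where
    lemma : + (abs x ℕ.* abs x) ≡ x * x
    lemma = trans (ℤₚ.pos-* (abs x) (abs x)) (abs-square x)

  pos-quad : ∀ k p z → + k * + p * quad z ≡ + (k ℕ.* p ℕ.* quadℕ (abs z))
  pos-quad k p z = trans (cong₂ _*_ (sym (ℤₚ.pos-* k p)) (sym (abs-quad z))) (sym (ℤₚ.pos-* (k ℕ.* p) _))

  record Primitive (p : ℕ) (a e v : ℤ) : Set where
    field
      coprime  : Coprime (abs a) (abs e)
      equation : v * v ≡ quad e + + 20 * + p * quad a

  -- What the descent uses of p. The condition p² ≡ -1 modulo 5 treats the residues 2 and 3
  -- together.
  record Admissible (p : ℕ) : Set where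
    field
      p-prime : Prime p
      p≡3[4]  : + 4 ∣ + p + 1ℤ
      p≡±2[5] : + 5 ∣ + p * + p + 1ℤ

  module _ {p} (adm : Admissible p) where
    open Admissible adm

    -- Otherwise p would be 2 or 5, neither of which is 3 modulo 4.
    p∤20 : ¬ + p ∣ + 20
    p∤20 h = [ case-2 , (λ h → [ case-2 , case-5 ]′ (euclidℤ (+ 2) (+ 5) p-prime h)) ]′ (euclidℤ (+ 2) (+ 10) p-prime h)
      where
      p≢1 : p ≢ 1
      p≢1 = ℕ.nonTrivial⇒≢1 {{prime⇒nonTrivial p-prime}}
      case-2 : ¬ + p ∣ + 2
      case-2 h = [ p≢1 , (λ p≡2 → 2∤3 (subst (λ p → + 4 ∣ + p + 1ℤ) p≡2 p≡3[4])) ]′ (prime⇒irreducible prime-2 (∣⇒∣ᵤ h))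
        where
        2∤3 : ¬ + 4 ∣ + 3
        2∤3 h = inconsistent 4 [] (# 3 ∷ []) refl (λ ()) (h ∷ [])
      case-5 : ¬ + p ∣ + 5
      case-5 h = [ p≢1 , (λ p≡5 → 4∤6 (subst (λ p → + 4 ∣ + p + 1ℤ) p≡5 p≡3[4])) ]′ (prime⇒irreducible prime-5 (∣⇒∣ᵤ h))
        where
        4∤6 : ¬ + 4 ∣ + 6
        4∤6 h = inconsistent 4 [] (# 6 ∷ []) refl (λ ()) (h ∷ [])

    module _ {a e v} (prim : Primitive p a e v) where
      open Primitive prim

      common-prime : ∀ {q} → Prime q → + q ∣ e → ¬ + q ∣ a
      common-prime pq q∣e q∣a = ℕ.nonTrivial⇒≢1 {{prime⇒nonTrivial pq}} (coprime (∣⇒∣ᵤ q∣a , ∣⇒∣ᵤ q∣e))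

      equation′ : v * v - (quad e + + 20 * + p * quad a) ≡ 0ℤ
      equation′ = certify (v * v ∷ quad e + + 20 * + p * quad a ∷ [])
        ($0 :- $1) (# 0) (# 1 ∙ $0 ≔ $1 by equation ∷ []) refl

      -- For e = 2 e′ the number a is odd, and v = 2 v′ with v′² = 4 e′⁴ + 5 p a⁴, which is 3 modulo
      -- 4.
      e-odd : ¬ + 2 ∣ e
      e-odd 2∣e = descend 2∣e 2∣v (odd⇒ (common-prime prime-2 2∣e))
        where
        2∣v : + 2 ∣ v
        2∣v = congruence 2 (v ∷ e ∷ a ∷ + p ∷ [])
          ($1 ∷ $0 :* $0 :- (q⁴ $1 :+ # 20 :* $3 :* q⁴ $2) ∷ []) $0 refl
          (2∣e ∷ ≡0⇒∣ 2 equation′ ∷ [])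
        descend : + 2 ∣ e → + 2 ∣ v → + 2 ∣ a - 1ℤ → ⊥
        descend (divides e′ refl) (divides v′ refl) (divides b a-1) = inconsistent 4 (v′ ∷ e′ ∷ b ∷ + p ∷ [])
          ($3 :+ # 1 ∷ reduced ∷ []) refl (λ ()) (p≡3[4] ∷ ≡0⇒∣ 4 reduced≡0 ∷ [])
          where
          reduced : Expr 4
          reduced = $0 :* $0 :- # 4 :* q⁴ $1 :- # 5 :* $3 :* q⁴ ($2 :* # 2 :+ # 1)
          reduced≡0 : ⟦ reduced ⟧ (v′ ∷ e′ ∷ b ∷ + p ∷ []) ≡ 0ℤ
          reduced≡0 = ℤₚ.*-cancelˡ-≡ (+ 4) _ 0ℤ (certify (v′ ∷ e′ ∷ b ∷ + p ∷ a ∷ [])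
            (# 4 :* ($0 :* $0 :- # 4 :* q⁴ $1 :- # 5 :* $3 :* q⁴ b+1)) (# 0)
            ( # 1 ∙ $0 :* # 2 :* ($0 :* # 2) ≔ q⁴ ($1 :* # 2) :+ # 20 :* $3 :* q⁴ $4 by equation
            ∷ # 20 :* $3 :* ($4 :* $4 :+ b+1 :* b+1) :* ($4 :+ b+1) ∙ $4 :- # 1 ≔ $2 :* # 2 by a-1 ∷ []) refl)
            where b+1 = $2 :* # 2 :+ # 1

      -- For q = 5, and likewise for q = p below: q ∣ e gives q ∣ v, so q² divides 20 p a⁴ and
      -- therefore q divides a, against coprimality.
      5∤e : ¬ + 5 ∣ e
      5∤e 5∣e = descend 5∣e 5∣v
        where
        5∣v : + 5 ∣ v
        5∣v = [ (λ h → h) , (λ h → h) ]′ (euclidℤ v v prime-5 (congruence 5 (v * v ∷ e ∷ + p * quad a ∷ [])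
          ($1 ∷ $0 :- (q⁴ $1 :+ # 20 :* $2) ∷ []) $0 refl
          (5∣e ∷ ≡0⇒∣ 5 (certify (v * v ∷ e ∷ + p ∷ quad a ∷ [])
            ($0 :- (q⁴ $1 :+ # 20 :* ($2 :* $3))) (# 0)
            (# 1 ∙ $0 ≔ q⁴ $1 :+ # 20 :* $2 :* $3 by equation ∷ []) refl) ∷ [])))
        descend : + 5 ∣ e → + 5 ∣ v → ⊥
        descend (divides e′ refl) (divides v′ refl) = common-prime prime-5 (divides e′ refl)
          (congruence 5 (v′ * v′ ∷ quad e′ ∷ a ∷ + p ∷ [])
            ($3 :* $3 :+ # 1 ∷ reduced ∷ []) $2 refl (p≡±2[5] ∷ ≡0⇒∣ 5 reduced≡0 ∷ []))
          where
          reduced : Expr 4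
          reduced = # 5 :* $0 :- # 125 :* $1 :- # 4 :* $3 :* q⁴ $2
          reduced≡0 : ⟦ reduced ⟧ (v′ * v′ ∷ quad e′ ∷ a ∷ + p ∷ []) ≡ 0ℤ
          reduced≡0 = ℤₚ.*-cancelˡ-≡ (+ 5) _ 0ℤ (certify (v′ ∷ e′ ∷ a ∷ + p ∷ [])
            (# 5 :* (# 5 :* ($0 :* $0) :- # 125 :* q⁴ $1 :- # 4 :* $3 :* q⁴ $2)) (# 0)
            (# 1 ∙ $0 :* # 5 :* ($0 :* # 5) ≔ q⁴ ($1 :* # 5) :+ # 20 :* $3 :* q⁴ $2 by equation ∷ []) refl)

      p∤e : ¬ + p ∣ e
      p∤e p∣e = descend p∣e p∣v
        where
        instance _ = ℕ.nonTrivial⇒nonZero p {{prime⇒nonTrivial p-prime}}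
        p∣v : + p ∣ v
        p∣v = [ (λ h → h) , (λ h → h) ]′ (euclidℤ v v p-prime (subst (+ p ∣_) (sym equation)
          (∣m∣n⇒∣m+n (∣m⇒∣m*n (e * e) (∣m⇒∣m*n e p∣e)) (∣m⇒∣m*n (quad a) (∣n⇒∣m*n (+ 20) (∣-refl {+ p}))))))
        descend : + p ∣ e → + p ∣ v → ⊥
        descend (divides e′ refl) (divides v′ refl) =
          [ p∤20 , (λ h → p∤a² ([ (λ h → h) , (λ h → h) ]′ (euclidℤ (a * a) (a * a) p-prime h))) ]′
          (euclidℤ (+ 20) (quad a) p-prime (divides (v′ * v′ - + p * + p * quad e′) reduced))
          where
          p∤a² : ¬ + p ∣ a * a
          p∤a² h = common-prime p-prime (divides e′ refl) ([ (λ h → h) , (λ h → h) ]′ (euclidℤ a a p-prime h))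
          reduced : + 20 * quad a ≡ (v′ * v′ - + p * + p * quad e′) * + p
          reduced = ℤₚ.*-cancelˡ-≡ (+ p) _ _ (certify (v′ ∷ e′ ∷ a ∷ + p ∷ [])
            ($3 :* (# 20 :* q⁴ $2)) ($3 :* (($0 :* $0 :- $3 :* $3 :* q⁴ $1) :* $3))
            (con ℤ.-1ℤ ∙ $0 :* $3 :* ($0 :* $3) ≔ q⁴ ($1 :* $3) :+ # 20 :* $3 :* q⁴ $2 by equation ∷ []) refl)

      e-coprime-2 : Coprime (abs e) 2
      e-coprime-2 = prime-∤⇒coprime prime-2 (λ h → e-odd (∣ᵤ⇒∣ h))

      e-coprime-5 : Coprime (abs e) 5
      e-coprime-5 = prime-∤⇒coprime prime-5 (λ h → 5∤e (∣ᵤ⇒∣ h))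

      e-coprime-p : Coprime (abs e) p
      e-coprime-p = prime-∤⇒coprime p-prime (λ h → p∤e (∣ᵤ⇒∣ h))

      e-coprime-quad : ∀ {k z} → Coprime (abs e) k → Coprime (abs e) z → Coprime (abs e) (k ℕ.* p ℕ.* quadℕ z)
      e-coprime-quad ck cz = coprime-*ʳ (coprime-*ʳ ck e-coprime-p) (coprime-quadʳ cz)

      e-coprime-20 : Coprime (abs e) 20
      e-coprime-20 = coprime-*ʳ {a = 4} (coprime-*ʳ {a = 2} e-coprime-2 e-coprime-2) e-coprime-5

  -- A common divisor of x and y divides their product N, and by `common` it divides E, which is
  -- prime to N. In the applications E is a sum or difference of the factors.
  coprime-of-sum : ∀ {x y E N} → (∀ {k} → k ∣ x → k ∣ y → k ∣ E) → x * y ≡ + N → Coprime (abs E) N →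
    Coprime (abs x) (abs y)
  coprime-of-sum {x} {y} {E} {N} common xy≡N cop {k} (k∣x , k∣y) = cop
    ( ∣⇒∣ᵤ (common {+ k} (∣ᵤ⇒∣ k∣x) (∣ᵤ⇒∣ k∣y))
    , ∣⇒∣ᵤ {+ k} {+ N} (subst (+ k ∣_) xy≡N (∣m⇒∣m*n y (∣ᵤ⇒∣ {+ k} {x} k∣x))) )

  -- The product excludes opposite signs and the weighted sum excludes two negative factors. The
  -- weight `suc c` is 4 where a factor 4 has been taken out of x, and 1 elsewhere.
  positive-factors : ∀ c x y {m n} → x * y ≡ + n → n ≢ 0 → + suc c * x + y ≡ + m → x ≡ + abs x × y ≡ + abs y
  positive-factors c (+ x)    (+ y)    xy n≢0 sum = refl , refl
  positive-factors c (+ zero) -[1+ y ] xy n≢0 sum = ⊥-elim (n≢0 (sym (ℤₚ.+-injective xy)))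
  positive-factors c -[1+ x ] (+ zero) xy n≢0 sum =
    ⊥-elim (n≢0 (ℤₚ.+-injective (trans (sym xy) (ℤₚ.*-zeroʳ -[1+ x ]))))

  Split : ℕ → ℤ → ℤ → ℤ → ℤ → Set
  Split p x y r s =
    (x ≡ quad r × y ≡ + 5 * + p * quad s) ⊎ (x ≡ + 5 * quad r × y ≡ + p * quad s) ⊎
    (x ≡ + p * quad r × y ≡ + 5 * quad s) ⊎ (x ≡ + 5 * + p * quad r × y ≡ quad s)

  split : ∀ {p} c x y z {m} → Prime p → Coprime (abs x) (abs y) → x * y ≡ + 5 * + p * quad z → z ≢ 0ℤ →
    + suc c * x + y ≡ + m → ∃₂ λ r s → + abs z ≡ r * s × Split p x y r s
  split {p} c x y z {m} pp cop xy z≢0 sum =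
    convert (two-primes-quad prime-5 pp cop (ℤₚ.+-injective abs-xy) (λ h → z≢0 (ℤₚ.∣i∣≡0⇒i≡0 h)))
    where
    instance _ = ℕ.nonTrivial⇒nonZero p {{prime⇒nonTrivial pp}}
    N = 5 ℕ.* p ℕ.* quadℕ (abs z)
    ∣z∣≢0 : abs z ≢ 0
    ∣z∣≢0 h = z≢0 (ℤₚ.∣i∣≡0⇒i≡0 h)
    N≢0 : N ≢ 0
    N≢0 = *-≢0ℕ (*-≢0ℕ {5} (λ ()) (ℕ.≢-nonZero⁻¹ p)) (*-≢0ℕ (*-≢0ℕ ∣z∣≢0 ∣z∣≢0) (*-≢0ℕ ∣z∣≢0 ∣z∣≢0))
    pos = positive-factors c x y (trans xy (pos-quad 5 p z)) N≢0 sum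
    abs-xy : + (abs x ℕ.* abs y) ≡ + N
    abs-xy = trans (ℤₚ.pos-* (abs x) (abs y)) (trans (cong₂ _*_ (sym (proj₁ pos)) (sym (proj₂ pos))) (trans xy (pos-quad 5 p z)))
    quadᶻ : ∀ {w n} → w ≡ + abs w → abs w ≡ quadℕ n → w ≡ quad (+ n)
    quadᶻ {n = n} w≥0 h = trans w≥0 (trans (cong +_ h) (abs-quad (+ n)))
    timesᶻ : ∀ {w n} q → w ≡ + abs w → abs w ≡ q ℕ.* quadℕ n → w ≡ + q * quad (+ n)
    timesᶻ {n = n} q w≥0 h = trans w≥0 (trans (cong +_ h) (trans (ℤₚ.pos-* q _) (cong (+ q *_) (abs-quad (+ n)))))
    times₂ᶻ : ∀ {w n} q q′ → w ≡ + abs w → abs w ≡ q ℕ.* q′ ℕ.* quadℕ n → w ≡ + q * + q′ * quad (+ n)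
    times₂ᶻ {n = n} q q′ w≥0 h = trans (timesᶻ {n = n} (q ℕ.* q′) w≥0 h) (cong (_* quad (+ n)) (ℤₚ.pos-* q q′))
    convert : TwoPrimesSplit 5 p (abs x) (abs y) (abs z) → ∃₂ λ r s → + abs z ≡ r * s × Split p x y r s
    convert (r , s , z≡rs , cases) = + r , + s , trans (cong +_ z≡rs) (ℤₚ.pos-* r s) , go cases
      where
      go : (abs x ≡ quadℕ r × abs y ≡ 5 ℕ.* p ℕ.* quadℕ s) ⊎ (abs x ≡ 5 ℕ.* quadℕ r × abs y ≡ p ℕ.* quadℕ s) ⊎
        (abs x ≡ p ℕ.* quadℕ r × abs y ≡ 5 ℕ.* quadℕ s) ⊎ (abs x ≡ 5 ℕ.* p ℕ.* quadℕ r × abs y ≡ quadℕ s) →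
        Split p x y (+ r) (+ s)
      go (inj₁ (a , b)) = inj₁ (quadᶻ {n = r} (proj₁ pos) a , times₂ᶻ {n = s} 5 p (proj₂ pos) b)
      go (inj₂ (inj₁ (a , b))) = inj₂ (inj₁ (timesᶻ {n = r} 5 (proj₁ pos) a , timesᶻ {n = s} p (proj₂ pos) b))
      go (inj₂ (inj₂ (inj₁ (a , b)))) = inj₂ (inj₂ (inj₁ (timesᶻ {n = r} p (proj₁ pos) a , timesᶻ {n = s} 5 (proj₂ pos) b)))
      go (inj₂ (inj₂ (inj₂ (a , b)))) = inj₂ (inj₂ (inj₂ (times₂ᶻ {n = r} 5 p (proj₁ pos) a , quadᶻ {n = s} (proj₂ pos) b)))

  ∤5⇒fermat : ∀ {x} → ¬ + 5 ∣ x → + 5 ∣ quad x - 1ℤ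
  ∤5⇒fermat {x} 5∤x = [ (λ h → ⊥-elim (5∤x h)) , (λ h → h) ]′ (euclidℤ x (quad x - 1ℤ) prime-5
    (congruence 5 (x ∷ []) [] ($0 :* (q⁴ $0 :- # 1)) refl []))

  odd-square : ∀ {x} → ¬ + 2 ∣ x → + 4 ∣ x * x - 1ℤ
  odd-square {x} 2∤x = go (odd⇒ 2∤x)
    where
    go : + 2 ∣ x - 1ℤ → + 4 ∣ x * x - 1ℤ
    go (divides b eq) = divides (b * b + b) (certify (b ∷ x ∷ [])
      ($1 :* $1 :- # 1) (($0 :* $0 :+ $0) :* # 4)
      ($1 :+ # 1 :+ # 2 :* $0 ∙ $1 :- # 1 ≔ $0 :* # 2 by eq ∷ []) refl)

  -- (a / e , v / e²) is, up to sign, the duplicate of the point (n / m , r / m²) of w² = 1 + 20 p u⁴.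
  record Double (p : ℕ) (a e v : ℤ) : Set where
    constructor double
    field
      {m n r} : ℤ
      on      : r * r ≡ quad m + + 20 * + p * quad n
      a²-eq   : a * a ≡ + 2 * r * m * n * (+ 2 * r * m * n)
      e²-eq   : e * e ≡ (quad m - + 20 * + p * quad n) * (quad m - + 20 * + p * quad n)
      v-eq    : v ≡ quad r + + 80 * + p * (quad m * quad n)

  -- The same for (n / m , 2 r / m²) on the twist ω² = 10 + 2 p ν⁴.
  record Twisted (p : ℕ) (a e v : ℤ) : Set where
    constructor twisted
    field
      {m n r} : ℤ
      on      : + 2 * (r * r) ≡ + 5 * quad m + + p * quad n
      a²-eq   : a * a ≡ r * m * n * (r * m * n)
      e²-eq   : + 4 * (e * e) ≡ (+ 5 * quad m - + p * quad n) * (+ 5 * quad m - + p * quad n)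
      v-eq    : v ≡ quad r + + 5 * + p * (quad m * quad n)

  -- The content of `Double` in terms of t, where s = 2 t: the half is (n / m , r / m²).
  Halved : ℕ → ℤ → ℤ → ℤ → Set
  Halved p e r t = ∃₂ λ m n → t * t ≡ m * n * (m * n) × r * r ≡ quad m + + 20 * + p * quad n ×
    e * e ≡ (quad m - + 20 * + p * quad n) * (quad m - + 20 * + p * quad n)

  module _ {p} (adm : Admissible p) where
    open Admissible adm

    -- The case x even of x y = 20 p t⁴, where x and y are (r² ± e) / 2.
    split-even : ∀ {e r t x y} → ¬ + 2 ∣ r → ¬ + 5 ∣ r → t ≢ 0ℤ → Coprime (abs x) (abs y) →
      x * y ≡ + 20 * + p * quad t → x + y ≡ r * r → e * e ≡ (x - y) * (x - y) → + 2 ∣ x →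
      Halved p e r t
    split-even {e} {r} {t} {x} {y} 2∤r 5∤r t≢0 cop xy x+y e² 2∣x = step₁ 2∣x
      where
      fermat : + 5 ∣ quad r - 1ℤ
      fermat = ∤5⇒fermat 5∤r
      2∤y : ¬ + 2 ∣ y
      2∤y 2∣y with cop {2} (∣⇒∣ᵤ 2∣x , ∣⇒∣ᵤ 2∣y)
      ... | ()
      step₃ : ∀ z → x ≡ z * + 4 → (∃₂ λ n m → + abs t ≡ n * m × Split p z y n m) → Halved p e r t
      -- Here r² = 4 n⁴ + 5 p m⁴ is 0 or 3 modulo 4, while r is odd.
      step₃ z x≡4z (n , m , t≡ , inj₁ (z≡ , y≡)) = ⊥-elim (inconsistent 4 (r ∷ n ∷ m ∷ + p ∷ [])
        ($3 :+ # 1 ∷ $0 :* $0 :- # 1 ∷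
         $0 :* $0 :- # 4 :* q⁴ $1 :- # 5 :* $3 :* q⁴ $2 ∷ []) refl (λ ())
        (p≡3[4] ∷ odd-square 2∤r ∷ ≡0⇒∣ 4 (certify (r ∷ n ∷ m ∷ + p ∷ x ∷ y ∷ z ∷ [])
          ($0 :* $0 :- # 4 :* q⁴ $1 :- # 5 :* $3 :* q⁴ $2) (# 0)
          ( con ℤ.-1ℤ ∙ $4 :+ $5 ≔ $0 :* $0 by x+y
          ∷ # 1 ∙ $4 ≔ $6 :* # 4 by x≡4z
          ∷ # 4 ∙ $6 ≔ q⁴ $1 by z≡
          ∷ # 1 ∙ $5 ≔ # 5 :* $3 :* q⁴ $2 by y≡ ∷ []) refl) ∷ []))
      -- Here and in the next case r² is ± p times a fourth power modulo 5, hence 0 or ± 2; but r⁴ ≡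
      -- 1 makes it ± 1.
      step₃ z x≡4z (n , m , t≡ , inj₂ (inj₁ (z≡ , y≡))) = ⊥-elim (inconsistent 5 (r ∷ quad n ∷ m ∷ + p ∷ [])
        ($3 :* $3 :+ # 1 ∷ q⁴ $0 :- # 1 ∷
         $0 :* $0 :- # 20 :* $1 :- $3 :* q⁴ $2 ∷ []) refl (λ ())
        (p≡±2[5] ∷ fermat ∷ ≡0⇒∣ 5 (certify (r ∷ quad n ∷ m ∷ + p ∷ x ∷ y ∷ z ∷ [])
          ($0 :* $0 :- # 20 :* $1 :- $3 :* q⁴ $2) (# 0)
          ( con ℤ.-1ℤ ∙ $4 :+ $5 ≔ $0 :* $0 by x+y
          ∷ # 1 ∙ $4 ≔ $6 :* # 4 by x≡4z
          ∷ # 4 ∙ $6 ≔ # 5 :* $1 by z≡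
          ∷ # 1 ∙ $5 ≔ $3 :* q⁴ $2 by y≡ ∷ []) refl) ∷ []))
      step₃ z x≡4z (n , m , t≡ , inj₂ (inj₂ (inj₁ (z≡ , y≡)))) = ⊥-elim (inconsistent 5 (r ∷ n ∷ quad m ∷ + p ∷ [])
        ($3 :* $3 :+ # 1 ∷ q⁴ $0 :- # 1 ∷
         $0 :* $0 :- # 4 :* $3 :* q⁴ $1 :- # 5 :* $2 ∷ []) refl (λ ())
        (p≡±2[5] ∷ fermat ∷ ≡0⇒∣ 5 (certify (r ∷ n ∷ quad m ∷ + p ∷ x ∷ y ∷ z ∷ [])
          ($0 :* $0 :- # 4 :* $3 :* q⁴ $1 :- # 5 :* $2) (# 0)
          ( con ℤ.-1ℤ ∙ $4 :+ $5 ≔ $0 :* $0 by x+y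
          ∷ # 1 ∙ $4 ≔ $6 :* # 4 by x≡4z
          ∷ # 4 ∙ $6 ≔ $3 :* q⁴ $1 by z≡
          ∷ # 1 ∙ $5 ≔ # 5 :* $2 by y≡ ∷ []) refl) ∷ []))
      -- The surviving case r² = m⁴ + 20 p n⁴ is a point of the original curve.
      step₃ z x≡4z (n , m , t≡ , inj₂ (inj₂ (inj₂ (z≡ , y≡)))) = m , n ,
        trans (sym (abs-square t)) (trans (cong₂ _*_ t≡ t≡) (certify (m ∷ n ∷ [])
          ($1 :* $0 :* ($1 :* $0)) ($0 :* $1 :* ($0 :* $1)) [] refl)) ,
        certify ρ ($0 :* $0) (q⁴ $2 :+ # 20 :* $3 :* q⁴ $1)
          ( con ℤ.-1ℤ ∙ $4 :+ $5 ≔ $0 :* $0 by x+y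
          ∷ # 1 ∙ $4 ≔ $6 :* # 4 by x≡4z
          ∷ # 4 ∙ $6 ≔ # 5 :* $3 :* q⁴ $1 by z≡
          ∷ # 1 ∙ $5 ≔ q⁴ $2 by y≡ ∷ []) refl ,
        trans e² (trans (cong₂ _*_ x-y x-y) (certify (quad m ∷ + 20 * + p * quad n ∷ [])
          (($1 :- $0) :* ($1 :- $0)) (($0 :- $1) :* ($0 :- $1)) [] refl))
        where
        ρ = r ∷ n ∷ m ∷ + p ∷ x ∷ y ∷ z ∷ []
        x-y : x - y ≡ + 20 * + p * quad n - quad m
        x-y = certify ρ ($4 :- $5) (# 20 :* $3 :* q⁴ $1 :- q⁴ $2)
          ( # 1 ∙ $4 ≔ $6 :* # 4 by x≡4z
          ∷ # 4 ∙ $6 ≔ # 5 :* $3 :* q⁴ $1 by z≡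
          ∷ con ℤ.-1ℤ ∙ $5 ≔ q⁴ $2 by y≡ ∷ []) refl
      step₂ : ∀ x′ → x ≡ x′ * + 2 → + 2 ∣ x′ → Halved p e r t
      step₂ x′ x≡2x′ (divides z x′≡2z) = step₃ z x≡4z (split 3 z y t {abs (r * r)} p-prime
        (coprime-∣ˡ (∣⇒∣ᵤ (divides (+ 4) (trans x≡4z (ℤₚ.*-comm z (+ 4))))) cop)
        (ℤₚ.*-cancelˡ-≡ (+ 4) _ _ (certify (x ∷ y ∷ z ∷ + p ∷ quad t ∷ [])
          (# 4 :* ($2 :* $1)) (# 4 :* (# 5 :* $3 :* $4))
          ( # 1 ∙ $0 :* $1 ≔ # 20 :* $3 :* $4 by xy
          ∷ # 0 :- $1 ∙ $0 ≔ $2 :* # 4 by x≡4z ∷ []) refl))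
        t≢0
        (trans (trans (cong (_+ y) (trans (ℤₚ.*-comm (+ 4) z) (sym x≡4z))) x+y) (square-abs r)))
        where
        x≡4z : x ≡ z * + 4
        x≡4z = certify (x ∷ x′ ∷ z ∷ []) $0 ($2 :* # 4)
          (# 1 ∙ $0 ≔ $1 :* # 2 by x≡2x′ ∷ # 2 ∙ $1 ≔ $2 :* # 2 by x′≡2z ∷ []) refl
      step₁ : + 2 ∣ x → Halved p e r t
      -- Since y is odd, the factor 4 of 20 p t⁴ lies entirely in x; with x = 4 z there remains z y
      -- = 5 p t⁴.
      step₁ (divides x′ x≡2x′) = step₂ x′ x≡2x′ ([ (λ h → h) , (λ h → ⊥-elim (2∤y h)) ]′ (euclidℤ x′ y prime-2
        (divides (+ 5 * + p * quad t) (ℤₚ.*-cancelˡ-≡ (+ 2) _ _ (certify (x ∷ y ∷ x′ ∷ + p ∷ quad t ∷ [])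
          (# 2 :* ($2 :* $1)) (# 2 :* (# 5 :* $3 :* $4 :* # 2))
          ( # 1 ∙ $0 :* $1 ≔ # 20 :* $3 :* $4 by xy
          ∷ # 0 :- $1 ∙ $0 ≔ $2 :* # 2 by x≡2x′ ∷ []) refl)))))

    module _ {a e V} (prim : Primitive p a e (+ V)) (a≢0 : a ≢ 0ℤ) where
      open Primitive prim

      private
        v = + V

        Outcome = Double p a e v ⊎ Twisted p a e v

        2∤e : ¬ + 2 ∣ e
        2∤e = e-odd adm prim

        fermat-e : + 5 ∣ quad e - 1ℤ
        fermat-e = ∤5⇒fermat (5∤e adm prim)

        -- The second factorisation is (r² - e) (r² + e) = 5 p s⁴. For odd s the two factors are
        -- coprime. For s = 2 t both are even, and their halves are coprime with product 20 p t⁴.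
        module Second (r s : ℤ) (a≡rs : + abs a ≡ r * s) (e² : e * e ≡ quad r - + 5 * + p * quad s)
                      (v-eq : v ≡ quad r + + 5 * + p * quad s) where
          a²≡r²s² : a * a ≡ r * s * (r * s)
          a²≡r²s² = trans (sym (abs-square a)) (cong₂ _*_ a≡rs a≡rs)

          s≢0 : s ≢ 0ℤ
          s≢0 refl = a≢0 (ℤₚ.∣i∣≡0⇒i≡0 (ℤₚ.+-injective (trans a≡rs (ℤₚ.*-zeroʳ r))))

          e⊥s : Coprime (abs e) (abs s)
          e⊥s = C.sym (coprime-∣ˡ (∣⇒∣ᵤ {s} {+ abs a} (divides r a≡rs)) coprime)

          fermat-r : + 5 ∣ quad r - 1ℤ
          fermat-r = congruence 5 (r ∷ e ∷ + p * quad s ∷ [])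
            (q⁴ $1 :- # 1 ∷ $1 :* $1 :- (q⁴ $0 :- # 5 :* $2) ∷ []) (q⁴ $0 :- # 1) refl
            (fermat-e ∷ ≡0⇒∣ 5 (certify (r ∷ e ∷ + p ∷ quad s ∷ [])
              ($1 :* $1 :- (q⁴ $0 :- # 5 :* ($2 :* $3))) (# 0)
              (# 1 ∙ $1 :* $1 ≔ q⁴ $0 :- # 5 :* $2 :* $3 by e² ∷ []) refl) ∷ [])

          E₁ E₂ : ℤ
          E₁ = r * r - e
          E₂ = r * r + e

          E₁E₂ : E₁ * E₂ ≡ + 5 * + p * quad s
          E₁E₂ = certify (r ∷ e ∷ + p ∷ quad s ∷ [])
            (($0 :* $0 :- $1) :* ($0 :* $0 :+ $1)) (# 5 :* $2 :* $3)
            (con ℤ.-1ℤ ∙ $1 :* $1 ≔ q⁴ $0 :- # 5 :* $2 :* $3 by e² ∷ []) refl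

          module Odd (2∤s : ¬ + 2 ∣ s) where
            2⊥N : Coprime 2 (5 ℕ.* p ℕ.* quadℕ (abs s))
            2⊥N = C.sym (prime-∤⇒coprime prime-2 (λ h → 2∤N (subst (+ 2 ∣_) (sym (pos-quad 5 p s)) (∣ᵤ⇒∣ h))))
              where
              2∤N : ¬ + 2 ∣ + 5 * + p * quad s
              2∤N h = inconsistent 4 (quad s ∷ + p ∷ quotient h ∷ [])
                ($1 :+ # 1 ∷ # 5 :* $1 :* $0 :- $2 :* # 2 ∷ $0 :- # 1 ∷ []) refl (λ ())
                (p≡3[4] ∷ ≡0⇒∣ 4 (certify (quad s ∷ + p ∷ quotient h ∷ [])
                   (# 5 :* $1 :* $0 :- $2 :* # 2) (# 0)
                   (# 1 ∙ # 5 :* $1 :* $0 ≔ $2 :* # 2 by _∣_.equality h ∷ []) refl)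
                ∷ congruence 4 (s * s ∷ []) ($0 :- # 1 ∷ []) ($0 :* $0 :- # 1) refl (odd-square 2∤s ∷ []) ∷ [])

            E₁⊥E₂ : Coprime (abs E₁) (abs E₂)
            E₁⊥E₂ = coprime-of-sum {E₁} {E₂} {+ 2 * e}
              (λ {k} h₁ h₂ → subst (k ∣_) (certify (r ∷ e ∷ [])
                (($0 :* $0 :+ $1) :- ($0 :* $0 :- $1)) (# 2 :* $1) [] refl) (∣m∣n⇒∣m-n h₂ h₁))
              (trans E₁E₂ (pos-quad 5 p s))
              (subst (λ t → Coprime t (5 ℕ.* p ℕ.* quadℕ (abs s))) (sym (ℤₚ.abs-* (+ 2) e)) (coprime-*ˡ 2⊥N (e-coprime-quad adm prim (e-coprime-5 adm prim) e⊥s)))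

            sum : + 1 * E₁ + E₂ ≡ + (2 ℕ.* abs (r * r))
            sum = trans (certify (r ∷ e ∷ [])
                (# 1 :* ($0 :* $0 :- $1) :+ ($0 :* $0 :+ $1)) (# 2 :* ($0 :* $0)) [] refl)
              (trans (cong (+ 2 *_) (square-abs r)) (sym (ℤₚ.pos-* 2 (abs (r * r)))))

            -- Modulo 5 the left side is ± 2, because r⁴ ≡ 1, whereas a fourth power is 0 or 1.
            no-square : ∀ m z → ¬ + 2 * (r * r) ≡ quad m + + 5 * + p * z
            no-square m z h = inconsistent 5 (r ∷ m ∷ + p * z ∷ [])
              (# 2 :* ($0 :* $0) :- (q⁴ $1 :+ # 5 :* $2) ∷ q⁴ $0 :- # 1 ∷ []) refl (λ ())
              (≡0⇒∣ 5 (certify (r ∷ m ∷ + p ∷ z ∷ []) (# 2 :* ($0 :* $0) :- (q⁴ $1 :+ # 5 :* ($2 :* $3))) (# 0)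
                (# 1 ∙ # 2 :* ($0 :* $0) ≔ q⁴ $1 :+ # 5 :* $2 :* $3 by h ∷ []) refl) ∷ fermat-r ∷ [])

            twisted-outcome : ∀ m n → s * s ≡ m * n * (m * n) → + 2 * (r * r) ≡ + 5 * quad m + + p * quad n →
              + 4 * (e * e) ≡ (+ 5 * quad m - + p * quad n) * (+ 5 * quad m - + p * quad n) → Outcome
            twisted-outcome m n s² on e²-eq = inj₂ (twisted {m = m} {n} {r} on
              (trans a²≡r²s² (certify ρ ($0 :* $1 :* ($0 :* $1)) ($0 :* $2 :* $3 :* ($0 :* $2 :* $3))
                ($0 :* $0 ∙ $1 :* $1 ≔ $2 :* $3 :* ($2 :* $3) by s² ∷ []) refl))
              e²-eq
              (trans v-eq (certify ρ (q⁴ $0 :+ # 5 :* $4 :* q⁴ $1) (q⁴ $0 :+ # 5 :* $4 :* (q⁴ $2 :* q⁴ $3))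
                (# 5 :* $4 :* ($1 :* $1 :+ $2 :* $3 :* ($2 :* $3)) ∙ $1 :* $1 ≔ $2 :* $3 :* ($2 :* $3) by s² ∷ []) refl)))
              where ρ = r ∷ s ∷ m ∷ n ∷ + p ∷ []

            2r²≡ : ∀ {x y} → E₁ ≡ x → E₂ ≡ y → + 2 * (r * r) ≡ x + y
            2r²≡ refl refl = certify (r ∷ e ∷ []) (# 2 :* ($0 :* $0)) (($0 :* $0 :- $1) :+ ($0 :* $0 :+ $1)) [] refl

            4e²≡ : ∀ {x y} → E₁ ≡ x → E₂ ≡ y → + 4 * (e * e) ≡ (x - y) * (x - y)
            4e²≡ refl refl = certify (r ∷ e ∷ []) (# 4 :* ($1 :* $1)) (δ :* δ) [] refl
              where δ = ($0 :* $0 :- $1) :- ($0 :* $0 :+ $1)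

            s²≡ : ∀ m n → + abs s ≡ m * n → s * s ≡ m * n * (m * n)
            s²≡ m n s≡ = trans (sym (abs-square s)) (cong₂ _*_ s≡ s≡)

            square-difference-comm : ∀ x y → (x - y) * (x - y) ≡ (y - x) * (y - x)
            square-difference-comm x y = certify (x ∷ y ∷ []) (($0 :- $1) :* ($0 :- $1)) (($1 :- $0) :* ($1 :- $0)) [] refl

            finish : (∃₂ λ m n → + abs s ≡ m * n × Split p E₁ E₂ m n) → Outcome
            finish (m , n , s≡ , inj₁ (E₁≡ , E₂≡)) = ⊥-elim (no-square m (quad n) (2r²≡ E₁≡ E₂≡))
            finish (m , n , s≡ , inj₂ (inj₁ (E₁≡ , E₂≡))) = twisted-outcome m n (s²≡ m n s≡) (2r²≡ E₁≡ E₂≡) (4e²≡ E₁≡ E₂≡)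
            finish (n , m , s≡ , inj₂ (inj₂ (inj₁ (E₁≡ , E₂≡)))) = twisted-outcome m n
              (s²≡ m n (trans s≡ (ℤₚ.*-comm n m))) (trans (2r²≡ E₁≡ E₂≡) (ℤₚ.+-comm (+ p * quad n) (+ 5 * quad m)))
              (trans (4e²≡ E₁≡ E₂≡) (square-difference-comm (+ p * quad n) (+ 5 * quad m)))
            finish (n , m , s≡ , inj₂ (inj₂ (inj₂ (E₁≡ , E₂≡)))) = ⊥-elim (no-square m (quad n)
              (trans (2r²≡ E₁≡ E₂≡) (ℤₚ.+-comm (+ 5 * + p * quad n) (quad m))))

            outcome : Outcome
            outcome = finish (split 0 E₁ E₂ s p-prime E₁⊥E₂ E₁E₂ s≢0 sum)

          module Even (t : ℤ) (s≡2t : s ≡ t * + 2) where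
            e²′ : e * e - (quad r - + 10 * (+ 8 * + p * quad t)) ≡ 0ℤ
            e²′ = certify (r ∷ e ∷ + p ∷ t ∷ s ∷ [])
              ($1 :* $1 :- (q⁴ $0 :- # 10 :* (# 8 :* $2 :* q⁴ $3))) (# 0)
              ( # 1 ∙ $1 :* $1 ≔ q⁴ $0 :- # 5 :* $2 :* q⁴ $4 by e²
              ∷ # 0 :- # 5 :* $2 :* ($4 :* $4 :+ # 4 :* $3 :* $3) :* ($4 :+ # 2 :* $3)
                ∙ $4 ≔ $3 :* # 2 by s≡2t ∷ []) refl

            2∤r : ¬ + 2 ∣ r
            2∤r 2∣r = 2∤e (congruence 2 (r ∷ e ∷ + 8 * + p * quad t ∷ [])
              ($0 ∷ $1 :* $1 :- (q⁴ $0 :- # 10 :* $2) ∷ []) $1 refl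
              (2∣r ∷ ≡0⇒∣ 2 e²′ ∷ []))

            5∤r : ¬ + 5 ∣ r
            5∤r 5∣r = inconsistent 5 (r ∷ []) ($0 ∷ q⁴ $0 :- # 1 ∷ []) refl (λ ()) (5∣r ∷ fermat-r ∷ [])

            t≢0 : t ≢ 0ℤ
            t≢0 refl = s≢0 s≡2t

            e⊥t : Coprime (abs e) (abs t)
            e⊥t = C.sym (coprime-∣ˡ (∣⇒∣ᵤ {t} {s} (divides (+ 2) (trans s≡2t (ℤₚ.*-comm t (+ 2))))) (C.sym e⊥s))

            conclude : Halved p e r t → Outcome
            conclude (m , n , t² , on , e²-eq) = inj₁ (double {m = m} {n} {r} on
              (trans a²≡r²s² (certify ρ ($0 :* $4 :* ($0 :* $4))
                (# 2 :* $0 :* $1 :* $2 :* (# 2 :* $0 :* $1 :* $2))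
                ( $0 :* $0 :* ($4 :+ # 2 :* $3) ∙ $4 ≔ $3 :* # 2 by s≡2t
                ∷ # 4 :* ($0 :* $0) ∙ $3 :* $3 ≔ $1 :* $2 :* ($1 :* $2) by t² ∷ []) refl))
              e²-eq
              (trans v-eq (certify ρ (q⁴ $0 :+ # 5 :* $5 :* q⁴ $4)
                (q⁴ $0 :+ # 80 :* $5 :* (q⁴ $1 :* q⁴ $2))
                ( # 5 :* $5 :* ($4 :* $4 :+ # 4 :* $3 :* $3) :* ($4 :+ # 2 :* $3)
                  ∙ $4 ≔ $3 :* # 2 by s≡2t
                ∷ # 80 :* $5 :* ($3 :* $3 :+ $1 :* $2 :* ($1 :* $2))
                  ∙ $3 :* $3 ≔ $1 :* $2 :* ($1 :* $2) by t² ∷ []) refl)))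
              where
              ρ = r ∷ m ∷ n ∷ t ∷ s ∷ + p ∷ []

            module Halves (c : ℤ) (c-eq : r * r - e ≡ c * + 2) where
              c[c+e] : c * (c + e) ≡ + 20 * + p * quad t
              c[c+e] = ℤₚ.*-cancelˡ-≡ (+ 4) _ _ (certify (r ∷ e ∷ + p ∷ quad t ∷ c ∷ [])
                (# 4 :* ($4 :* ($4 :+ $1))) (# 4 :* (# 20 :* $2 :* $3))
                ( con ℤ.-1ℤ ∙ $1 :* $1 :- (q⁴ $0 :- # 10 :* (# 8 :* $2 :* $3)) ≔ # 0 by e²′
                ∷ # 0 :- (# 2 :* $4 :+ $0 :* $0 :+ $1) ∙ $0 :* $0 :- $1 ≔ $4 :* # 2 by c-eq
                ∷ []) refl)

              c⊥c+e : Coprime (abs c) (abs (c + e))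
              c⊥c+e = coprime-of-sum {c} {c + e} {e} (λ {k} h₁ h₂ → ∣m+n∣m⇒∣n {k} {c} {e} h₂ h₁) (trans c[c+e] (pos-quad 20 p t))
                (e-coprime-quad adm prim {20} (e-coprime-20 adm prim) e⊥t)

              sum : c + (c + e) ≡ r * r
              sum = certify (r ∷ e ∷ c ∷ []) ($2 :+ ($2 :+ $1)) ($0 :* $0)
                (con ℤ.-1ℤ ∙ $0 :* $0 :- $1 ≔ $2 :* # 2 by c-eq ∷ []) refl

              outcome : Outcome
              outcome = [ (λ 2∣c → conclude (split-even {e} {r} {t} 2∤r 5∤r t≢0 c⊥c+e c[c+e] sum
                              (certify (e ∷ c ∷ []) ($0 :* $0)
                                (($1 :- ($1 :+ $0)) :* ($1 :- ($1 :+ $0))) [] refl) 2∣c))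
                        , (λ 2∣c+e → conclude (split-even {e} {r} {t} 2∤r 5∤r t≢0 (C.sym c⊥c+e) (trans (ℤₚ.*-comm (c + e) c) c[c+e])
                              (trans (ℤₚ.+-comm (c + e) c) sum)
                              (certify (e ∷ c ∷ []) ($0 :* $0)
                                ((($1 :+ $0) :- $1) :* (($1 :+ $0) :- $1)) [] refl) 2∣c+e)) ]′
                (euclidℤ c (c + e) prime-2 (divides (+ 10 * + p * quad t)
                  (trans c[c+e] (certify (+ p ∷ quad t ∷ [])
                    (# 20 :* $0 :* $1) (# 10 :* $0 :* $1 :* # 2) [] refl))))

            outcome : Outcome
            outcome = go (congruence 2 (r ∷ e ∷ + 8 * + p * quad t ∷ [])
              ($1 :* $1 :- (q⁴ $0 :- # 10 :* $2) ∷ []) ($0 :* $0 :- $1) refl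
              (≡0⇒∣ 2 e²′ ∷ []))
              where
              go : + 2 ∣ r * r - e → Outcome
              go (divides c c-eq) = Halves.outcome c c-eq

          outcome : Outcome
          outcome = by-parity (+ 2 ∣? s)
            where
            by-parity : Dec (+ 2 ∣ s) → Outcome
            by-parity (yes (divides t s≡2t)) = Even.outcome t s≡2t
            by-parity (no 2∤s)               = Odd.outcome 2∤s

        -- b = (v - e²) / 2 and b + e² are coprime, with product 5 p a⁴.
        module First (b : ℤ) (b-eq : v - e * e ≡ b * + 2) where
          product : (b + e * e) * b ≡ + 5 * + p * quad a
          product = ℤₚ.*-cancelˡ-≡ (+ 4) _ _ (certify (v ∷ e ∷ + p ∷ quad a ∷ b ∷ [])
            (# 4 :* (($4 :+ $1 :* $1) :* $4)) (# 4 :* (# 5 :* $2 :* $3))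
            ( # 1 ∙ $0 :* $0 ≔ q⁴ $1 :+ # 20 :* $2 :* $3 by equation
            ∷ # 0 :- ($0 :+ # 2 :* $4 :+ $1 :* $1) ∙ $0 :- $1 :* $1 ≔ $4 :* # 2 by b-eq
            ∷ []) refl)

          coprime-b : Coprime (abs (b + e * e)) (abs b)
          coprime-b = coprime-of-sum {b + e * e} {b} {e * e} (λ {k} h₁ h₂ → ∣m+n∣m⇒∣n {k} {b} {e * e} h₁ h₂)
            (trans product (pos-quad 5 p a))
            (subst (λ t → Coprime t (5 ℕ.* p ℕ.* quadℕ (abs a))) (sym (ℤₚ.abs-* e e))
              (coprime-*ˡ e⊥N e⊥N))
            where e⊥N = e-coprime-quad adm prim (e-coprime-5 adm prim) (C.sym coprime)

          sum : + 1 * (b + e * e) + b ≡ + V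
          sum = certify (v ∷ e ∷ b ∷ [])
            (# 1 :* ($2 :+ $1 :* $1) :+ $2) $0
            (con ℤ.-1ℤ ∙ $0 :- $1 :* $1 ≔ $2 :* # 2 by b-eq ∷ []) refl

          finish : (∃₂ λ r s → + abs a ≡ r * s × Split p (b + e * e) b r s) → Outcome
          -- The surviving case b + e² = r⁴, b = 5 p s⁴: subtraction gives e², addition gives v.
          finish (r , s , a≡ , inj₁ (x≡ , b≡)) = Second.outcome r s a≡
            (certify (b ∷ e * e ∷ quad r ∷ + 5 * + p * quad s ∷ [])
              $1 ($2 :- $3)
              (# 1 ∙ $0 :+ $1 ≔ $2 by x≡ ∷ con ℤ.-1ℤ ∙ $0 ≔ $3 by b≡ ∷ []) refl)
            (certify (b ∷ e * e ∷ quad r ∷ + 5 * + p * quad s ∷ v ∷ [])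
              $4 ($2 :+ $3)
              (# 1 ∙ $0 :+ $1 ≔ $2 by x≡ ∷ # 1 ∙ $0 ≔ $3 by b≡
               ∷ # 1 ∙ $4 :- $1 ≔ $0 :* # 2 by b-eq ∷ []) refl)
          -- Here e² = 5 r⁴ - p s⁴, and in the next case e² = p r⁴ - 5 s⁴: modulo 5 these are 0 or ±
          -- 2, while e⁴ ≡ 1 makes e² equal to ± 1.
          finish (r , s , a≡ , inj₂ (inj₁ (x≡ , b≡))) = ⊥-elim (inconsistent 5 (e ∷ quad r ∷ s ∷ + p ∷ [])
            (q⁴ $0 :- # 1 ∷ $3 :* $3 :+ # 1 ∷ # 5 :* $1 :- $3 :* q⁴ $2 :- $0 :* $0 ∷ [])
            refl (λ ()) (fermat-e ∷ p≡±2[5] ∷ ≡0⇒∣ 5 (certify (e ∷ quad r ∷ s ∷ + p ∷ b ∷ [])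
              (# 5 :* $1 :- $3 :* q⁴ $2 :- $0 :* $0) (# 0)
              (con ℤ.-1ℤ ∙ $4 :+ $0 :* $0 ≔ # 5 :* $1 by x≡
               ∷ # 1 ∙ $4 ≔ $3 :* q⁴ $2 by b≡ ∷ []) refl) ∷ []))
          finish (r , s , a≡ , inj₂ (inj₂ (inj₁ (x≡ , b≡)))) = ⊥-elim (inconsistent 5 (e ∷ r ∷ quad s ∷ + p ∷ [])
            (q⁴ $0 :- # 1 ∷ $3 :* $3 :+ # 1 ∷ $3 :* q⁴ $1 :- # 5 :* $2 :- $0 :* $0 ∷ [])
            refl (λ ()) (fermat-e ∷ p≡±2[5] ∷ ≡0⇒∣ 5 (certify (e ∷ r ∷ quad s ∷ + p ∷ b ∷ [])
              ($3 :* q⁴ $1 :- # 5 :* $2 :- $0 :* $0) (# 0)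
              (con ℤ.-1ℤ ∙ $4 :+ $0 :* $0 ≔ $3 :* q⁴ $1 by x≡
               ∷ # 1 ∙ $4 ≔ # 5 :* $2 by b≡ ∷ []) refl) ∷ []))
          -- Here e² = 5 p r⁴ - s⁴ is 0, 2 or 3 modulo 4, never the square of an odd number.
          finish (r , s , a≡ , inj₂ (inj₂ (inj₂ (x≡ , b≡)))) = ⊥-elim (inconsistent 4 (e * e ∷ r ∷ s ∷ + p ∷ [])
            ($0 :- # 1 ∷ $3 :+ # 1 ∷ # 5 :* $3 :* q⁴ $1 :- q⁴ $2 :- $0 ∷ [])
            refl (λ ()) (odd-square 2∤e ∷ p≡3[4] ∷ ≡0⇒∣ 4 (certify (e * e ∷ r ∷ s ∷ + p ∷ b ∷ [])
              (# 5 :* $3 :* q⁴ $1 :- q⁴ $2 :- $0) (# 0)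
              (con ℤ.-1ℤ ∙ $4 :+ $0 ≔ # 5 :* $3 :* q⁴ $1 by x≡
               ∷ # 1 ∙ $4 ≔ q⁴ $2 by b≡ ∷ []) refl) ∷ []))

          outcome : Outcome
          outcome = finish (split 0 (b + e * e) b a p-prime coprime-b product a≢0 sum)

      -- By v² ≡ e⁴ modulo 2 the difference v - e² is even, so b is an integer. The sign of v
      -- matters: it makes both factors of 5 p a⁴ positive.
      classify : Double p a e (+ V) ⊎ Twisted p a e (+ V)
      classify = go (congruence 2 (v ∷ e ∷ + p ∷ a ∷ [])
        ($0 :* $0 :- (q⁴ $1 :+ # 20 :* $2 :* q⁴ $3) ∷ []) ($0 :- $1 :* $1) refl
        (≡0⇒∣ 2 (equation′ adm prim) ∷ []))
        where
        go : + 2 ∣ v - e * e → Outcome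
        go (divides b b-eq) = First.outcome b b-eq

-- Height inequalities for duplication and for sum and difference.

module HeightBounds where

  open PolynomialIdentities
  open QuarticAddition
  open Congruences
  open CoprimeFactors
  open TwoDescent
  open ℤ-Solver
  open import Data.Integer as ℤ using (ℤ; +_; 0ℤ; _+_; _*_; _-_; -_) renaming (∣_∣ to abs)
  open import Data.Integer.Divisibility.Signed
  open import Data.Nat.Coprimality as C using (Coprime)
  open import Relation.Binary.PropositionalEquality hiding ([_])

  coprime-intro : ∀ {x y} → (∀ {k} → + k ∣ x → + k ∣ y → k ≡ 1) → Coprime (abs x) (abs y)
  coprime-intro h {k} (k∣x , k∣y) = h (∣ᵤ⇒∣ k∣x) (∣ᵤ⇒∣ k∣y)

  gauss : ∀ {k x y} → Coprime (abs k) (abs x) → k ∣ x * y → k ∣ y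
  gauss {k} {x} {y} cop h = ∣ᵤ⇒∣ (C.coprime-divisor cop (subst (abs k ℕ.∣_) (ℤₚ.abs-* x y) (∣⇒∣ᵤ h)))

  private
    *-cancelʳ-ℤ : ∀ {x y z} → z ≢ 0ℤ → x * z ≡ y * z → x ≡ y
    *-cancelʳ-ℤ {x} {y} {z} z≢0 = ℤₚ.*-cancelʳ-≡ x y z where instance _ = ℤ.≢-nonZero z≢0

    abs≢0 : ∀ {x} → x ≢ 0ℤ → abs x ≢ 0
    abs≢0 x≢0 h = x≢0 (ℤₚ.∣i∣≡0⇒i≡0 h)

    square-+ : ∀ x → x * x ≡ + (abs x ℕ.* abs x)
    square-+ x = trans (sym (abs-square x)) (sym (ℤₚ.pos-* (abs x) (abs x)))

    abs-≤-square-multiple : ∀ x {h} → h ≢ 0ℤ → abs x ℕ.≤ abs (x * (h * h))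
    abs-≤-square-multiple x {h} h≢0 = subst (abs x ℕ.≤_) (sym (ℤₚ.abs-* x (h * h)))
      (ℕₚ.m≤m*n (abs x) (abs (h * h)))
      where instance _ = ℕ.≢-nonZero (λ eq → *-≢0ℕ (abs≢0 h≢0) (abs≢0 h≢0) (trans (sym (ℤₚ.abs-* h h)) eq))

  -- The duplicate of (a : e : v) has coordinates (2 a e v : e⁴ - d a⁴ : v⁴ + 4 d a⁴ e⁴), d = 20 p, without
  -- common factors, since e is prime to 2 d a.
  module _ {p} (adm : Admissible p) where

    double-height : ∀ {a e v a′ e′ v′} → Primitive p a e v → e′ ≢ 0ℤ →
      let E = quad e - + 20 * + p * quad a in
      a′ * E ≡ + 2 * a * e * v * e′ → v′ * (E * E) ≡ (quad v + + 80 * + p * (quad a * quad e)) * (e′ * e′) →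
      quadℕ (abs v) ℕ.≤ abs v′
    double-height {a} {e} {v} {a′} {e′} {v′} prim e′≢0 a′-eq v′-eq = conclude E∣e′
      where
      open Primitive prim
      E = quad e - + 20 * + p * quad a
      N = quad v + + 80 * + p * (quad a * quad e)
      2∤E : ¬ + 2 ∣ E
      2∤E h = e-odd adm prim (congruence 2 (e ∷ + p * quad a ∷ [])
        (q⁴ $0 :- # 20 :* $1 ∷ []) $0 refl
        (subst (+ 2 ∣_) (certify (e ∷ + p ∷ quad a ∷ [])
          (q⁴ $0 :- # 20 :* $1 :* $2) (q⁴ $0 :- # 20 :* ($1 :* $2)) [] refl) h ∷ []))
      E≢0 : E ≢ 0ℤ
      E≢0 h = 2∤E (≡0⇒∣ 2 h)
      E⊥2 : Coprime (abs E) 2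
      E⊥2 = prime-∤⇒coprime prime-2 (λ h → 2∤E (∣ᵤ⇒∣ h))
      dN : ℕ
      dN = 20 ℕ.* p ℕ.* quadℕ (abs a)
      e⊥dN : Coprime (abs e) dN
      e⊥dN = e-coprime-quad adm prim {20} (e-coprime-20 adm prim) (C.sym coprime)
      quad-∣ : ∀ {k x} → + k ∣ quad x → k ℕ.∣ quadℕ (abs x)
      quad-∣ {k} {x} h = ∣⇒∣ᵤ {+ k} {+ quadℕ (abs x)} (subst (+ k ∣_) (sym (abs-quad x)) h)
      dN-∣ : ∀ {k} → + k ∣ + 20 * + p * quad a → k ℕ.∣ dN
      dN-∣ {k} h = ∣⇒∣ᵤ {+ k} {+ dN} (subst (+ k ∣_) (pos-quad 20 p a) h)
      E⊥a : Coprime (abs E) (abs a)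
      E⊥a = coprime-intro {E} {a} λ {k} k∣E k∣a → coprime-quadʳ coprime (∣⇒∣ᵤ k∣a ,
        quad-∣ {k} {e} (subst (+ k ∣_) (certify (quad e ∷ + 20 * + p * quad a ∷ [])
          ($0 :- $1 :+ $1) $0 [] refl)
          (∣m∣n⇒∣m+n {+ k} k∣E (∣n⇒∣m*n (+ 20 * + p) (∣m⇒∣m*n (a * a) (∣m⇒∣m*n a k∣a))))))
      E⊥e : Coprime (abs E) (abs e)
      E⊥e = coprime-intro {E} {e} λ {k} k∣E k∣e → e⊥dN (∣⇒∣ᵤ k∣e ,
        dN-∣ (subst (+ k ∣_) (certify (quad e ∷ + 20 * + p * quad a ∷ [])
          ($0 :- ($0 :- $1)) $1 [] refl)
          (∣m∣n⇒∣m-n {+ k} (∣m⇒∣m*n (e * e) (∣m⇒∣m*n e k∣e)) k∣E)))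
      -- v² + E = 2 e⁴ and v² - E = 2 d a⁴, so a common divisor of E and v, being odd, divides the
      -- coprime numbers e⁴ and d a⁴.
      E⊥v : Coprime (abs E) (abs v)
      E⊥v = coprime-intro {E} {v} λ {k} k∣E k∣v →
        let k⊥2 = coprime-∣ˡ {x = k} (∣⇒∣ᵤ {+ k} {E} k∣E) E⊥2
            k∣v² = ∣m⇒∣m*n {+ k} v k∣v
        in coprime-*ˡ (coprime-*ˡ e⊥dN e⊥dN) (coprime-*ˡ e⊥dN e⊥dN)
          ( quad-∣ {k} {e} (gauss {+ k} {+ 2} k⊥2 (subst (+ k ∣_)
              (certify (quad e ∷ + 20 * + p * quad a ∷ v ∷ [])
                ($2 :* $2 :+ ($0 :- $1)) (# 2 :* $0)
                (# 1 ∙ $2 :* $2 ≔ $0 :+ $1 by equation ∷ []) refl)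
              (∣m∣n⇒∣m+n {+ k} k∣v² k∣E)))
          , dN-∣ (gauss {+ k} {+ 2} k⊥2 (subst (+ k ∣_)
              (certify (quad e ∷ + 20 * + p * quad a ∷ v ∷ [])
                ($2 :* $2 :- ($0 :- $1)) (# 2 :* $1)
                (# 1 ∙ $2 :* $2 ≔ $0 :+ $1 by equation ∷ []) refl)
              (∣m∣n⇒∣m-n {+ k} k∣v² k∣E))))
      E⊥A : Coprime (abs E) (abs (+ 2 * a * e * v))
      E⊥A = subst (Coprime (abs E)) (sym (trans (ℤₚ.abs-* (+ 2 * a * e) v)
          (cong (ℕ._* abs v) (trans (ℤₚ.abs-* (+ 2 * a) e) (cong (ℕ._* abs e) (ℤₚ.abs-* (+ 2) a))))))
        (coprime-*ʳ (coprime-*ʳ (coprime-*ʳ E⊥2 E⊥a) E⊥e) E⊥v)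
      -- The numerator 2 a e v is prime to E, so nothing of the denominator cancels: e′ = q E, and
      -- then v′ = N q².
      E∣e′ : E ∣ e′
      E∣e′ = gauss {E} {+ 2 * a * e * v} E⊥A (divides a′ (sym a′-eq))
      N-+ : N ≡ + (quadℕ (abs v) ℕ.+ 80 ℕ.* p ℕ.* (quadℕ (abs a) ℕ.* quadℕ (abs e)))
      N-+ = cong₂ _+_ (sym (abs-quad v)) (trans (cong₂ _*_ (sym (ℤₚ.pos-* 80 p))
        (trans (cong₂ _*_ (sym (abs-quad a)) (sym (abs-quad e))) (sym (ℤₚ.pos-* (quadℕ (abs a)) _)))) (sym (ℤₚ.pos-* (80 ℕ.* p) _)))
      conclude : E ∣ e′ → quadℕ (abs v) ℕ.≤ abs v′
      conclude (divides q e′≡qE) = ℕₚ.≤-trans (subst (λ t → quadℕ (abs v) ℕ.≤ abs t) (sym N-+) (ℕₚ.m≤m+n _ _))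
        (subst (λ t → abs N ℕ.≤ abs t) (sym v′≡Nq²) (abs-≤-square-multiple N q≢0))
        where
        q≢0 : q ≢ 0ℤ
        q≢0 refl = e′≢0 e′≡qE
        v′≡Nq² : v′ ≡ N * (q * q)
        v′≡Nq² = *-cancelʳ-ℤ E≢0 (*-cancelʳ-ℤ E≢0 (certify (v′ ∷ N ∷ q ∷ E ∷ e′ ∷ [])
          ($0 :* $3 :* $3) ($1 :* ($2 :* $2) :* $3 :* $3)
          ( # 1 ∙ $0 :* ($3 :* $3) ≔ $1 :* ($4 :* $4) by v′-eq
          ∷ $1 :* ($4 :+ $2 :* $3) ∙ $4 ≔ $2 :* $3 by e′≡qE ∷ []) refl))

  integer-operations : Operations ℤ
  integer-operations = record { _⊞_ = _+_ ; _⊟_ = λ x y → x + (- y) ; _⊠_ = _*_ ; literal = λ z → z }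

  module ℤF = Formulas integer-operations

  -- With g = E / e₃ and g′ = E / e₄ the denominators cancelled in P₁ ± P₂, the product of the two numerators
  -- is a multiple of E, whence E ∣ g g′; this makes up for the factor E² in the product of the numerators
  -- V V′ = E² (v₁² v₂² + 4 d a₁² a₂² e₁² e₂²).
  sum-height : ∀ {p a₁ e₁ v₁ a₂ e₂ v₂ a₃ e₃ v₃ a₄ e₄ v₄} →
    Primitive p a₁ e₁ v₁ → Primitive p a₂ e₂ v₂ → Primitive p a₃ e₃ v₃ → Primitive p a₄ e₄ v₄ →
    e₃ ≢ 0ℤ → e₄ ≢ 0ℤ →
    let E = ℤF.homE (+ 20 * + p) a₁ e₁ a₂ e₂ in E ≢ 0ℤ →
    a₃ * E ≡ ℤF.homA a₁ e₁ v₁ a₂ e₂ v₂ * e₃ → v₃ * (E * E) ≡ ℤF.homV (+ 20 * + p) a₁ e₁ v₁ a₂ e₂ v₂ * (e₃ * e₃) →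
    a₄ * E ≡ ℤF.homA a₁ e₁ v₁ (0ℤ - a₂) e₂ v₂ * e₄ → v₄ * (E * E) ≡ ℤF.homV (+ 20 * + p) a₁ e₁ v₁ (0ℤ - a₂) e₂ v₂ * (e₄ * e₄) →
    abs v₃ ℕ.* abs v₄ ℕ.≤ 2 ℕ.* (abs v₁ ℕ.* abs v₁ ℕ.* (abs v₂ ℕ.* abs v₂))
  sum-height {p} {a₁} {e₁} {v₁} {a₂} {e₂} {v₂} {a₃} {e₃} {v₃} {a₄} {e₄} {v₄} P₁ P₂ P₃ P₄ e₃≢0 e₄≢0 E≢0 a₃-eq v₃-eq a₄-eq v₄-eq =
    step₁ e₃∣E e₄∣E
    where
    d = + 20 * + p
    E = ℤF.homE d a₁ e₁ a₂ e₂
    A = ℤF.homA a₁ e₁ v₁ a₂ e₂ v₂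
    A′ = ℤF.homA a₁ e₁ v₁ (0ℤ - a₂) e₂ v₂
    V = ℤF.homV d a₁ e₁ v₁ a₂ e₂ v₂
    V′ = ℤF.homV d a₁ e₁ v₁ (0ℤ - a₂) e₂ v₂
    F = a₁ * a₁ * (e₂ * e₂) - a₂ * a₂ * (e₁ * e₁)
    M = v₁ * v₂ * (v₁ * v₂) + + 4 * d * (a₁ * e₁ * (a₂ * e₂) * (a₁ * e₁ * (a₂ * e₂)))
    T = base [X] [X] [X] [X] [X] [√ 𝔼.quartic (q⁴ $2) $4 $0 ] [√ 𝔼.quartic (q⁴ $4) $5 $2 ]
    ρ = v₁ ∷ v₂ ∷ a₂ ∷ a₁ ∷ e₂ ∷ e₁ ∷ d ∷ []
    e₃∣E : e₃ ∣ E
    e₃∣E = gauss {e₃} {a₃} (C.sym (Primitive.coprime P₃)) (divides A a₃-eq)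
    e₄∣E : e₄ ∣ E
    e₄∣E = gauss {e₄} {a₄} (C.sym (Primitive.coprime P₄)) (divides A′ a₄-eq)
    step₁ : e₃ ∣ E → e₄ ∣ E → abs v₃ ℕ.* abs v₄ ℕ.≤ 2 ℕ.* (abs v₁ ℕ.* abs v₁ ℕ.* (abs v₂ ℕ.* abs v₂))
    step₁ (divides g E≡ge₃) (divides g′ E≡g′e₄) = step₂ e₃∣g′
      where
      g≢0 : g ≢ 0ℤ
      g≢0 refl = E≢0 E≡ge₃
      g′≢0 : g′ ≢ 0ℤ
      g′≢0 refl = E≢0 E≡g′e₄
      numerator : ∀ {a e g} {A : ℤ} → e ≢ 0ℤ → E ≡ g * e → a * E ≡ A * e → g * a ≡ A
      numerator {a} {e} {g} {A} e≢0 E≡ge a-eq = *-cancelʳ-ℤ e≢0 (trans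
        (certify (a ∷ e ∷ g ∷ E ∷ []) ($2 :* $0 :* $1) ($0 :* $3)
          (# 0 :- $0 ∙ $3 ≔ $2 :* $1 by E≡ge ∷ []) refl) a-eq)
      numeratorᵛ : ∀ {v e g V} → e ≢ 0ℤ → E ≡ g * e → v * (E * E) ≡ V * (e * e) → v * (g * g) ≡ V
      numeratorᵛ {v} {e} {g} {V} e≢0 E≡ge v-eq = *-cancelʳ-ℤ e≢0 (*-cancelʳ-ℤ e≢0
        (certify (v ∷ e ∷ g ∷ E ∷ V ∷ [])
          ($0 :* ($2 :* $2) :* $1 :* $1) ($4 :* $1 :* $1)
          ( # 1 ∙ $0 :* ($3 :* $3) ≔ $4 :* ($1 :* $1) by v-eq
          ∷ # 0 :- $0 :* ($3 :+ $2 :* $1) ∙ $3 ≔ $2 :* $1 by E≡ge ∷ []) refl))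
      AA′≡FE : A * A′ ≡ F * E
      AA′≡FE = certify-over T ρ (Primitive.equation P₁ , Primitive.equation P₂ , tt)
        (𝔼.homA $3 $5 $0 $2 $4 $1 :*
          𝔼.homA $3 $5 $0 (# 0 :- $2) $4 $1)
        (($3 :* $3 :* ($4 :* $4) :- $2 :* $2 :* ($5 :* $5)) :*
          𝔼.homE $6 $3 $5 $2 $4) [] refl
      -- The product A A′ = F E of the numerators shows that e₃ divides g′ a₄, and it divides g′ e₄
      -- = E as well; a₄ and e₄ are coprime.
      e₃∣g′ : e₃ ∣ g′
      e₃∣g′ = ∣ᵤ⇒∣ (C.coprime-factors {o = abs g′} (Primitive.coprime P₄)
        ( subst (abs e₃ ℕ.∣_) (trans (ℤₚ.abs-* g′ a₄) (ℕₚ.*-comm (abs g′) (abs a₄))) (∣⇒∣ᵤ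
            (gauss {e₃} {a₃} (C.sym (Primitive.coprime P₃)) (divides F g′a₃a₄)))
        , subst (abs e₃ ℕ.∣_) (trans (ℤₚ.abs-* g′ e₄) (ℕₚ.*-comm (abs g′) (abs e₄))) (∣⇒∣ᵤ
            (divides g (trans (sym E≡g′e₄) E≡ge₃))) ))
        where
        g′a₃a₄ : a₃ * (g′ * a₄) ≡ F * e₃
        g′a₃a₄ = *-cancelʳ-ℤ g≢0 (certify (a₃ ∷ a₄ ∷ g ∷ g′ ∷ A ∷ A′ ∷ F ∷ E ∷ e₃ ∷ [])
          ($0 :* ($3 :* $1) :* $2) ($6 :* $8 :* $2)
          ( $3 :* $1 ∙ $2 :* $0 ≔ $4 by numerator {a₃} {e₃} {g} {A} e₃≢0 E≡ge₃ a₃-eq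
          ∷ $4 ∙ $3 :* $1 ≔ $5 by numerator {a₄} {e₄} {g′} {A′} e₄≢0 E≡g′e₄ a₄-eq
          ∷ # 1 ∙ $4 :* $5 ≔ $6 :* $7 by AA′≡FE
          ∷ $6 ∙ $7 ≔ $2 :* $8 by E≡ge₃ ∷ []) refl)
      step₂ : e₃ ∣ g′ → abs v₃ ℕ.* abs v₄ ℕ.≤ 2 ℕ.* (abs v₁ ℕ.* abs v₁ ℕ.* (abs v₂ ℕ.* abs v₂))
      step₂ (divides h g′≡he₃) = begin
        abs v₃ ℕ.* abs v₄                  ≡⟨ sym (ℤₚ.abs-* v₃ v₄) ⟩
        abs (v₃ * v₄)                      ≤⟨ abs-≤-square-multiple (v₃ * v₄) h≢0 ⟩
        abs (v₃ * v₄ * (h * h))            ≡⟨ cong abs (trans v₃v₄h² M-+) ⟩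
        M⁺                                 ≤⟨ ℕₚ.m≤m+n M⁺ K⁺ ⟩
        M⁺ ℕ.+ K⁺                          ≡⟨ ℤₚ.+-injective (trans (sym bound) R-+) ⟩
        2 ℕ.* (abs v₁ ℕ.* abs v₁ ℕ.* (abs v₂ ℕ.* abs v₂)) ∎
        where
        open ℕₚ.≤-Reasoning
        h≢0 : h ≢ 0ℤ
        h≢0 refl = g′≢0 g′≡he₃
        VV′≡E²M : V * V′ ≡ E * E * M
        VV′≡E²M = certify-over T ρ (Primitive.equation P₁ , Primitive.equation P₂ , tt)
          (𝔼.homV $6 $3 $5 $0 $2 $4 $1 :*
            𝔼.homV $6 $3 $5 $0 (# 0 :- $2) $4 $1)
          (𝔼.homE $6 $3 $5 $2 $4 :* 𝔼.homE $6 $3 $5 $2 $4 :*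
            ($0 :* $1 :* ($0 :* $1) :+ # 4 :* $6 :*
              ($3 :* $5 :* ($2 :* $4) :* ($3 :* $5 :* ($2 :* $4))))) [] refl
        -- Since g g′ = h E, this is v₃ v₄ (h E)² = V V′ = E² M with E² cancelled.
        v₃v₄h² : v₃ * v₄ * (h * h) ≡ M
        v₃v₄h² = *-cancelʳ-ℤ E≢0 (*-cancelʳ-ℤ E≢0 (certify (v₃ ∷ v₄ ∷ h ∷ E ∷ g ∷ g′ ∷ e₃ ∷ V ∷ V′ ∷ M ∷ [])
          ($0 :* $1 :* ($2 :* $2) :* $3 :* $3) ($9 :* $3 :* $3)
          ( $0 :* $1 :* $2 :* ($2 :* $3 :+ $4 :* $5) ∙ $3 ≔ $4 :* $6 by E≡ge₃
          ∷ # 0 :- $0 :* $1 :* $4 :* ($2 :* $3 :+ $4 :* $5) ∙ $5 ≔ $2 :* $6 by g′≡he₃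
          ∷ $1 :* ($5 :* $5) ∙ $0 :* ($4 :* $4) ≔ $7 by numeratorᵛ {v₃} {e₃} {g} {V} e₃≢0 E≡ge₃ v₃-eq
          ∷ $7 ∙ $1 :* ($5 :* $5) ≔ $8 by numeratorᵛ {v₄} {e₄} {g′} {V′} e₄≢0 E≡g′e₄ v₄-eq
          ∷ # 1 ∙ $7 :* $8 ≔ $3 :* $3 :* $9 by VV′≡E²M ∷ []) refl))
        x = v₁ * v₂
        y = a₁ * e₁ * (a₂ * e₂)
        M⁺ = abs x ℕ.* abs x ℕ.+ 4 ℕ.* (20 ℕ.* p) ℕ.* (abs y ℕ.* abs y)
        K⁺ = abs E ℕ.* abs E ℕ.+ 20 ℕ.* p ℕ.* (abs F ℕ.* abs F)
        M-+ : M ≡ + M⁺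
        M-+ = cong₂ _+_ (square-+ x) (trans (cong₂ _*_ (trans (cong (+ 4 *_) (sym (ℤₚ.pos-* 20 p))) (sym (ℤₚ.pos-* 4 (20 ℕ.* p))))
          (square-+ y)) (sym (ℤₚ.pos-* (4 ℕ.* (20 ℕ.* p)) _)))
        K-+ : E * E + d * (F * F) ≡ + K⁺
        K-+ = cong₂ _+_ (square-+ E) (trans (cong₂ _*_ (sym (ℤₚ.pos-* 20 p)) (square-+ F)) (sym (ℤₚ.pos-* (20 ℕ.* p) _)))
        R-+ : + 2 * (v₁ * v₁ * (v₂ * v₂)) ≡ + (2 ℕ.* (abs v₁ ℕ.* abs v₁ ℕ.* (abs v₂ ℕ.* abs v₂)))
        R-+ = trans (cong (+ 2 *_) (trans (cong₂ _*_ (square-+ v₁) (square-+ v₂)) (sym (ℤₚ.pos-* (abs v₁ ℕ.* abs v₁) _))))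
          (sym (ℤₚ.pos-* 2 (abs v₁ ℕ.* abs v₁ ℕ.* (abs v₂ ℕ.* abs v₂))))
        -- The difference 2 v₁² v₂² - M equals E² + d F², hence is nonnegative.
        bound : + 2 * (v₁ * v₁ * (v₂ * v₂)) ≡ + (M⁺ ℕ.+ K⁺)
        bound = trans (certify-over T ρ (Primitive.equation P₁ , Primitive.equation P₂ , tt)
          (# 2 :* ($0 :* $0 :* ($1 :* $1)))
          (($0 :* $1 :* ($0 :* $1) :+ # 4 :* $6 :*
              ($3 :* $5 :* ($2 :* $4) :* ($3 :* $5 :* ($2 :* $4))))
           :+ (eE :* eE :+ $6 :* (eF :* eF))) [] refl) (cong₂ _+_ M-+ K-+)
          where
          eE = 𝔼.homE $6 $3 $5 $2 $4
          eF = $3 :* $3 :* ($4 :* $4) :- $2 :* $2 :* ($5 :* $5)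

-- Passage between ℤ and its field of fractions.

module FractionFields where

  open PolynomialIdentities
  open DiscreteFields
  open Congruences
  open TwoDescent
  open HeightBounds
  open import Data.Integer as ℤ using (ℤ; +_; 0ℤ; 1ℤ) renaming (∣_∣ to abs)
  open import Data.Integer.Divisibility.Signed
  open import Data.Nat using ()
  open import Data.Nat.Coprimality as C using (Coprime)
  open import Data.Vec.Properties using (lookup-map)
  open import Relation.Binary.PropositionalEquality hiding ([_])

  record Fraction (𝔽 : DiscreteField) (x : DiscreteField.F 𝔽) : Set where
    open DiscreteField 𝔽
    field
      {a e}    : ℤ
      e≢0      : e ≢ 0ℤ
      coprime  : Coprime (abs a) (abs e)
      value    : x * ι e ≡ ι a

  -- These properties characterise ℚ. With an abstract instance the concrete arithmetic of ℚ stays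
  -- out of the descent.
  record FractionField : Set₁ where
    field
      𝔽           : DiscreteField
      ι-injective : ∀ {x y} → DiscreteField.ι 𝔽 x ≡ DiscreteField.ι 𝔽 y → x ≡ y
      fraction    : ∀ x → Fraction 𝔽 x

  module FractionFieldProperties (ℱ : FractionField) where
    open FractionField ℱ public
    open DiscreteField 𝔽 public

    private
      ι-neg : ∀ x → ι (ℤ.- x) ≡ - ι x
      ι-neg x = trans (certify (ι x ∷ ι (ℤ.- x) ∷ - ι x ∷ []) $1 $2
        ( # 1 ∙ $0 :+ $1 ≔ # 0 by trans (sym (ι-+ x (ℤ.- x))) (cong ι (ℤₚ.+-inverseʳ x))
        ∷ con ℤ.-1ℤ ∙ $0 :+ $2 ≔ # 0 by IsCommutativeRing.-‿inverseʳ isCommutativeRing (ι x) ∷ []) refl) refl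
        where open import Algebra.Structures using (IsCommutativeRing)

    ι-⟦⟧ : ∀ {n} (e : Expr n) ρ → ⟦ e ⟧ (Vec.map ι ρ) ≡ ι (ℤ-Solver.⟦ e ⟧ ρ)
    ι-⟦⟧ (con z) ρ  = refl
    ι-⟦⟧ (var i) ρ  = lookup-map i ι ρ
    ι-⟦⟧ (a :+ b) ρ = trans (cong₂ _+_ (ι-⟦⟧ a ρ) (ι-⟦⟧ b ρ)) (sym (ι-+ _ _))
    ι-⟦⟧ (a :- b) ρ = trans (cong₂ _+_ (ι-⟦⟧ a ρ) (trans (cong -_ (ι-⟦⟧ b ρ)) (sym (ι-neg _)))) (sym (ι-+ _ _))
    ι-⟦⟧ (a :* b) ρ = trans (cong₂ _*_ (ι-⟦⟧ a ρ) (ι-⟦⟧ b ρ)) (sym (ι-* _ _))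

    -- Denominators are cleared in the field; as `ι` commutes with evaluation and is injective, the
    -- resulting identity descends to ℤ.
    lower : ∀ {n} (ρ : Vec ℤ n) (l r : Expr n) → ⟦ l ⟧ (Vec.map ι ρ) ≡ ⟦ r ⟧ (Vec.map ι ρ) → ℤ-Solver.⟦ l ⟧ ρ ≡ ℤ-Solver.⟦ r ⟧ ρ
    lower ρ l r h = ι-injective (trans (sym (ι-⟦⟧ l ρ)) (trans h (ι-⟦⟧ r ρ)))

    lift : ∀ {n} (ρ : Vec ℤ n) (l r : Expr n) → ℤ-Solver.⟦ l ⟧ ρ ≡ ℤ-Solver.⟦ r ⟧ ρ → ⟦ l ⟧ (Vec.map ι ρ) ≡ ⟦ r ⟧ (Vec.map ι ρ)
    lift ρ l r h = trans (ι-⟦⟧ l ρ) (trans (cong ι h) (sym (ι-⟦⟧ r ρ)))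

    ι≢0 : ∀ {x} → x ≢ 0ℤ → ι x ≢ 0#
    ι≢0 x≢0 h = x≢0 (ι-injective h)

    square-roots : ∀ {x y} → x * x ≡ y * y → x ≡ y ⊎ x ≡ 0# - y
    square-roots {x} {y} h = [ (λ h → inj₁ (certify ρ $0 $1
                                 (# 1 ∙ $0 :- $1 ≔ # 0 by h ∷ []) refl))
                             , (λ h → inj₂ (certify ρ $0 (# 0 :- $1)
                                 (# 1 ∙ $0 :+ $1 ≔ # 0 by h ∷ []) refl)) ]′
      (no-zero-divisors {x - y} {x + y} (certify ρ
        (($0 :- $1) :* ($0 :+ $1)) (# 0) (# 1 ∙ $0 :* $0 ≔ $1 :* $1 by h ∷ []) refl))
      where ρ = x ∷ y ∷ []

    -- In lowest terms t = x / y the equation x² = n y² makes y divide x, so y = ± 1.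
    integral-square-root : ∀ {t} n → t * t ≡ ι n → ∃ λ v → t ≡ ι v
    integral-square-root {t} n t² = root (fraction t)
      where
      root : Fraction 𝔽 t → ∃ λ v → t ≡ ι v
      root fr = x ℤ.* y , certify (t ∷ ι x ∷ ι y ∷ ι (x ℤ.* y) ∷ []) $0 $3
        ( $2 ∙ $0 :* $2 ≔ $1 by value
        ∷ con ℤ.-1ℤ ∙ $3 ≔ $1 :* $2 by ι-* x y
        ∷ # 0 :- $0 ∙ $2 :* $2 ≔ # 1 by trans (sym (ι-* y y)) (cong ι y²≡1) ∷ []) refl
        where
        open Fraction fr renaming (a to x; e to y)
        x² : x ℤ.* x ≡ n ℤ.* (y ℤ.* y)
        x² = lower (x ∷ y ∷ n ∷ []) ($0 :* $0) ($2 :* ($1 :* $1))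
          (certify (t ∷ ι x ∷ ι y ∷ ι n ∷ [])
            ($1 :* $1) ($3 :* ($2 :* $2))
            ( # 0 :- ($0 :* $2 :+ $1) ∙ $0 :* $2 ≔ $1 by value
            ∷ $2 :* $2 ∙ $0 :* $0 ≔ $3 by t² ∷ []) refl)
        y∣x : y ∣ x
        y∣x = gauss {y} {x} (C.sym coprime) (divides (n ℤ.* y) (trans x² (sym (ℤₚ.*-assoc n y y))))
        y²≡1 : y ℤ.* y ≡ 1ℤ
        y²≡1 = trans (sym (abs-square y)) (cong (λ k → + k ℤ.* + k) (coprime (∣⇒∣ᵤ y∣x , ℕ.∣-refl)))

    -- A root m / e would give m² = 5 p e² with 5 p ≡ 3 modulo 4, so m and e would both be even.
    -- Evenness is stated as 4 ∣ 2 m in order to be decided modulo 4.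
    negative-nonsquare : ∀ {p} → Admissible p → ∀ {a} → a ≡ 0# - ι (+ 5 ℤ.* + p) → NegativeNonSquare a
    negative-nonsquare {p} adm {a} a≡ x x²+a = contradict (fraction x)
      where
      open Admissible adm
      contradict : Fraction 𝔽 x → ⊥
      contradict fr = 1≢2 (coprime (∣⇒∣ᵤ (even m 4∣2m) , ∣⇒∣ᵤ (even e 4∣2e)))
        where
        open Fraction fr renaming (a to m)
        1≢2 : 2 ≢ 1
        1≢2 ()
        m²≡ : m ℤ.* m ℤ.- + 5 ℤ.* + p ℤ.* (e ℤ.* e) ≡ 0ℤ
        m²≡ = lower (m ∷ e ∷ + 5 ℤ.* + p ∷ []) ($0 :* $0 :- $2 :* ($1 :* $1)) (# 0)
          (certify (ι m ∷ ι e ∷ ι (+ 5 ℤ.* + p) ∷ x ∷ a ∷ [])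
            ($0 :* $0 :- $2 :* ($1 :* $1)) (# 0)
            ( # 0 :- ($3 :* $1 :+ $0) ∙ $3 :* $1 ≔ $0 by value
            ∷ $1 :* $1 ∙ $3 :* $3 :+ $4 ≔ # 0 by x²+a
            ∷ # 0 :- $1 :* $1 ∙ $4 ≔ # 0 :- $2 by a≡ ∷ []) refl)
        hyps : List (Expr 3)
        hyps = $2 :+ # 1 ∷ $0 :* $0 :- # 5 :* $2 :* ($1 :* $1) ∷ []
        4∣2m : + 4 ∣ + 2 ℤ.* m
        4∣2m = congruence 4 (m ∷ e ∷ + p ∷ []) hyps (# 2 :* $0) refl (p≡3[4] ∷ ≡0⇒∣ 4 m²≡ ∷ [])
        4∣2e : + 4 ∣ + 2 ℤ.* e
        4∣2e = congruence 4 (m ∷ e ∷ + p ∷ []) hyps (# 2 :* $1) refl (p≡3[4] ∷ ≡0⇒∣ 4 m²≡ ∷ [])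
        even : ∀ z → + 4 ∣ + 2 ℤ.* z → + 2 ∣ z
        even z = *-cancelˡ-∣ (+ 2) {+ 2} {z}

-- Integer multiples and independent pairs in an abelian group.

module Multiples where

  open import Data.Integer as ℤ using (ℤ; +_; -[1+_]; 0ℤ)
  import Relation.Binary.PropositionalEquality as ≡
  open ≡ using (_≡_)

  module IntegerMultiples (G : AbelianGroup 0ℓ 0ℓ) where
    open AbelianGroup G
    open import Algebra.Properties.Group group using (ε⁻¹≈ε; ⁻¹-involutive)
    open import Algebra.Properties.AbelianGroup G using (⁻¹-∙-comm)
    open import Algebra.Properties.CommutativeSemigroup commutativeSemigroup using (interchange)
    open import Algebra.Properties.Monoid.Mult monoid as Mult using ()
      renaming (_×_ to _×ℕ_; ×-homo-+ to ×ℕ-homo-+; ×-congʳ to ×ℕ-congʳ) public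
    open import Algebra.Properties.CommutativeMonoid.Mult commutativeMonoid using (×-distrib-+)
    open import Relation.Binary.Reasoning.Setoid setoid

    infixr 7.5 _·_
    -- The clauses follow those of `mulℤ`, so that multiples on the curve and in the group are
    -- compared by the same recursion.
    _·_ : ℤ → Carrier → Carrier
    + n      · x = n ×ℕ x
    -[1+ n ] · x = (suc n ×ℕ x) ⁻¹

    ·-cong : ∀ c {x y} → x ≈ y → c · x ≈ c · y
    ·-cong (+ n)    h = ×ℕ-congʳ n h
    ·-cong -[1+ n ] h = ⁻¹-cong (×ℕ-congʳ (suc n) h)

    ·-⊖ : ∀ m n x → (m ℤ.⊖ n) · x ≈ m ×ℕ x ∙ (n ×ℕ x) ⁻¹
    ·-⊖ m       zero    x = sym (trans (∙-congˡ ε⁻¹≈ε) (identityʳ _))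
    ·-⊖ zero    (suc n) x = sym (identityˡ _)
    ·-⊖ (suc m) (suc n) x = begin
      (suc m ℤ.⊖ suc n) · x                       ≡⟨ ≡.cong (_· x) (ℤₚ.[1+m]⊖[1+n]≡m⊖n m n) ⟩
      (m ℤ.⊖ n) · x                               ≈⟨ ·-⊖ m n x ⟩
      m ×ℕ x ∙ (n ×ℕ x) ⁻¹                        ≈⟨ sym (identityˡ _) ⟩
      ε ∙ (m ×ℕ x ∙ (n ×ℕ x) ⁻¹)                  ≈⟨ ∙-congʳ (sym (inverseʳ x)) ⟩
      x ∙ x ⁻¹ ∙ (m ×ℕ x ∙ (n ×ℕ x) ⁻¹)           ≈⟨ interchange _ _ _ _ ⟩
      x ∙ m ×ℕ x ∙ (x ⁻¹ ∙ (n ×ℕ x) ⁻¹)           ≈⟨ ∙-congˡ (⁻¹-∙-comm _ _) ⟩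
      x ∙ m ×ℕ x ∙ (x ∙ n ×ℕ x) ⁻¹                ∎

    ·-+ : ∀ c d x → (c ℤ.+ d) · x ≈ c · x ∙ d · x
    ·-+ (+ m)    (+ n)    x = ×ℕ-homo-+ x m n
    ·-+ (+ m)    -[1+ n ] x = ·-⊖ m (suc n) x
    ·-+ -[1+ m ] (+ n)    x = trans (·-⊖ n (suc m) x) (comm _ _)
    ·-+ -[1+ m ] -[1+ n ] x = begin
      (suc (suc (m ℕ.+ n)) ×ℕ x) ⁻¹               ≡⟨ ≡.cong (λ k → (suc k ×ℕ x) ⁻¹) (≡.sym (ℕₚ.+-suc m n)) ⟩
      ((suc m ℕ.+ suc n) ×ℕ x) ⁻¹                 ≈⟨ ⁻¹-cong (×ℕ-homo-+ x (suc m) (suc n)) ⟩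
      (suc m ×ℕ x ∙ suc n ×ℕ x) ⁻¹                ≈⟨ sym (⁻¹-∙-comm _ _) ⟩
      (suc m ×ℕ x) ⁻¹ ∙ (suc n ×ℕ x) ⁻¹           ∎

    ·-neg : ∀ c x → (ℤ.- c) · x ≈ (c · x) ⁻¹
    ·-neg (+ zero)  x = sym ε⁻¹≈ε
    ·-neg (+ suc n) x = refl
    ·-neg -[1+ n ]  x = sym (⁻¹-involutive _)

    ·-*-ℕ : ∀ n d x → (+ n ℤ.* d) · x ≈ n ×ℕ (d · x)
    ·-*-ℕ zero d x = reflexive (≡.cong (_· x) (ℤₚ.*-zeroˡ d))
    ·-*-ℕ (suc n) d x = begin
      (+ suc n ℤ.* d) · x       ≡⟨ ≡.cong (_· x) (ℤₚ.suc-* (+ n) d) ⟩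
      (d ℤ.+ + n ℤ.* d) · x     ≈⟨ ·-+ d (+ n ℤ.* d) x ⟩
      d · x ∙ (+ n ℤ.* d) · x   ≈⟨ ∙-congˡ (·-*-ℕ n d x) ⟩
      d · x ∙ n ×ℕ (d · x)      ∎

    ·-* : ∀ c d x → (c ℤ.* d) · x ≈ c · (d · x)
    ·-* (+ n)    d x = ·-*-ℕ n d x
    ·-* -[1+ n ] d x = begin
      (-[1+ n ] ℤ.* d) · x       ≡⟨ ≡.cong (_· x) (≡.sym (ℤₚ.neg-distribˡ-* (+ suc n) d)) ⟩
      (ℤ.- (+ suc n ℤ.* d)) · x  ≈⟨ ·-neg (+ suc n ℤ.* d) x ⟩
      ((+ suc n ℤ.* d) · x) ⁻¹   ≈⟨ ⁻¹-cong (·-*-ℕ (suc n) d x) ⟩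
      (suc n ×ℕ (d · x)) ⁻¹      ∎

    ·-∙ : ∀ c x y → c · (x ∙ y) ≈ c · x ∙ c · y
    ·-∙ (+ n)    x y = ×-distrib-+ x y n
    ·-∙ -[1+ n ] x y = trans (⁻¹-cong (×-distrib-+ x y (suc n))) (sym (⁻¹-∙-comm _ _))

    ×ℕ-ε : ∀ n → n ×ℕ ε ≈ ε
    ×ℕ-ε zero    = refl
    ×ℕ-ε (suc n) = trans (identityˡ _) (×ℕ-ε n)

    ·-ε : ∀ c → c · ε ≈ ε
    ·-ε (+ n)    = ×ℕ-ε n
    ·-ε -[1+ n ] = trans (⁻¹-cong (×ℕ-ε (suc n))) ε⁻¹≈ε

    Independent₂ : Carrier → Carrier → Set
    Independent₂ x y = ∀ c d → c · x ∙ d · y ≈ ε → c ≡ 0ℤ × d ≡ 0ℤ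

    Independent₂-swap : ∀ {x y} → Independent₂ x y → Independent₂ y x
    Independent₂-swap ind c d h with ind d c (trans (comm _ _) h)
    ... | d≡0 , c≡0 = c≡0 , d≡0

    -- Four times a relation c z + d y = 0 reads c k x + (c l + 4 d) y = 0; as k ≠ 0 this gives c =
    -- 0 and then d = 0. The multiple is 4 and not 2 because halves are determined only up to 𝕋.
    Independent₂-quarter : ∀ {x y z} k l → k ≡.≢ 0ℤ → + 4 · z ≈ k · x ∙ l · y → Independent₂ x y → Independent₂ z y
    Independent₂-quarter {x} {y} {z} k l k≢0 4z ind c d h = c≡0 , d≡0
      where
      relation : (c ℤ.* k) · x ∙ (c ℤ.* l ℤ.+ + 4 ℤ.* d) · y ≈ ε
      relation = begin
        (c ℤ.* k) · x ∙ (c ℤ.* l ℤ.+ + 4 ℤ.* d) · y           ≈⟨ ∙-cong (·-* c k x) (trans (·-+ (c ℤ.* l) (+ 4 ℤ.* d) y)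
                                                                 (∙-cong (·-* c l y) (·-* (+ 4) d y))) ⟩
        c · (k · x) ∙ (c · (l · y) ∙ + 4 · (d · y))           ≈⟨ sym (assoc _ _ _) ⟩
        c · (k · x) ∙ c · (l · y) ∙ + 4 · (d · y)             ≈⟨ ∙-congʳ (sym (·-∙ c _ _)) ⟩
        c · (k · x ∙ l · y) ∙ + 4 · (d · y)                   ≈⟨ ∙-congʳ (·-cong c (sym 4z)) ⟩
        c · (+ 4 · z) ∙ + 4 · (d · y)                         ≈⟨ ∙-congʳ (sym (·-* c (+ 4) z)) ⟩
        (c ℤ.* + 4) · z ∙ + 4 · (d · y)                       ≡⟨ ≡.cong (λ t → t · z ∙ + 4 · (d · y)) (ℤₚ.*-comm c (+ 4)) ⟩
        (+ 4 ℤ.* c) · z ∙ + 4 · (d · y)                       ≈⟨ ∙-congʳ (·-* (+ 4) c z) ⟩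
        + 4 · (c · z) ∙ + 4 · (d · y)                         ≈⟨ sym (·-∙ (+ 4) _ _) ⟩
        + 4 · (c · z ∙ d · y)                                 ≈⟨ ·-cong (+ 4) h ⟩
        + 4 · ε                                               ≈⟨ ·-ε (+ 4) ⟩
        ε                                                     ∎
      c≡0 : c ≡ 0ℤ
      c≡0 = ℤₚ.*-cancelʳ-≡ c 0ℤ k (≡.trans (proj₁ (ind (c ℤ.* k) (c ℤ.* l ℤ.+ + 4 ℤ.* d) relation)) (≡.sym (ℤₚ.*-zeroˡ k)))
        where instance _ = ℤ.≢-nonZero k≢0
      d≡0 : d ≡ 0ℤ
      d≡0 = ℤₚ.*-cancelˡ-≡ (+ 4) d 0ℤ (≡.trans (≡.sym (≡.trans (≡.cong (λ t → t ℤ.* l ℤ.+ + 4 ℤ.* d) c≡0)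
        (ℤₚ.+-identityˡ (+ 4 ℤ.* d)))) (proj₂ (ind (c ℤ.* k) (c ℤ.* l ℤ.+ + 4 ℤ.* d) relation)))

-- Primitive integral coordinates and heights of points.

module Representatives where

  open PolynomialIdentities
  open DiscreteFields
  open QuarticAddition
  open QuarticGroups
  open Congruences
  open CoprimeFactors
  open TwoDescent
  open HeightBounds
  open FractionFields
  open import Data.Integer as ℤ using (ℤ; +_; 0ℤ) renaming (∣_∣ to abs)
  open import Data.Nat.Coprimality as C using (Coprime)
  open import Relation.Binary.PropositionalEquality hiding ([_])

  module RationalPoints
    (ℱ : FractionField) {p} (adm : Admissible p) (d : DiscreteField.F (FractionField.𝔽 ℱ))
    (d≡ : d ≡ DiscreteField.ι (FractionField.𝔽 ℱ) (+ 20 ℤ.* + p))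
    (nonsquare : DiscreteField.ReciprocalNonSquare (FractionField.𝔽 ℱ) d)
    where
    open FractionFieldProperties ℱ
    open Sums 𝔽
    open QuarticGroup 𝔽 d nonsquare

    private
      D : ℤ
      D = + 20 ℤ.* + p

    record Rep (Q : 𝕁) : Set where
      field
        {a e v} : ℤ
        e≢0     : e ≢ 0ℤ
        prim    : Primitive p a e v
        u-eq    : u Q * ι e ≡ ι a
        w-eq    : w Q * (ι e * ι e) ≡ ι v

    height : ∀ {Q} → Rep Q → ℕ
    height r = abs (Rep.v r)

    -- With u = a / e in lowest terms, w e² has the integer e⁴ + 20 p a⁴ as its square and is
    -- therefore an integer v.
    rep : ∀ Q → Rep Q
    rep Q = make (fraction (u Q))
      where
      make : Fraction 𝔽 (u Q) → Rep Q
      make fr = with-root (integral-square-root n t²)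
        where
        open Fraction fr
        n = quad e ℤ.+ D ℤ.* quad a
        t = w Q * (ι e * ι e)
        t² : t * t ≡ ι n
        t² = trans (certify (w Q ∷ u Q ∷ ι e ∷ ι a ∷ d ∷ ι D ∷ [])
            ($0 :* ($2 :* $2) :* ($0 :* ($2 :* $2))) (q⁴ $2 :+ $5 :* q⁴ $3)
            ( q⁴ $2 ∙ $0 :* $0 ≔ 𝔼.quartic (# 1) $4 $1 by on! Q
            ∷ q⁴ ($1 :* $2) ∙ $4 ≔ $5 by d≡
            ∷ $5 :* ($1 :* $2 :* ($1 :* $2) :+ $3 :* $3) :* ($1 :* $2 :+ $3)
              ∙ $1 :* $2 ≔ $3 by value ∷ []) refl)
          (ι-⟦⟧ (q⁴ $0 :+ $2 :* q⁴ $1) (e ∷ a ∷ D ∷ []))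
        with-root : (∃ λ v → t ≡ ι v) → Rep Q
        with-root (v , t≡v) = record
          { e≢0 = e≢0
          ; prim = record
            { coprime = coprime
            ; equation = lower (v ∷ n ∷ []) ($0 :* $0) $1 (trans (sym (cong₂ _*_ t≡v t≡v)) t²)
            }
          ; u-eq = value
          ; w-eq = t≡v
          }

    rep-𝕋 : ∀ {Q} → Rep Q → Rep (Q ⊕ 𝕋)
    rep-𝕋 {Q} R = record
      { e≢0 = e≢0
      ; prim = record
        { coprime = subst (λ n → Coprime n (abs e)) (abs-neg a) (Primitive.coprime prim)
        ; equation = trans (neg-square v) (trans (Primitive.equation prim) (cong (λ t → quad e ℤ.+ D ℤ.* t) (sym (cong₂ ℤ._*_ (neg-square a) (neg-square a)))))
        }
      ; u-eq = trans (cong (_* ι e) (u-⊕𝕋 Q)) (trans (certify (u Q ∷ ι e ∷ ι a ∷ [])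
          ((# 0 :- $0) :* $1) (# 0 :- $2)
          (con ℤ.-1ℤ ∙ $0 :* $1 ≔ $2 by u-eq ∷ []) refl) (ι-⟦⟧ (# 0 :- $0) (a ∷ [])))
      ; w-eq = trans (cong (_* (ι e * ι e)) (w-⊕𝕋 Q)) (trans (certify (w Q ∷ ι e ∷ ι v ∷ [])
          ((# 0 :- $0) :* ($1 :* $1)) (# 0 :- $2)
          (con ℤ.-1ℤ ∙ $0 :* ($1 :* $1) ≔ $2 by w-eq ∷ []) refl) (ι-⟦⟧ (# 0 :- $0) (v ∷ [])))
      }
      where
      open Rep R
      abs-neg : ∀ x → abs x ≡ abs (0ℤ ℤ.- x)
      abs-neg x = sym (trans (cong abs (ℤₚ.+-identityˡ (ℤ.- x))) (ℤₚ.∣-i∣≡∣i∣ x))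
      neg-square : ∀ x → (0ℤ ℤ.- x) ℤ.* (0ℤ ℤ.- x) ≡ x ℤ.* x
      neg-square x = ℤ-Solver.certify (x ∷ []) ((# 0 :- $0) :* (# 0 :- $0)) ($0 :* $0) ℤ-Solver.[] refl

    height-𝕋 : ∀ {Q} (R : Rep Q) → height (rep-𝕋 R) ≡ height R
    height-𝕋 R = trans (cong abs (ℤₚ.+-identityˡ (ℤ.- Rep.v R))) (ℤₚ.∣-i∣≡∣i∣ (Rep.v R))

    cross-u : ∀ {Q} (R : Rep Q) {n} (ρ : Vec ℤ n) (eE eA : Expr n) →
      u Q * ⟦ eE ⟧ (Vec.map ι ρ) ≡ ⟦ eA ⟧ (Vec.map ι ρ) → Rep.a R ℤ.* ℤ-Solver.⟦ eE ⟧ ρ ≡ ℤ-Solver.⟦ eA ⟧ ρ ℤ.* Rep.e R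
    cross-u {Q} R ρ eE eA h = lower (a ∷ ℤ-Solver.⟦ eE ⟧ ρ ∷ ℤ-Solver.⟦ eA ⟧ ρ ∷ e ∷ []) ($0 :* $1) ($2 :* $3)
      (certify (u Q ∷ ι a ∷ ι (ℤ-Solver.⟦ eE ⟧ ρ) ∷ ι (ℤ-Solver.⟦ eA ⟧ ρ) ∷ ι e ∷ [])
        ($1 :* $2) ($3 :* $4)
        ( # 0 :- $2 ∙ $0 :* $4 ≔ $1 by u-eq
        ∷ $4 ∙ $0 :* $2 ≔ $3 by subst₂ (λ s t → u Q * s ≡ t) (ι-⟦⟧ eE ρ) (ι-⟦⟧ eA ρ) h ∷ []) refl)
      where open Rep R

    cross-w : ∀ {Q} (R : Rep Q) {n} (ρ : Vec ℤ n) (eE eV : Expr n) →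
      w Q * (⟦ eE ⟧ (Vec.map ι ρ) * ⟦ eE ⟧ (Vec.map ι ρ)) ≡ ⟦ eV ⟧ (Vec.map ι ρ) →
      Rep.v R ℤ.* (ℤ-Solver.⟦ eE ⟧ ρ ℤ.* ℤ-Solver.⟦ eE ⟧ ρ) ≡ ℤ-Solver.⟦ eV ⟧ ρ ℤ.* (Rep.e R ℤ.* Rep.e R)
    cross-w {Q} R ρ eE eV h = lower (v ∷ ℤ-Solver.⟦ eE ⟧ ρ ∷ ℤ-Solver.⟦ eV ⟧ ρ ∷ e ∷ [])
      ($0 :* ($1 :* $1)) ($2 :* ($3 :* $3))
      (certify (w Q ∷ ι v ∷ ι (ℤ-Solver.⟦ eE ⟧ ρ) ∷ ι (ℤ-Solver.⟦ eV ⟧ ρ) ∷ ι e ∷ [])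
        ($1 :* ($2 :* $2)) ($3 :* ($4 :* $4))
        ( # 0 :- $2 :* $2 ∙ $0 :* ($4 :* $4) ≔ $1 by w-eq
        ∷ $4 :* $4 ∙ $0 :* ($2 :* $2) ≔ $3 by
            subst₂ (λ s t → w Q * (s * s) ≡ t) (ι-⟦⟧ eE ρ) (ι-⟦⟧ eV ρ) h ∷ []) refl)
      where open Rep R

    Homogeneous : (a₁ e₁ v₁ a₂ e₂ v₂ : ℤ) → 𝕁 → F → Set
    Homogeneous a₁ e₁ v₁ a₂ e₂ v₂ Q d =
      homE d (ι a₁) (ι e₁) (ι a₂) (ι e₂) ≢ 0# ×
      u Q * homE d (ι a₁) (ι e₁) (ι a₂) (ι e₂) ≡ homA (ι a₁) (ι e₁) (ι v₁) (ι a₂) (ι e₂) (ι v₂) ×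
      w Q * (homE d (ι a₁) (ι e₁) (ι a₂) (ι e₂) * homE d (ι a₁) (ι e₁) (ι a₂) (ι e₂)) ≡
        homV d (ι a₁) (ι e₁) (ι v₁) (ι a₂) (ι e₂) (ι v₂)

    homogeneous : ∀ {P Q} {a₁ e₁ v₁ a₂ e₂ v₂} → e₁ ≢ 0ℤ → e₂ ≢ 0ℤ →
      u P * ι e₁ ≡ ι a₁ → w P * (ι e₁ * ι e₁) ≡ ι v₁ → u Q * ι e₂ ≡ ι a₂ → w Q * (ι e₂ * ι e₂) ≡ ι v₂ →
      Homogeneous a₁ e₁ v₁ a₂ e₂ v₂ (P ⊕ Q) (ι D)
    homogeneous {P} {Q} {a₁} {e₁} {v₁} {a₂} {e₂} {v₂} e₁≢0 e₂≢0 u₁ w₁ u₂ w₂ = subst (Homogeneous a₁ e₁ v₁ a₂ e₂ v₂ (P ⊕ Q)) d≡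
      (isSum-homogeneous (ι≢0 e₁≢0) (ι≢0 e₂≢0) u₁ w₁ u₂ w₂ (⊕-sum P Q))

    height-double : ∀ {Q S} (R : Rep Q) (R′ : Rep S) → Q ⊕ Q ≡ S → quadℕ (height R) ℕ.≤ height R′
    height-double {Q} R R′ refl = double-height {p} adm {a} {e} {v} {Rep.a R′} {Rep.e R′} {Rep.v R′} prim (Rep.e≢0 R′) a′-eq v′-eq
      where
      open Rep R
      hom = homogeneous {Q} {Q} {a} {e} {v} {a} {e} {v} e≢0 e≢0 u-eq w-eq u-eq w-eq
      ρ = a ∷ e ∷ v ∷ D ∷ []
      eE = 𝔼.homE $3 $0 $1 $0 $1
      eA = 𝔼.homA $0 $1 $2 $0 $1 $2
      eV = 𝔼.homV $3 $0 $1 $2 $0 $1 $2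
      a′-eq : Rep.a R′ ℤ.* (quad e ℤ.- D ℤ.* quad a) ≡ + 2 ℤ.* a ℤ.* e ℤ.* v ℤ.* Rep.e R′
      a′-eq = trans (cross-u R′ ρ eE eA (proj₁ (proj₂ hom)))
        (ℤ-Solver.certify (a ∷ e ∷ v ∷ Rep.e R′ ∷ [])
          (𝔼.homA $0 $1 $2 $0 $1 $2 :* $3)
          (# 2 :* $0 :* $1 :* $2 :* $3) ℤ-Solver.[] refl)
      v′-eq : Rep.v R′ ℤ.* ((quad e ℤ.- D ℤ.* quad a) ℤ.* (quad e ℤ.- D ℤ.* quad a)) ≡
        (quad v ℤ.+ + 80 ℤ.* + p ℤ.* (quad a ℤ.* quad e)) ℤ.* (Rep.e R′ ℤ.* Rep.e R′)
      v′-eq = trans (cross-w R′ ρ eE eV (proj₂ (proj₂ hom)))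
        (ℤ-Solver.certify-over (base [X] [X] [X] [X] [√ q⁴ $1 :+ # 20 :* $2 :* q⁴ $0 ])
          (v ∷ a ∷ e ∷ + p ∷ Rep.e R′ ∷ []) (Primitive.equation prim , tt)
          (𝔼.homV (# 20 :* $3) $1 $2 $0 $1 $2 $0 :* ($4 :* $4))
          ((q⁴ $0 :+ # 80 :* $3 :* (q⁴ $1 :* q⁴ $2)) :* ($4 :* $4)) ℤ-Solver.[] refl)

    height-sum : ∀ {P Q} (R : Rep P) (S : Rep Q) (R₊ : Rep (P ⊕ Q)) (R₋ : Rep (P ⊕ ⊖ Q)) →
      height R₊ ℕ.* height R₋ ℕ.≤ 2 ℕ.* (height R ℕ.* height R ℕ.* (height S ℕ.* height S))
    height-sum {P} {Q} R S R₊ R₋ = sum-height {p} {R.a} {R.e} {R.v} {S.a} {S.e} {S.v}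
      {Rep.a R₊} {Rep.e R₊} {Rep.v R₊} {Rep.a R₋} {Rep.e R₋} {Rep.v R₋} (Rep.prim R) (Rep.prim S) (Rep.prim R₊) (Rep.prim R₋) (Rep.e≢0 R₊) (Rep.e≢0 R₋)
      E≢0
      (cross-u R₊ ρ eE (𝔼.homA $0 $1 $2 $3 $4 $5) (proj₁ (proj₂ hom₊)))
      (cross-w R₊ ρ eE (𝔼.homV $6 $0 $1 $2 $3 $4 $5) (proj₂ (proj₂ hom₊)))
      (trans (cong (Rep.a R₋ ℤ.*_) E-eq)
        (cross-u R₋ ρ eE⁻ (𝔼.homA $0 $1 $2 (# 0 :- $3) $4 $5) (proj₁ (proj₂ hom₋))))
      (trans (cong (Rep.v R₋ ℤ.*_) (cong₂ ℤ._*_ E-eq E-eq))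
        (cross-w R₋ ρ eE⁻ (𝔼.homV $6 $0 $1 $2 (# 0 :- $3) $4 $5) (proj₂ (proj₂ hom₋))))
      where
      module R = Rep R
      module S = Rep S
      ρ = R.a ∷ R.e ∷ R.v ∷ S.a ∷ S.e ∷ S.v ∷ D ∷ []
      eE eE⁻ : Expr 7
      eE  = 𝔼.homE $6 $0 $1 $3 $4
      eE⁻ = 𝔼.homE $6 $0 $1 (# 0 :- $3) $4
      hom₊ = homogeneous {P} {Q} {R.a} {R.e} {R.v} {S.a} {S.e} {S.v} R.e≢0 S.e≢0 R.u-eq R.w-eq S.u-eq S.w-eq
      hom₋′ = homogeneous {P} {⊖ Q} {R.a} {R.e} {R.v} {0ℤ ℤ.- S.a} {S.e} {S.v} R.e≢0 S.e≢0 R.u-eq R.w-eq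
        (trans (certify (u Q ∷ ι S.e ∷ ι S.a ∷ [])
          ((# 0 :- $0) :* $1) (# 0 :- $2) (con ℤ.-1ℤ ∙ $0 :* $1 ≔ $2 by S.u-eq ∷ []) refl)
          (ι-⟦⟧ (# 0 :- $0) (S.a ∷ []))) S.w-eq
      hom₋ : homE (ι D) (ι R.a) (ι R.e) (0# - ι S.a) (ι S.e) ≢ 0# ×
        u (P ⊕ ⊖ Q) * homE (ι D) (ι R.a) (ι R.e) (0# - ι S.a) (ι S.e) ≡ homA (ι R.a) (ι R.e) (ι R.v) (0# - ι S.a) (ι S.e) (ι S.v) ×
        w (P ⊕ ⊖ Q) * (homE (ι D) (ι R.a) (ι R.e) (0# - ι S.a) (ι S.e) * homE (ι D) (ι R.a) (ι R.e) (0# - ι S.a) (ι S.e)) ≡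
          homV (ι D) (ι R.a) (ι R.e) (ι R.v) (0# - ι S.a) (ι S.e) (ι S.v)
      hom₋ = subst (λ t → homE (ι D) (ι R.a) (ι R.e) t (ι S.e) ≢ 0# ×
        u (P ⊕ ⊖ Q) * homE (ι D) (ι R.a) (ι R.e) t (ι S.e) ≡ homA (ι R.a) (ι R.e) (ι R.v) t (ι S.e) (ι S.v) ×
        w (P ⊕ ⊖ Q) * (homE (ι D) (ι R.a) (ι R.e) t (ι S.e) * homE (ι D) (ι R.a) (ι R.e) t (ι S.e)) ≡
          homV (ι D) (ι R.a) (ι R.e) (ι R.v) t (ι S.e) (ι S.v)) (sym (ι-⟦⟧ (# 0 :- $0) (S.a ∷ []))) hom₋′
      E≢0 : ℤ-Solver.⟦ eE ⟧ ρ ≢ 0ℤ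
      E≢0 h = proj₁ hom₊ (trans (ι-⟦⟧ eE ρ) (cong ι h))
      E-eq : ℤ-Solver.⟦ eE ⟧ ρ ≡ ℤ-Solver.⟦ eE⁻ ⟧ ρ
      E-eq = ℤ-Solver.certify ρ eE eE⁻ ℤ-Solver.[] refl

-- Halving, torsion, and the descent on independent pairs.

module Halving where

  open PolynomialIdentities
  open DiscreteFields
  open QuarticAddition
  open QuarticGroups
  open Congruences
  open CoprimeFactors
  open TwoDescent
  open HeightBounds
  open FractionFields
  open Multiples
  open Representatives
  import Algebra.Properties.AbelianGroup
  import Algebra.Properties.CommutativeSemigroup
  open import Data.Integer as ℤ using (+_; -[1+_]; 0ℤ; 1ℤ) renaming (∣_∣ to abs)
  open import Data.Nat.Primality using (prime⇒nonZero)
  open import Relation.Binary.PropositionalEquality hiding ([_])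

  module RankBound
    (ℱ : FractionField) {p} (adm : Admissible p) (d : DiscreteField.F (FractionField.𝔽 ℱ))
    (d≡ : d ≡ DiscreteField.ι (FractionField.𝔽 ℱ) (+ 20 ℤ.* + p))
    (nonsquare : DiscreteField.ReciprocalNonSquare (FractionField.𝔽 ℱ) d)
    where
    open FractionFieldProperties ℱ
    open Sums 𝔽
    open QuarticGroup 𝔽 d nonsquare
    open RationalPoints ℱ adm d d≡ nonsquare
    open Algebra.Properties.AbelianGroup abelianGroup using (⁻¹-∙-comm)
    open Algebra.Properties.CommutativeSemigroup (AbelianGroup.commutativeSemigroup abelianGroup) using (interchange)
    open AbelianGroup abelianGroup using (identityʳ)

    P : F
    P = ι (+ p)

    d≡20P : d ≡ ι (+ 20) * P
    d≡20P = trans d≡ (ι-* (+ 20) (+ p))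

    2≢0 : ι (+ 2) ≢ 0#
    2≢0 = ι≢0 (λ ())

    quadF : F → F
    quadF x = x * x * (x * x)

    infix 4 _~_
    _~_ : 𝕁 → 𝕁 → Set
    S ~ Q = S ≡ Q ⊎ S ≡ Q ⊕ 𝕋

    ~-⊕ : ∀ {S S′ Q Q′} → S ~ Q → S′ ~ Q′ → S ⊕ S′ ~ Q ⊕ Q′
    ~-⊕ (inj₁ refl) (inj₁ refl) = inj₁ refl
    ~-⊕ {Q = Q} {Q′} (inj₁ refl) (inj₂ refl) = inj₂ (sym (⊕-assoc Q Q′ 𝕋))
    ~-⊕ {Q = Q} {Q′} (inj₂ refl) (inj₁ refl) = inj₂ (trans (⊕-assoc Q 𝕋 Q′)
      (trans (cong (Q ⊕_) (⊕-comm 𝕋 Q′)) (sym (⊕-assoc Q Q′ 𝕋))))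
    ~-⊕ {Q = Q} {Q′} (inj₂ refl) (inj₂ refl) = inj₁ (trans (interchange Q 𝕋 Q′ 𝕋)
      (trans (cong ((Q ⊕ Q′) ⊕_) 𝕋⊕𝕋) (identityʳ _)))

    ~-⊖ : ∀ {S Q} → S ~ Q → ⊖ S ~ ⊖ Q
    ~-⊖ (inj₁ refl) = inj₁ refl
    ~-⊖ {Q = Q} (inj₂ refl) = inj₂ (trans (sym (⁻¹-∙-comm Q 𝕋)) (cong (⊖ Q ⊕_) ⊖𝕋))
      where
      ⊖𝕋 : ⊖ 𝕋 ≡ 𝕋
      ⊖𝕋 = 𝕁-≡ (certify [] (# 0 :- # 0) (# 0) [] refl , refl)

    ~-double : ∀ {S Q} → S ~ Q → S ⊕ S ≡ Q ⊕ Q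
    ~-double (inj₁ refl) = refl
    ~-double {Q = Q} (inj₂ refl) = trans (interchange Q 𝕋 Q 𝕋) (trans (cong ((Q ⊕ Q) ⊕_) 𝕋⊕𝕋) (identityʳ _))

    ~-rep : ∀ {S Q} → S ~ Q → (R : Rep Q) → ∃ λ (R′ : Rep S) → height R′ ≡ height R
    ~-rep (inj₁ refl) R = R , refl
    ~-rep (inj₂ refl) R = rep-𝕋 R , height-𝕋 R

    Halvable : 𝕁 → Set
    Halvable Q = ∃ λ R → R ⊕ R ~ Q

    -- The constants of 2 r² = 5 m⁴ + p n⁴ after doubling. Because c δ = d, a sum of two points of
    -- this twist lies on the curve itself.
    c δ : F
    c = ι (+ 10)
    δ = ι (+ 2) * P

    cδ≡d : c * δ ≡ d
    cδ≡d = trans (certify (P ∷ []) (# 10 :* (# 2 :* $0)) (# 20 :* $0) [] refl) (sym d≡20P)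

    record TwistRoot (S : 𝕁) : Set where
      constructor twistRoot
      field
        {ν ω} : F
        on    : ω * ω ≡ quartic c δ ν
        sum   : IsSum c δ ν ω ν ω (u S) (w S)

    Twist : 𝕁 → Set
    Twist Q = ∃ λ S → TwistRoot S × S ~ Q

    -- If 10 = 2 p (ν₁ ν₂)², then (p ν₁ ν₂)² = 5 p, but 5 p is not a square.
    twist-D≢0 : ∀ ν₁ ν₂ → sumD c δ ν₁ ν₂ ≢ 0#
    twist-D≢0 ν₁ ν₂ h = negative-nonsquare adm {0# - ι (+ 5 ℤ.* + p)} refl (P * (ν₁ * ν₂))
      (*-cancelʳ 2≢0 (certify (P ∷ ν₁ ∷ ν₂ ∷ ι (+ 5 ℤ.* + p) ∷ [])
        (($0 :* ($1 :* $2) :* ($0 :* ($1 :* $2)) :+ (# 0 :- $3)) :* # 2)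
        (# 0 :* # 2)
        ( # 0 :- $0 ∙ 𝔼.sumD (# 10) (# 2 :* $0) $1 $2 ≔ # 0 by h
        ∷ con (ℤ.- + 2) ∙ $3 ≔ # 5 :* $0 by ι-* (+ 5) (+ p) ∷ []) refl))

    ⊖-twist : ∀ {S} → TwistRoot S → TwistRoot (⊖ S)
    ⊖-twist {S} (twistRoot {ν} {ω} on (isSum nz p q)) = twistRoot {ν = 0# - ν} {ω}
      (trans on (certify (c ∷ δ ∷ ν ∷ [])
        (𝔼.quartic $0 $1 $2) (𝔼.quartic $0 $1 (# 0 :- $2)) [] refl))
      (isSum (twist-D≢0 (0# - ν) (0# - ν))
        (certify ρ ((# 0 :- $4) :* 𝔼.sumD $0 $1 ν⁻ ν⁻) (𝔼.sumA ν⁻ $3 ν⁻ $3)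
          (con ℤ.-1ℤ ∙ $4 :* 𝔼.sumD $0 $1 $2 $2 ≔ 𝔼.sumA $2 $3 $2 $3 by p ∷ []) refl)
        (certify ρ ($5 :* (𝔼.sumD $0 $1 ν⁻ ν⁻ :* 𝔼.sumD $0 $1 ν⁻ ν⁻))
          (𝔼.sumB $0 $1 ν⁻ $3 ν⁻ $3)
          (# 1 ∙ $5 :* (𝔼.sumD $0 $1 $2 $2 :* 𝔼.sumD $0 $1 $2 $2)
            ≔ 𝔼.sumB $0 $1 $2 $3 $2 $3 by q ∷ []) refl))
      where
      ρ = c ∷ δ ∷ ν ∷ ω ∷ u S ∷ w S ∷ []
      ν⁻ : Expr 6
      ν⁻ = # 0 :- $2

    -- S and S′ are duplicates of points ρ, ρ′ of the twist; R is ρ + ρ′, which lies on the curve,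
    -- and `isSum-interchange` computes its double.
    twist-⊕ : ∀ {S S′} → TwistRoot S → TwistRoot S′ → ∃ λ R → R ⊕ R ≡ S ⊕ S′
    twist-⊕ {S} {S′} (twistRoot {ν} {ω} on sum) (twistRoot {ν′} {ω′} on′ sum′) = R , 𝕁-≡ (isSum-interchange on on′ s sum sum′
        (subst (λ d → IsSum 1# d (u R) (w R) (u R) (w R) (u (R ⊕ R)) (w (R ⊕ R))) (sym cδ≡d) (⊕-sum R R))
        (subst (λ d → IsSum 1# d (u S) (w S) (u S′) (w S′) (u (S ⊕ S′)) (w (S ⊕ S′))) (sym cδ≡d) (⊕-sum S S′)))
      where
      s = isSum-exists c δ ν ω ν′ ω′ (twist-D≢0 ν ν′)
      i = inv (sumD c δ ν ν′)
      μ = sumA ν ω ν′ ω′ * i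
      θ = sumB c δ ν ω ν′ ω′ * (i * i)
      R : 𝕁
      R = jac μ θ (subst (λ d → θ * θ ≡ quartic 1# d μ) cδ≡d (isSum-closed on on′ s))

    ~-twist : ∀ {Q Q′} → Twist Q → Twist Q′ → Halvable (Q ⊕ Q′)
    ~-twist {Q} {Q′} (S , root , S~Q) (S′ , root′ , S′~Q′) = conclude (twist-⊕ root root′)
      where
      conclude : (∃ λ R → R ⊕ R ≡ S ⊕ S′) → Halvable (Q ⊕ Q′)
      conclude (R , h) = R , subst (_~ Q ⊕ Q′) (sym h) (~-⊕ S~Q S′~Q′)

    ⊖-Twist : ∀ {Q} → Twist Q → Twist (⊖ Q)
    ⊖-Twist (S , root , S~Q) = ⊖ S , ⊖-twist root , ~-⊖ S~Q

    -- The squares a² and e² fix u only up to sign, while w is determined; so H = (n / m , r / m²)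
    -- or ⊖ H is a half.
    double⇒halvable : ∀ {S} (R : Rep S) → Rep.a R ≢ 0ℤ → Double p (Rep.a R) (Rep.e R) (Rep.v R) → ∃ λ H → H ⊕ H ≡ S
    double⇒halvable {S} R a≢0 (double {m} {n} {r} on a²-eq e²-eq v-eq) = by-sign (square-roots u²)
      where
      open Rep R
      m≢0 : m ≢ 0ℤ
      m≢0 m≡0 = a≢0 ([ (λ h → h) , (λ h → h) ]′ (ℤₚ.i*j≡0⇒i≡0∨j≡0 a (trans a²-eq (ℤ-Solver.certify (r ∷ m ∷ n ∷ [])
        (A :* A) (# 0) (# 2 :* $0 :* $2 :* A ℤ-Solver.∙ $1 ≔ # 0 by m≡0 ∷ ℤ-Solver.[]) refl))))
        where A = # 2 :* $0 :* $1 :* $2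
      i = inv (ι m)
      μ = ι n * i
      ω = ι r * (i * i)
      μm : μ * ι m ≡ ι n
      μm = proj₁ (fractions (ι n) (ι r) (ι≢0 m≢0))
      ωm² : ω * (ι m * ι m) ≡ ι r
      ωm² = proj₂ (fractions (ι n) (ι r) (ι≢0 m≢0))
      r²≡ : ι r * ι r ≡ quadF (ι m) + ι (+ 20) * P * (quadF (ι n))
      r²≡ = lift (r ∷ m ∷ n ∷ + p ∷ []) ($0 :* $0) (q⁴ $1 :+ # 20 :* $3 :* q⁴ $2) on
      onH : ω * ω ≡ quartic 1# d μ
      onH = *-cancelʳ {z = quadF (ι m)} (*-≢0 (*-≢0 (ι≢0 m≢0) (ι≢0 m≢0)) (*-≢0 (ι≢0 m≢0) (ι≢0 m≢0)))
        (certify (μ ∷ ω ∷ ι m ∷ ι n ∷ ι r ∷ d ∷ P ∷ [])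
          ($1 :* $1 :* q⁴ $2) (𝔼.quartic (# 1) $5 $0 :* q⁴ $2)
          ( $1 :* ($2 :* $2) :+ $4 ∙ $1 :* ($2 :* $2) ≔ $4 by ωm²
          ∷ # 1 ∙ $4 :* $4 ≔ q⁴ $2 :+ # 20 :* $6 :* q⁴ $3 by r²≡
          ∷ # 0 :- q⁴ $3 ∙ $5 ≔ # 20 :* $6 by d≡20P
          ∷ # 0 :- $5 :* ($0 :* $2 :* ($0 :* $2) :+ $3 :* $3) :* ($0 :* $2 :+ $3)
            ∙ $0 :* $2 ≔ $3 by μm ∷ []) refl)
      H : 𝕁
      H = jac μ ω onH
      hom = homogeneous {H} {H} {n} {m} {r} {n} {m} {r} m≢0 m≢0 μm ωm² μm ωm²
      E = homE (ι D) (ι n) (ι m) (ι n) (ι m)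
        where D = + 20 ℤ.* + p
      E≢0 : E ≢ 0#
      E≢0 = proj₁ hom
      E≡ : E ≡ quadF (ι m) - ι (+ 20) * P * (quadF (ι n))
      E≡ = cong (λ d → homE d (ι n) (ι m) (ι n) (ι m)) (ι-* (+ 20) (+ p))
      ae : ι a * ι a ≡ ι (+ 2) * ι r * ι m * ι n * (ι (+ 2) * ι r * ι m * ι n)
      ae = lift (a ∷ r ∷ m ∷ n ∷ []) ($0 :* $0) (A :* A) a²-eq
        where A = # 2 :* $1 :* $2 :* $3
      ee : ι e * ι e ≡ E * E
      ee = trans (lift (e ∷ m ∷ n ∷ + p ∷ []) ($0 :* $0) (E′ :* E′) e²-eq) (sym (cong₂ _*_ E≡ E≡))
        where E′ = q⁴ $1 :- # 20 :* $3 :* q⁴ $2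
      ve : ι v ≡ quadF (ι r) + ι (+ 80) * P * (quadF (ι m) * (quadF (ι n)))
      ve = lift (v ∷ r ∷ m ∷ n ∷ + p ∷ []) $0 (q⁴ $1 :+ # 80 :* $4 :* (q⁴ $2 :* q⁴ $3)) v-eq
      u₂ = u (H ⊕ H)
      u² : u S * u S ≡ u₂ * u₂
      u² = *-cancelʳ E≢0 (*-cancelʳ E≢0 (certify (u S ∷ u₂ ∷ E ∷ ι a ∷ ι e ∷ ι r ∷ ι m ∷ ι n ∷ [])
        ($0 :* $0 :* $2 :* $2) ($1 :* $1 :* $2 :* $2)
        ( # 0 :- $0 :* $0 ∙ $4 :* $4 ≔ $2 :* $2 by ee
        ∷ $0 :* $4 :+ $3 ∙ $0 :* $4 ≔ $3 by u-eq
        ∷ # 1 ∙ $3 :* $3 ≔ A :* A by ae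
        ∷ # 0 :- ($1 :* $2 :+ A) ∙ $1 :* $2 ≔ 𝔼.homA $7 $6 $5 $7 $6 $5 by proj₁ (proj₂ hom)
        ∷ []) refl))
        where A = # 2 :* $5 :* $6 :* $7
      w≡ : w (H ⊕ H) ≡ w S
      w≡ = *-cancelʳ E≢0 (*-cancelʳ E≢0 (certify (w S ∷ w (H ⊕ H) ∷ E ∷ ι e ∷ ι v ∷ ι r ∷ ι m ∷ ι n ∷ P ∷ ι D ∷ [])
        ($1 :* $2 :* $2) ($0 :* $2 :* $2)
        ( # 1 ∙ $1 :* ($2 :* $2) ≔ V by proj₂ (proj₂ hom)
        ∷ # 4 :* (q⁴ $6 :* q⁴ $7) :+ r² :* q⁴ $7 ∙ $9 ≔ # 20 :* $8 by ι-* (+ 20) (+ p)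
        ∷ # 0 :- r² ∙ r² ≔ q⁴ $6 :+ # 20 :* $8 :* q⁴ $7 by r²≡
        ∷ con ℤ.-1ℤ ∙ $4 ≔ q⁴ $5 :+ # 80 :* $8 :* (q⁴ $6 :* q⁴ $7) by ve
        ∷ con ℤ.-1ℤ ∙ $0 :* ($3 :* $3) ≔ $4 by w-eq
        ∷ $0 ∙ $3 :* $3 ≔ $2 :* $2 by ee ∷ []) refl))
        where
        D = + 20 ℤ.* + p
        r² = $5 :* $5
        V = 𝔼.homV $9 $7 $6 $5 $7 $6 $5
      by-sign : u S ≡ u₂ ⊎ u S ≡ 0# - u₂ → ∃ λ H → H ⊕ H ≡ S
      by-sign (inj₁ h) = H , 𝕁-≡ (sym h , w≡)
      by-sign (inj₂ h) = ⊖ H , trans (⁻¹-∙-comm H H) (𝕁-≡ (sym h , w≡))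

    -- The analogue on the twist, with root (n / m , 2 r / m²); a wrong sign of u is repaired by
    -- `⊖-twist`.
    twisted⇒twistRoot : ∀ {S} (R : Rep S) → Rep.a R ≢ 0ℤ → Twisted p (Rep.a R) (Rep.e R) (Rep.v R) → TwistRoot S
    twisted⇒twistRoot {S} R a≢0 (twisted {m} {n} {r} on a²-eq e²-eq v-eq) = by-sign (square-roots u²)
      where
      open Rep R
      m≢0 : m ≢ 0ℤ
      m≢0 m≡0 = a≢0 ([ (λ h → h) , (λ h → h) ]′ (ℤₚ.i*j≡0⇒i≡0∨j≡0 a (trans a²-eq (ℤ-Solver.certify (r ∷ m ∷ n ∷ [])
        (A :* A) (# 0) ($0 :* $2 :* A ℤ-Solver.∙ $1 ≔ # 0 by m≡0 ∷ ℤ-Solver.[]) refl))))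
        where A = $0 :* $1 :* $2
      ιm≢0 = ι≢0 m≢0
      i = inv (ι m)
      ν = ι n * i
      ω = ι (+ 2) * ι r * (i * i)
      νm : ν * ι m ≡ ι n
      νm = proj₁ (fractions (ι n) (ι (+ 2) * ι r) ιm≢0)
      ωm² : ω * (ι m * ι m) ≡ ι (+ 2) * ι r
      ωm² = proj₂ (fractions (ι n) (ι (+ 2) * ι r) ιm≢0)
      2r²≡ : ι (+ 2) * (ι r * ι r) ≡ ι (+ 5) * (quadF (ι m)) + P * (quadF (ι n))
      2r²≡ = lift (r ∷ m ∷ n ∷ + p ∷ []) (# 2 :* ($0 :* $0)) (# 5 :* q⁴ $1 :+ $3 :* q⁴ $2) on
      aa : ι a * ι a ≡ ι r * ι m * ι n * (ι r * ι m * ι n)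
      aa = lift (a ∷ r ∷ m ∷ n ∷ []) ($0 :* $0) (A :* A) a²-eq
        where A = $1 :* $2 :* $3
      K : F
      K = ι (+ 5) * (quadF (ι m)) - P * (quadF (ι n))
      ee : ι (+ 4) * (ι e * ι e) ≡ K * K
      ee = lift (e ∷ m ∷ n ∷ + p ∷ []) (# 4 :* ($0 :* $0)) (E′ :* E′) e²-eq
        where E′ = # 5 :* q⁴ $1 :- $3 :* q⁴ $2
      ve : ι v ≡ quadF (ι r) + ι (+ 5) * P * (quadF (ι m) * (quadF (ι n)))
      ve = lift (v ∷ r ∷ m ∷ n ∷ + p ∷ []) $0 (q⁴ $1 :+ # 5 :* $4 :* (q⁴ $2 :* q⁴ $3)) v-eq
      Δ : F
      Δ = sumD c δ ν ν
      Δ≢0 : Δ ≢ 0#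
      Δ≢0 = twist-D≢0 ν ν
      Δm⁴ : Δ * (quadF (ι m)) ≡ ι (+ 2) * K
      Δm⁴ = certify (ν ∷ ι m ∷ ι n ∷ P ∷ [])
        (𝔼.sumD (# 10) (# 2 :* $3) $0 $0 :* q⁴ $1)
        (# 2 :* (# 5 :* q⁴ $1 :- $3 :* q⁴ $2))
        (# 0 :- # 2 :* $3 :* ($0 :* $1 :* ($0 :* $1) :+ $2 :* $2) :* ($0 :* $1 :+ $2)
          ∙ $0 :* $1 ≔ $2 by νm ∷ []) refl
      m⁴≢0 : quadF (ι m) ≢ 0#
      m⁴≢0 = *-≢0 (*-≢0 ιm≢0 ιm≢0) (*-≢0 ιm≢0 ιm≢0)
      A : F
      A = sumA ν ω ν ω
      Am³ : A * (quadF (ι m)) ≡ ι (+ 4) * (ι r * ι m * ι n)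
      Am³ = certify (ν ∷ ω ∷ ι m ∷ ι n ∷ ι r ∷ [])
        (𝔼.sumA $0 $1 $0 $1 :* q⁴ $2) (# 4 :* ($4 :* $2 :* $3))
        ( # 2 :* $1 :* ($2 :* $2 :* $2) ∙ $0 :* $2 ≔ $3 by νm
        ∷ # 2 :* $3 :* $2 ∙ $1 :* ($2 :* $2) ≔ # 2 :* $4 by ωm² ∷ []) refl
      u² : u S * Δ * (u S * Δ) ≡ A * A
      u² = *-cancelʳ m⁴≢0 (*-cancelʳ m⁴≢0 (certify (u S ∷ Δ ∷ A ∷ K ∷ ι e ∷ ι a ∷ ι r ∷ ι m ∷ ι n ∷ P ∷ [])
        ($0 :* $1 :* ($0 :* $1) :* q⁴ $7 :* q⁴ $7) ($2 :* $2 :* q⁴ $7 :* q⁴ $7)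
        ( $0 :* $0 :* ($1 :* q⁴ $7 :+ # 2 :* $3) ∙ $1 :* q⁴ $7 ≔ # 2 :* $3 by Δm⁴
        ∷ con (ℤ.- + 4) :* ($0 :* $0) ∙ # 4 :* ($4 :* $4) ≔ $3 :* $3 by ee
        ∷ # 16 :* ($0 :* $4 :+ $5) ∙ $0 :* $4 ≔ $5 by u-eq
        ∷ # 16 ∙ $5 :* $5 ≔ rmn :* rmn by aa
        ∷ # 0 :- ($2 :* q⁴ $7 :+ # 4 :* rmn) ∙ $2 :* q⁴ $7 ≔ # 4 :* rmn by Am³ ∷ []) refl))
        where rmn = $6 :* $7 :* $8
      B : F
      B = sumB c δ ν ω ν ω
      Bm⁸ : B * (quadF (ι m)) * (quadF (ι m)) ≡ ι (+ 16) * ι v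
      Bm⁸ = certify (ν ∷ ω ∷ ι m ∷ ι n ∷ ι r ∷ P ∷ ι v ∷ [])
        (𝔼.sumB (# 10) (# 2 :* $5) $0 $1 $0 $1 :* m⁴ :* m⁴) (# 16 :* $6)
        ( ($1 :* ($2 :* $2) :+ # 2 :* $4) :* Q ∙ $1 :* ($2 :* $2) ≔ # 2 :* $4 by ωm²
        ∷ (# 8 :* ($4 :* $4) :* $5 :+ # 80 :* $5 :* m⁴) :* ($0 :* $2 :* ($0 :* $2) :+ $3 :* $3)
            :* ($0 :* $2 :+ $3) ∙ $0 :* $2 ≔ $3 by νm
        ∷ con (ℤ.- + 8) :* ($4 :* $4) ∙ # 2 :* ($4 :* $4) ≔ # 5 :* m⁴ :+ $5 :* q⁴ $3 by 2r²≡
        ∷ con (ℤ.- + 16) ∙ $6 ≔ q⁴ $4 :+ # 5 :* $5 :* (m⁴ :* q⁴ $3) by ve ∷ []) refl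
        where
        m⁴ = q⁴ $2
        Q = # 10 :* m⁴ :+ # 2 :* $5 :* q⁴ ($0 :* $2)
      w-sum : w S * (Δ * Δ) ≡ B
      w-sum = *-cancelʳ m⁴≢0 (*-cancelʳ m⁴≢0 (certify (w S ∷ Δ ∷ B ∷ K ∷ ι e ∷ ι v ∷ quadF (ι m) ∷ [])
        ($0 :* ($1 :* $1) :* $6 :* $6) ($2 :* $6 :* $6)
        ( $0 :* ($1 :* $6 :+ # 2 :* $3) ∙ $1 :* $6 ≔ # 2 :* $3 by Δm⁴
        ∷ con (ℤ.- + 4) :* $0 ∙ # 4 :* ($4 :* $4) ≔ $3 :* $3 by ee
        ∷ # 16 ∙ $0 :* ($4 :* $4) ≔ $5 by w-eq
        ∷ con ℤ.-1ℤ ∙ $2 :* $6 :* $6 ≔ # 16 :* $5 by Bm⁸ ∷ []) refl))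
      onν : ω * ω ≡ quartic c δ ν
      onν = *-cancelʳ m⁴≢0 (certify (ν ∷ ω ∷ ι m ∷ ι n ∷ ι r ∷ P ∷ [])
        ($1 :* $1 :* q⁴ $2) (𝔼.quartic (# 10) (# 2 :* $5) $0 :* q⁴ $2)
        ( $1 :* ($2 :* $2) :+ # 2 :* $4 ∙ $1 :* ($2 :* $2) ≔ # 2 :* $4 by ωm²
        ∷ # 2 ∙ # 2 :* ($4 :* $4) ≔ # 5 :* q⁴ $2 :+ $5 :* q⁴ $3 by 2r²≡
        ∷ # 0 :- # 2 :* $5 :* ($0 :* $2 :* ($0 :* $2) :+ $3 :* $3) :* ($0 :* $2 :+ $3)
          ∙ $0 :* $2 ≔ $3 by νm ∷ []) refl)
      by-sign : u S * Δ ≡ A ⊎ u S * Δ ≡ 0# - A → TwistRoot S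
      by-sign (inj₁ h) = twistRoot onν (isSum Δ≢0 h w-sum)
      by-sign (inj₂ h) = subst TwistRoot ⊖⊖S (⊖-twist {⊖ S} (twistRoot onν (isSum Δ≢0
          (certify (u S ∷ Δ ∷ A ∷ []) ((# 0 :- $0) :* $1) $2
            (con ℤ.-1ℤ ∙ $0 :* $1 ≔ # 0 :- $2 by h ∷ []) refl) w-sum)))
        where
        ⊖⊖S : ⊖ (⊖ S) ≡ S
        ⊖⊖S = 𝕁-≡ (certify (u S ∷ []) (# 0 :- (# 0 :- $0)) $0 [] refl , refl)

    -- `classify` asks for v ≥ 0. A negative v is made positive by adding 𝕋, and `_~_` absorbs this
    -- change.
    dichotomy : ∀ {Q} (R : Rep Q) → Rep.a R ≢ 0ℤ → Halvable Q ⊎ Twist Q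
    dichotomy {Q} R a≢0 = by-sign (Rep.v R) refl
      where
      module R = Rep R
      positive : ∀ {S V} (R : Rep S) → S ~ Q → Rep.a R ≢ 0ℤ → Rep.v R ≡ + V → Halvable Q ⊎ Twist Q
      positive {S} R S~Q a≢0 v≡ = [ (λ D → inj₁ (halve (double⇒halvable R a≢0 D)))
                                  , (λ T → inj₂ (S , twisted⇒twistRoot R a≢0 T , S~Q)) ]′ classified
        where
        classified : Double p (Rep.a R) (Rep.e R) (Rep.v R) ⊎ Twisted p (Rep.a R) (Rep.e R) (Rep.v R)
        classified = subst (λ v → Double p (Rep.a R) (Rep.e R) v ⊎ Twisted p (Rep.a R) (Rep.e R) v) (sym v≡)
          (classify adm (subst (Primitive p (Rep.a R) (Rep.e R)) v≡ (Rep.prim R)) a≢0)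
        halve : (∃ λ H → H ⊕ H ≡ S) → Halvable Q
        halve (H , refl) = H , S~Q
      by-sign : ∀ v → R.v ≡ v → Halvable Q ⊎ Twist Q
      by-sign (+ V)    v≡ = positive R (inj₁ refl) a≢0 v≡
      by-sign -[1+ V ] v≡ = positive (rep-𝕋 R) (inj₂ refl)
        (λ h → a≢0 (ℤₚ.neg-injective (trans (sym (ℤₚ.+-identityˡ (ℤ.- R.a))) h))) (cong (λ t → 0ℤ ℤ.- t) v≡)

    height² : ∀ {Q} (R : Rep Q) → height R ℕ.* height R ≡ quadℕ (abs (Rep.e R)) ℕ.+ 20 ℕ.* p ℕ.* quadℕ (abs (Rep.a R))
    height² R = ℤₚ.+-injective (begin
      + (abs v ℕ.* abs v)                                          ≡⟨ ℤₚ.pos-* (abs v) (abs v) ⟩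
      + abs v ℤ.* + abs v                                          ≡⟨ abs-square v ⟩
      v ℤ.* v                                                      ≡⟨ Primitive.equation prim ⟩
      quad e ℤ.+ + 20 ℤ.* + p ℤ.* quad a                           ≡⟨ cong₂ ℤ._+_ (sym (abs-quad e))
                                                                      (cong₂ ℤ._*_ (sym (ℤₚ.pos-* 20 p)) (sym (abs-quad a))) ⟩
      + quadℕ (abs e) ℤ.+ + (20 ℕ.* p) ℤ.* + quadℕ (abs a)         ≡⟨ cong (λ t → + quadℕ (abs e) ℤ.+ t) (sym (ℤₚ.pos-* (20 ℕ.* p) _)) ⟩
      + (quadℕ (abs e) ℕ.+ 20 ℕ.* p ℕ.* quadℕ (abs a))             ∎)
      where
      open Rep R
      open ≡-Reasoning

    quadℕ-≢0 : ∀ {n} → n ≢ 0 → quadℕ n ≢ 0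
    quadℕ-≢0 n≢0 = *-≢0ℕ (*-≢0ℕ n≢0 n≢0) (*-≢0ℕ n≢0 n≢0)

    quadℕ-mono : ∀ {m n} → m ℕ.≤ n → quadℕ m ℕ.≤ quadℕ n
    quadℕ-mono h = ℕₚ.*-mono-≤ (ℕₚ.*-mono-≤ h h) (ℕₚ.*-mono-≤ h h)

    quadℕ-grows : ∀ {n} → 2 ℕ.≤ n → n ℕ.< quadℕ n
    quadℕ-grows {n} 2≤n = begin-strict
      n                       <⟨ ℕₚ.m<m*n n n 2≤n ⟩
      n ℕ.* n                 ≤⟨ ℕₚ.m≤m*n (n ℕ.* n) (n ℕ.* n) ⟩
      n ℕ.* n ℕ.* (n ℕ.* n)   ∎
      where
      open ℕₚ.≤-Reasoning
      n≢0 : n ≢ 0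
      n≢0 = ℕₚ.m<n⇒n≢0 2≤n
      instance _ = ℕ.≢-nonZero n≢0
               _ = ℕ.≢-nonZero (*-≢0ℕ n≢0 n≢0)

    quadℕ-≤⇒< : ∀ {m n} → 2 ℕ.≤ n → quadℕ m ℕ.≤ n → m ℕ.< n
    quadℕ-≤⇒< 2≤n m⁴≤n = ℕₚ.≰⇒> (λ n≤m → ℕₚ.<-irrefl refl (ℕₚ.<-≤-trans (quadℕ-grows 2≤n) (ℕₚ.≤-trans (quadℕ-mono n≤m) m⁴≤n)))

    2≤height : ∀ {Q} (R : Rep Q) → Rep.a R ≢ 0ℤ → 2 ℕ.≤ height R
    2≤height R a≢0 = ℕₚ.≰⇒> (λ h≤1 → ℕₚ.<-irrefl refl (begin-strict
      1                                                     <⟨ ℕₚ.+-mono-≤ (positive (quadℕ-≢0 (∣-∣≢0 (Rep.e≢0 R))))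
                                                                 (positive (*-≢0ℕ (*-≢0ℕ {20} (λ ()) p≢0) (quadℕ-≢0 (∣-∣≢0 a≢0)))) ⟩
      quadℕ (abs (Rep.e R)) ℕ.+ 20 ℕ.* p ℕ.* quadℕ (abs (Rep.a R))   ≡⟨ sym (height² R) ⟩
      height R ℕ.* height R                                 ≤⟨ ℕₚ.*-mono-≤ h≤1 h≤1 ⟩
      1                                                     ∎))
      where
      open ℕₚ.≤-Reasoning
      positive : ∀ {n} → n ≢ 0 → 1 ℕ.≤ n
      positive = ℕₚ.n≢0⇒n>0
      ∣-∣≢0 : ∀ {x} → x ≢ 0ℤ → abs x ≢ 0
      ∣-∣≢0 x≢0 h = x≢0 (ℤₚ.∣i∣≡0⇒i≡0 h)
      p≢0 : p ≢ 0
      p≢0 = ℕ.≢-nonZero⁻¹ p {{prime⇒nonZero (Admissible.p-prime adm)}}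

    a≡0⇒u≡0 : ∀ {Q} (R : Rep Q) → Rep.a R ≡ 0ℤ → u Q ≡ 0#
    a≡0⇒u≡0 {Q} R a≡0 = *-cancelʳ (ι≢0 (Rep.e≢0 R)) (certify (u Q ∷ ι (Rep.e R) ∷ ι (Rep.a R) ∷ [])
      ($0 :* $1) (# 0 :* $1)
      (# 1 ∙ $0 :* $1 ≔ $2 by Rep.u-eq R ∷ # 1 ∙ $2 ≔ # 0 by cong ι a≡0 ∷ []) refl)

    u≡0⇒height≤1 : ∀ {Q} (R : Rep Q) → u Q ≡ 0# → height R ℕ.≤ 1
    u≡0⇒height≤1 {Q} R u≡0 = ℕₚ.≮⇒≥ (λ 2≤h → ℕₚ.<-irrefl refl (begin-strict
      1                     <⟨ ℕₚ.*-mono-≤ (ℕₚ.<⇒≤ 2≤h) 2≤h ⟩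
      height R ℕ.* height R ≡⟨ height² R ⟩
      quadℕ (abs e) ℕ.+ 20 ℕ.* p ℕ.* quadℕ (abs a) ≡⟨ cong₂ (λ s t → quadℕ s ℕ.+ 20 ℕ.* p ℕ.* quadℕ t) ∣e∣≡1 (cong abs a≡0) ⟩
      1 ℕ.+ 20 ℕ.* p ℕ.* 0   ≡⟨ cong suc (ℕₚ.*-zeroʳ (20 ℕ.* p)) ⟩
      1 ∎))
      where
      open Rep R
      open ℕₚ.≤-Reasoning
      a≡0 : a ≡ 0ℤ
      a≡0 = ι-injective (certify (u Q ∷ ι e ∷ ι a ∷ []) $2 (# 0)
        (con ℤ.-1ℤ ∙ $0 :* $1 ≔ $2 by u-eq ∷ $1 ∙ $0 ≔ # 0 by u≡0 ∷ []) refl)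
      ∣e∣≡1 : abs e ≡ 1
      ∣e∣≡1 = Primitive.coprime prim (subst (abs e ℕ.∣_) (sym (cong abs a≡0)) (abs e ℕ.∣0) , ℕ.∣-refl)

    height≤1⇒u≡0 : ∀ {Q} (R : Rep Q) → height R ℕ.≤ 1 → u Q ≡ 0#
    height≤1⇒u≡0 R h≤1 = by-cases (Rep.a R ℤ.≟ 0ℤ)
      where
      by-cases : Dec (Rep.a R ≡ 0ℤ) → _
      by-cases (yes a≡0) = a≡0⇒u≡0 R a≡0
      by-cases (no a≢0)  = ⊥-elim (ℕₚ.<⇒≱ (2≤height R a≢0) h≤1)

    open IntegerMultiples abelianGroup

    half : ∀ n → ∃ λ k → n ≡ k ℕ.+ k ⊎ n ≡ suc (k ℕ.+ k)
    half zero    = 0 , inj₁ refl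
    half (suc n) with half n
    ... | k , inj₁ refl = k , inj₂ refl
    ... | k , inj₂ refl = suc k , inj₁ (cong suc (sym (ℕₚ.+-suc k k)))

    quadℕ≤1⇒≤1 : ∀ {n} → quadℕ n ℕ.≤ 1 → n ℕ.≤ 1
    quadℕ≤1⇒≤1 h = ℕₚ.≮⇒≥ (λ 2≤n → ℕₚ.<⇒≱ (ℕₚ.<-trans 2≤n (quadℕ-grows 2≤n)) h)

    -- A point Q of odd order 2 k + 1 is the duplicate of - k Q, which has smaller height.
    odd-torsion : ∀ k H {Q} (R : Rep Q) → height R ℕ.≤ H → suc (k ℕ.+ k) ×ℕ Q ≡ 𝕆 → height R ℕ.≤ 1
    odd-torsion k zero    R h≤0 nQ = ℕₚ.≤-trans h≤0 ℕ.z≤n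
    odd-torsion k (suc H) {Q} R h≤H nQ = by-size (2 ℕ.≤? height R)
      where
      open ≡-Reasoning
      n = suc (k ℕ.+ k)
      Q′ : 𝕁
      Q′ = (ℤ.- + k) · Q
      R′ = rep Q′
      Q′⊕Q′ : Q′ ⊕ Q′ ≡ Q
      Q′⊕Q′ = begin
        Q′ ⊕ Q′                                    ≡⟨ sym (·-+ (ℤ.- + k) (ℤ.- + k) Q) ⟩
        (ℤ.- + k ℤ.+ ℤ.- + k) · Q                  ≡⟨ cong (_· Q) (ℤ-Solver.certify (+ k ∷ ℤ.- + k ∷ [])
                                                        ($1 :+ $1) (# 1 :+ con ℤ.-1ℤ :* (# 1 :+ ($0 :+ $0)))
                                                        (# 2 ℤ-Solver.∙ $0 :+ $1 ≔ # 0 by ℤₚ.+-inverseʳ (+ k) ∷ ℤ-Solver.[]) refl) ⟩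
        (1ℤ ℤ.+ ℤ.-1ℤ ℤ.* + n) · Q                 ≡⟨ ·-+ 1ℤ (ℤ.-1ℤ ℤ.* + n) Q ⟩
        1ℤ · Q ⊕ (ℤ.-1ℤ ℤ.* + n) · Q               ≡⟨ cong₂ _⊕_ (identityʳ Q) (trans (·-* ℤ.-1ℤ (+ n) Q) (trans (·-cong ℤ.-1ℤ nQ) (·-ε ℤ.-1ℤ))) ⟩
        Q ⊕ 𝕆                                      ≡⟨ identityʳ Q ⟩
        Q                                          ∎
      nQ′ : n ×ℕ Q′ ≡ 𝕆
      nQ′ = begin
        + n · ((ℤ.- + k) · Q)     ≡⟨ sym (·-* (+ n) (ℤ.- + k) Q) ⟩
        (+ n ℤ.* (ℤ.- + k)) · Q   ≡⟨ cong (_· Q) (ℤₚ.*-comm (+ n) (ℤ.- + k)) ⟩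
        ((ℤ.- + k) ℤ.* + n) · Q   ≡⟨ ·-* (ℤ.- + k) (+ n) Q ⟩
        (ℤ.- + k) · (n ×ℕ Q)      ≡⟨ trans (·-cong (ℤ.- + k) nQ) (·-ε (ℤ.- + k)) ⟩
        𝕆                         ∎
      by-size : Dec (2 ℕ.≤ height R) → height R ℕ.≤ 1
      by-size (no 2≰h)  = ℕₚ.≮⇒≥ 2≰h
      -- Induction gives u = 0 at Q′, so Q′ is 2-torsion and Q = 2 Q′ is 𝕆.
      by-size (yes 2≤h) = u≡0⇒height≤1 R (cong u (trans (sym Q′⊕Q′) (u≡0⇒2-torsion Q′ (height≤1⇒u≡0 R′
        (odd-torsion k H R′ (ℕ.s≤s⁻¹ (ℕₚ.<-≤-trans (quadℕ-≤⇒< 2≤h (height-double R′ R Q′⊕Q′)) h≤H)) nQ′)))))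

    -- Induction on the order n, bounded by N. For n = 2 k the point 2 Q is killed by k, and the
    -- fourth power of the height of Q is at most the height of 2 Q, hence at most 1.
    torsion : ∀ N n → n ℕ.≤ N → n ≢ 0 → ∀ {Q} (R : Rep Q) → n ×ℕ Q ≡ 𝕆 → height R ℕ.≤ 1
    torsion zero _ ℕ.z≤n n≢0 = ⊥-elim (n≢0 refl)
    torsion (suc N) n n≤N n≢0 {Q} R nQ = by-parity (half n)
      where
      by-parity : (∃ λ k → n ≡ k ℕ.+ k ⊎ n ≡ suc (k ℕ.+ k)) → height R ℕ.≤ 1
      by-parity (k , inj₂ refl) = odd-torsion k (height R) R ℕₚ.≤-refl nQ
      by-parity (k , inj₁ refl) = quadℕ≤1⇒≤1 (ℕₚ.≤-trans (height-double R R₂ refl)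
          (torsion N k k≤N k≢0 R₂ (trans (·-∙ (+ k) Q Q) (trans (sym (×ℕ-homo-+ Q k k)) nQ))))
        where
        R₂ = rep (Q ⊕ Q)
        k≢0 : k ≢ 0
        k≢0 refl = n≢0 refl
        k≤N : k ℕ.≤ N
        k≤N = ℕ.s≤s⁻¹ (ℕₚ.<-≤-trans (ℕₚ.m<m+n k (ℕₚ.n≢0⇒n>0 k≢0)) n≤N)

    infinite-order : ∀ {Q} → u Q ≢ 0# → ∀ c → c · Q ≡ 𝕆 → c ≡ 0ℤ
    infinite-order {Q} u≢0 (+ zero)  _  = refl
    infinite-order {Q} u≢0 (+ suc n) nQ =
      ⊥-elim (u≢0 (height≤1⇒u≡0 (rep Q) (torsion (suc n) (suc n) ℕₚ.≤-refl (λ ()) (rep Q) nQ)))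
    infinite-order {Q} u≢0 -[1+ n ]  nQ =
      ⊥-elim (u≢0 (height≤1⇒u≡0 (rep Q) (torsion (suc n) (suc n) ℕₚ.≤-refl (λ ()) (rep Q)
        (trans (sym (⁻¹-involutive (suc n ×ℕ Q))) (trans (cong ⊖_ nQ) ε⁻¹≈ε)))))
      where open import Algebra.Properties.Group (AbelianGroup.group abelianGroup) using (⁻¹-involutive; ε⁻¹≈ε)

    halve-height : ∀ {Q H} (R : Rep Q) (RH : Rep H) → H ⊕ H ~ Q → quadℕ (height RH) ℕ.≤ height R
    halve-height {Q} {H} R RH h = subst (quadℕ (height RH) ℕ.≤_) (proj₂ (~-rep h R)) (height-double RH (proj₁ (~-rep h R)) refl)

    -- Doubling once more annihilates the possible summand 𝕋.
    quarter : ∀ {H Q} → H ⊕ H ~ Q → + 4 · H ≡ + 2 · Q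
    quarter {H} {Q} h = trans (·-+ (+ 2) (+ 2) H) (trans (cong₂ _⊕_ (two H) (two H)) (trans (~-double h) (sym (two Q))))
      where
      two : ∀ Q → + 2 · Q ≡ Q ⊕ Q
      two Q = cong (Q ⊕_) (identityʳ Q)

    -- The condition l ≠ 0 is recorded so that H can take the place of Q₂ as well as of Q₁.
    SmallerHalf : 𝕁 → 𝕁 → ℕ → Set
    SmallerHalf Q₁ Q₂ y = ∃₂ λ H l → l ≢ 0ℤ × + 4 · H ≡ + 2 · Q₁ ⊕ l · Q₂ × height (rep H) ℕ.< y

    -- The product of the heights of Q₁ ± Q₂ is at most 2 y⁴, so that one of their halves has height less than y.
    smaller-half : ∀ {Q₁ Q₂} (R₁ : Rep Q₁) (R₂ : Rep Q₂) y → height R₁ ℕ.≤ y → height R₂ ℕ.≤ y → 2 ℕ.≤ y →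
      Twist Q₁ → Twist Q₂ → SmallerHalf Q₁ Q₂ y
    smaller-half {Q₁} {Q₂} R₁ R₂ y h₁≤y h₂≤y 2≤y twist₁ twist₂ = choose (~-twist twist₁ twist₂) (~-twist twist₁ (⊖-Twist twist₂))
      where
      S = rep (Q₁ ⊕ Q₂)
      S′ = rep (Q₁ ⊕ ⊖ Q₂)
      -- If both halves had height at least y, then y⁸ ≤ 2 y⁴, against y ≥ 2.
      contradiction : ∀ {H H′} → H ⊕ H ~ Q₁ ⊕ Q₂ → H′ ⊕ H′ ~ Q₁ ⊕ ⊖ Q₂ → y ℕ.≤ height (rep H) → y ℕ.≤ height (rep H′) → ⊥
      contradiction {H} {H′} h h′ y≤H y≤H′ = ℕₚ.<⇒≱ (ℕₚ.≤-<-trans 2≤y (quadℕ-grows 2≤y)) (ℕₚ.*-cancelʳ-≤ (quadℕ y) 2 (quadℕ y) (begin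
        quadℕ y ℕ.* quadℕ y                                      ≤⟨ ℕₚ.*-mono-≤ (ℕₚ.≤-trans (quadℕ-mono y≤H) (halve-height {Q₁ ⊕ Q₂} {H} S (rep H) h))
                                                                     (ℕₚ.≤-trans (quadℕ-mono y≤H′) (halve-height {Q₁ ⊕ ⊖ Q₂} {H′} S′ (rep H′) h′)) ⟩
        height S ℕ.* height S′                                   ≤⟨ height-sum R₁ R₂ S S′ ⟩
        2 ℕ.* (height R₁ ℕ.* height R₁ ℕ.* (height R₂ ℕ.* height R₂)) ≤⟨ ℕₚ.*-monoʳ-≤ 2 (ℕₚ.*-mono-≤ (ℕₚ.*-mono-≤ h₁≤y h₁≤y) (ℕₚ.*-mono-≤ h₂≤y h₂≤y)) ⟩
        2 ℕ.* quadℕ y                                            ∎))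
        where
        open ℕₚ.≤-Reasoning
        instance _ = ℕ.≢-nonZero (quadℕ-≢0 (ℕₚ.m<n⇒n≢0 2≤y))
      choose : Halvable (Q₁ ⊕ Q₂) → Halvable (Q₁ ⊕ ⊖ Q₂) → SmallerHalf Q₁ Q₂ y
      choose (H , h) (H′ , h′) = by-size (height (rep H) ℕ.<? y) (height (rep H′) ℕ.<? y)
        where
        ⊖Q₂ : ⊖ Q₂ ≡ ℤ.-1ℤ · Q₂
        ⊖Q₂ = cong ⊖_ (sym (identityʳ Q₂))
        by-size : Dec (height (rep H) ℕ.< y) → Dec (height (rep H′) ℕ.< y) → SmallerHalf Q₁ Q₂ y
        by-size (yes H<y) _ = H , + 2 , (λ ()) , trans (quarter {H} h) (·-∙ (+ 2) Q₁ Q₂) , H<y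
        by-size (no _) (yes H′<y) = H′ , + 2 ℤ.* ℤ.-1ℤ , (λ ()) , trans (quarter {H′} h′) (trans (·-∙ (+ 2) Q₁ (⊖ Q₂))
          (cong (+ 2 · Q₁ ⊕_) (trans (cong (+ 2 ·_) ⊖Q₂) (sym (·-* (+ 2) ℤ.-1ℤ Q₂))))) , H′<y
        by-size (no H≮y) (no H′≮y) = ⊥-elim (contradiction {H} {H′} h h′ (ℕₚ.≮⇒≥ H≮y) (ℕₚ.≮⇒≥ H′≮y))

    -- N exceeds the sum of the two heights and is the measure of the descent: each replacement
    -- lowers one height, keeps the other, and preserves independence by `Independent₂-quarter`.
    no-independent-pair : ∀ N {Q₁ Q₂} (R₁ : Rep Q₁) (R₂ : Rep Q₂) → height R₁ ℕ.+ height R₂ ℕ.< N → ¬ Independent₂ Q₁ Q₂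
    no-independent-pair (suc N) {Q₁} {Q₂} R₁ R₂ h<N ind = cases (nonzero R₁ ind) (nonzero R₂ (Independent₂-swap ind))
      where
      nonzero : ∀ {Q Q′} (R : Rep Q) → Independent₂ Q Q′ → Rep.a R ≢ 0ℤ
      nonzero {Q} {Q′} R ind a≡0 = 2≢0ℤ (proj₁ (ind (+ 2) 0ℤ (trans (identityʳ (+ 2 · Q)) (trans (cong (Q ⊕_) (identityʳ Q))
        (u≡0⇒2-torsion Q (a≡0⇒u≡0 R a≡0))))))
        where
        2≢0ℤ : + 2 ≢ 0ℤ
        2≢0ℤ ()

      replace₁ : ∀ {H} k l → k ≢ 0ℤ → + 4 · H ≡ k · Q₁ ⊕ l · Q₂ → height (rep H) ℕ.< height R₁ → ⊥
      replace₁ {H} k l k≢0 4H smaller = no-independent-pair N (rep H) R₂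
        (ℕₚ.<-≤-trans (ℕₚ.+-monoˡ-< (height R₂) smaller) (ℕ.s≤s⁻¹ h<N)) (Independent₂-quarter k l k≢0 4H ind)

      replace₂ : ∀ {H} k l → l ≢ 0ℤ → + 4 · H ≡ k · Q₁ ⊕ l · Q₂ → height (rep H) ℕ.< height R₂ → ⊥
      replace₂ {H} k l l≢0 4H smaller = no-independent-pair N R₁ (rep H)
        (ℕₚ.<-≤-trans (ℕₚ.+-monoʳ-< (height R₁) smaller) (ℕ.s≤s⁻¹ h<N))
        (Independent₂-swap (Independent₂-quarter l k l≢0 (trans 4H (⊕-comm (k · Q₁) (l · Q₂))) (Independent₂-swap ind)))

      cases : Rep.a R₁ ≢ 0ℤ → Rep.a R₂ ≢ 0ℤ → ⊥
      cases a₁≢0 a₂≢0 = by-dichotomy (dichotomy R₁ a₁≢0) (dichotomy R₂ a₂≢0)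
        where
        by-dichotomy : Halvable Q₁ ⊎ Twist Q₁ → Halvable Q₂ ⊎ Twist Q₂ → ⊥
        by-dichotomy (inj₁ (H , h)) _ = replace₁ {H} (+ 2) 0ℤ (λ ()) (trans (quarter {H} h) (sym (identityʳ (+ 2 · Q₁))))
          (quadℕ-≤⇒< (2≤height R₁ a₁≢0) (halve-height {Q₁} {H} R₁ (rep H) h))
        by-dichotomy (inj₂ _) (inj₁ (H , h)) = replace₂ {H} 0ℤ (+ 2) (λ ()) (trans (quarter {H} h) (sym (⊕-identityˡ (+ 2 · Q₂))))
          (quadℕ-≤⇒< (2≤height R₂ a₂≢0) (halve-height {Q₂} {H} R₂ (rep H) h))
        by-dichotomy (inj₂ twist₁) (inj₂ twist₂) =
          [ (λ h₁≤h₂ → larger₂ (smaller-half R₁ R₂ (height R₂) h₁≤h₂ ℕₚ.≤-refl (2≤height R₂ a₂≢0) twist₁ twist₂))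
          , (λ h₂≤h₁ → larger₁ (smaller-half R₁ R₂ (height R₁) ℕₚ.≤-refl h₂≤h₁ (2≤height R₁ a₁≢0) twist₁ twist₂)) ]′
          (ℕₚ.≤-total (height R₁) (height R₂))
          where
          larger₁ : SmallerHalf Q₁ Q₂ (height R₁) → ⊥
          larger₁ (H , l , _ , 4H , smaller) = replace₁ {H} (+ 2) l (λ ()) 4H smaller
          larger₂ : SmallerHalf Q₁ Q₂ (height R₂) → ⊥
          larger₂ (H , l , l≢0 , 4H , smaller) = replace₂ {H} (+ 2) l l≢0 4H smaller

    dependent : ∀ {Q₁ Q₂} → ¬ Independent₂ Q₁ Q₂
    dependent {Q₁} {Q₂} = no-independent-pair (suc (height (rep Q₁) ℕ.+ height (rep Q₂))) (rep Q₁) (rep Q₂) ℕₚ.≤-refl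

-- The group-theoretic data that determine rank one.

module Models where

  open PolynomialIdentities
  open DiscreteFields
  open CurveToQuartic
  open Congruences
  open TwoDescent
  open FractionFields
  open Multiples
  open Halving
  open import Data.Integer as ℤ using (+_; 0ℤ)
  open import Relation.Binary.PropositionalEquality hiding ([_])

  -- What is needed of an abelian group to read off the rank: it receives the affine points compatibly with
  -- every branch of the chord-and-tangent law, and none of them is sent to ε.
  record RankOneModel (𝔽 : DiscreteField) (a : DiscreteField.F 𝔽) : Set₁ where
    open DiscreteField 𝔽

    OnE : F → F → Set
    OnE x y = y * y ≡ x * x * x + a * x + 0#

    thirdX : F → F → F → F
    thirdX l x₁ x₂ = l * l - x₁ - x₂

    thirdY : F → F → F → F → F
    thirdY l x₁ y₁ x₂ = l * (x₁ - thirdX l x₁ x₂) - y₁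

    field
      G     : AbelianGroup 0ℓ 0ℓ
    open AbelianGroup G using (Carrier; _≈_; _∙_; ε; _⁻¹)
    open IntegerMultiples G using (_·_; Independent₂)
    field
      image          : ∀ x y → OnE x y → Carrier
      chord          : ∀ l x₁ y₁ x₂ y₂ (on₁ : OnE x₁ y₁) (on₂ : OnE x₂ y₂) →
        x₂ - x₁ ≢ 0# → l * (x₂ - x₁) ≡ y₂ - y₁ →
        Σ (OnE (thirdX l x₁ x₂) (thirdY l x₁ y₁ x₂)) λ on₃ → image _ _ on₃ ≈ image x₁ y₁ on₁ ∙ image x₂ y₂ on₂
      vertical       : ∀ x₁ y₁ x₂ y₂ (on₁ : OnE x₁ y₁) (on₂ : OnE x₂ y₂) →
        x₂ - x₁ ≡ 0# → y₁ + y₂ ≡ 0# → ε ≈ image x₁ y₁ on₁ ∙ image x₂ y₂ on₂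
      non-degenerate : ∀ x₁ y₁ x₂ y₂ → OnE x₁ y₁ → OnE x₂ y₂ → x₂ - x₁ ≡ 0# → y₁ + y₂ ≢ 0# → (1# + 1#) * y₁ ≢ 0#
      tangent        : ∀ l x₁ y₁ x₂ y₂ (on₁ : OnE x₁ y₁) (on₂ : OnE x₂ y₂) →
        x₂ - x₁ ≡ 0# → y₁ + y₂ ≢ 0# → l * ((1# + 1#) * y₁) ≡ (1# + 1# + 1#) * x₁ * x₁ + a →
        Σ (OnE (thirdX l x₁ x₂) (thirdY l x₁ y₁ x₂)) λ on₃ → image _ _ on₃ ≈ image x₁ y₁ on₁ ∙ image x₂ y₂ on₂
      opposite       : ∀ x y (on : OnE x y) → Σ (OnE x (- y)) λ on⁻ → image x (- y) on⁻ ≈ image x y on ⁻¹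
      image≉ε        : ∀ x y (on : OnE x y) → ¬ image x y on ≈ ε
      generator      : ∃₂ λ x y → Σ (OnE x y) λ on → ∀ c → c · image x y on ≈ ε → c ≡ 0ℤ
      dependent      : ∀ P Q → ¬ Independent₂ P Q

  module _ (ℱ : FractionField) (p m : ℕ) (adm : Admissible p) (p+5≡8m² : + p ℤ.+ + 5 ≡ + 8 ℤ.* (+ m ℤ.* + m))
           (a : DiscreteField.F (FractionField.𝔽 ℱ))
           (a≡ : a ≡ DiscreteField._-_ (FractionField.𝔽 ℱ) (DiscreteField.0# (FractionField.𝔽 ℱ)) (DiscreteField.ι (FractionField.𝔽 ℱ) (+ 5 ℤ.* + p)))
           where
    open FractionFieldProperties ℱ
    open CurveMap 𝔽 a (negative-nonsquare adm a≡)

    private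
      d≡ : d ≡ ι (+ 20 ℤ.* + p)
      d≡ = certify (a ∷ ι (+ 5 ℤ.* + p) ∷ ι (+ p) ∷ ι (+ 20 ℤ.* + p) ∷ [])
        (# 0 :- # 4 :* $0) $3
        ( con (ℤ.- + 4) ∙ $0 ≔ # 0 :- $1 by a≡
        ∷ # 4 ∙ $1 ≔ # 5 :* $2 by ι-* (+ 5) (+ p)
        ∷ con ℤ.-1ℤ ∙ $3 ≔ # 20 :* $2 by ι-* (+ 20) (+ p) ∷ []) refl

    open RankBound ℱ adm d d≡ d-nonsquare using (infinite-order; dependent)

    same-x : ∀ {x₁ x₂} → x₂ - x₁ ≡ 0# → x₂ ≡ x₁
    same-x {x₁} {x₂} Δ≡0 = certify (x₁ ∷ x₂ ∷ []) $1 $0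
      (# 1 ∙ $1 :- $0 ≔ # 0 by Δ≡0 ∷ []) refl

    same-y : ∀ {x₁ y₁ x₂ y₂} → x₂ - x₁ ≡ 0# → y₁ + y₂ ≢ 0# → OnE x₁ y₁ → OnE x₂ y₂ → y₂ ≡ y₁
    same-y {x₁} {y₁} {x₂} {y₂} Δ≡0 s≢0 on₁ on₂ = *-cancelʳ s≢0 (certify (x₁ ∷ y₁ ∷ x₂ ∷ y₂ ∷ a ∷ []) ($3 :* ($1 :+ $3)) ($1 :* ($1 :+ $3))
      ( # 1 ∙ $3 :* $3 ≔ 𝔼on $4 $2 by on₂
      ∷ con ℤ.-1ℤ ∙ $1 :* $1 ≔ 𝔼on $4 $0 by on₁
      ∷ $2 :* $2 :+ $2 :* $0 :+ $0 :* $0 :+ $4 ∙ $2 :- $0 ≔ # 0 by Δ≡0 ∷ []) refl)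

    image-cong : ∀ {x x′ y y′} (on : OnE x y) (on′ : OnE x′ y′) → x ≡ x′ → y ≡ y′ → image x y on ≡ image x′ y′ on′
    image-cong on on′ refl refl = refl

    generator-x generator-y : F
    generator-x = ι (+ 4) * (ι (+ m) * ι (+ m))
    generator-y = ι (+ m) * (ι (+ p) - ι (+ 5))

    -- x = (2 m)², and by 8 m² = p + 5 also x² - 5 p = ((p + 5)² - 20 p) / 4 = ((p - 5) / 2)².
    generator-on : OnE generator-x generator-y
    generator-on = certify (ι (+ p) ∷ ι (+ m) ∷ a ∷ ι (+ 5 ℤ.* + p) ∷ [])
      (y :* y) (x :* x :* x :+ $2 :* x :+ # 0)
      ( $1 :* $1 :* ($0 :+ # 5 :+ # 8 :* ($1 :* $1)) ∙
          $0 :+ # 5 ≔ # 8 :* ($1 :* $1) by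
            lift (+ p ∷ + m ∷ []) ($0 :+ # 5) (# 8 :* ($1 :* $1)) p+5≡8m²
      ∷ # 0 :- x ∙ $2 ≔ # 0 :- $3 by a≡
      ∷ x ∙ $3 ≔ # 5 :* $0 by ι-* (+ 5) (+ p) ∷ []) refl
      where
      x y : Expr 4
      x = # 4 :* ($1 :* $1)
      y = $1 :* ($0 :- # 5)

    -- Makes u nonzero at the image, which is the criterion of `infinite-order`. Here m = 0
    -- contradicts p + 5 = 8 m², and p = 5 contradicts p ≡ 3 modulo 4.
    generator-y≢0 : generator-y ≢ 0#
    generator-y≢0 h = [ m≢0 , p≢5 ]′ (ℤₚ.i*j≡0⇒i≡0∨j≡0 (+ m)
      (lower (+ p ∷ + m ∷ []) ($1 :* ($0 :- # 5)) (# 0) h))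
      where
      m≢0 : + m ≢ 0ℤ
      m≢0 m≡0 = p+5≢0 (ℕₚ.m+n≡0⇒n≡0 p (ℤₚ.+-injective (trans p+5≡8m² (cong (λ t → + 8 ℤ.* (t ℤ.* t)) m≡0))))
        where
        p+5≢0 : 5 ≢ 0
        p+5≢0 ()
      p≢5 : + p ℤ.- + 5 ≢ 0ℤ
      p≢5 h = inconsistent 4 (+ p ∷ []) ($0 :+ # 1 ∷ $0 :- # 5 ∷ []) refl (λ ())
        (Admissible.p≡3[4] adm ∷ ≡0⇒∣ 4 h ∷ [])

    rankOneModel : RankOneModel 𝔽 a
    rankOneModel = record
      { G = abelianGroup
      ; image = image
      ; chord = λ l _ _ _ _ → chord {l}
      ; vertical = λ x₁ y₁ x₂ y₂ on₁ on₂ Δ≡0 s≡0 → sym (begin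
          image x₁ y₁ on₁ ⊕ image x₂ y₂ on₂                ≡⟨ cong (image x₁ y₁ on₁ ⊕_) (image-cong on₂ (neg-OnE on₁) (same-x Δ≡0) (opposite-y s≡0)) ⟩
          image x₁ y₁ on₁ ⊕ image x₁ (- y₁) (neg-OnE on₁)  ≡⟨ cong (image x₁ y₁ on₁ ⊕_) (image-neg on₁) ⟩
          image x₁ y₁ on₁ ⊕ ⊖ image x₁ y₁ on₁              ≡⟨ AbelianGroup.inverseʳ abelianGroup (image x₁ y₁ on₁) ⟩
          𝕆                                                ∎)
      ; non-degenerate = λ x₁ y₁ x₂ y₂ on₁ on₂ → not-degenerate on₁ on₂
      ; tangent = λ l x₁ y₁ x₂ y₂ on₁ on₂ Δ≡0 s≢0 slope →
          doubling l on₁ on₂ (same-x Δ≡0) (same-y Δ≡0 s≢0 on₁ on₂) (not-degenerate on₁ on₂ Δ≡0 s≢0) slope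
      ; opposite = λ x y on → neg-OnE on , image-neg on
      ; image≉ε = λ x y on → image≢𝕆 (ι≢0 (λ ())) on
      ; generator = generator-x , generator-y , generator-on , infinite-order (u-image≢0 generator-on generator-y≢0)
      ; dependent = λ P Q → dependent {P} {Q}
      }
      where
      open ≡-Reasoning
      opposite-y : ∀ {y₁ y₂} → y₁ + y₂ ≡ 0# → y₂ ≡ - y₁
      opposite-y {y₁} {y₂} s≡0 = certify (y₁ ∷ y₂ ∷ - y₁ ∷ []) $1 $2
        (# 1 ∙ $0 :+ $1 ≔ # 0 by s≡0 ∷ con ℤ.-1ℤ ∙ $2 ≔ # 0 :- $0 by negate y₁ ∷ []) refl
      -- Equal abscissas and y₁ + y₂ ≠ 0 force y₂ = y₁, so that 2 y₁ = y₁ + y₂.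
      not-degenerate : ∀ {x₁ y₁ x₂ y₂} → OnE x₁ y₁ → OnE x₂ y₂ → x₂ - x₁ ≡ 0# → y₁ + y₂ ≢ 0# → (1# + 1#) * y₁ ≢ 0#
      not-degenerate {x₁} {y₁} {x₂} {y₂} on₁ on₂ Δ≡0 s≢0 2y≡0 = s≢0 (certify (y₁ ∷ y₂ ∷ [])
        ($0 :+ $1) (# 0)
        ( # 1 ∙ (# 1 :+ # 1) :* $0 ≔ # 0 by 2y≡0
        ∷ # 1 ∙ $1 ≔ $0 by same-y Δ≡0 s≢0 on₁ on₂ ∷ []) refl)
      doubling : ∀ l {x₁ y₁ x₂ y₂} (on₁ : OnE x₁ y₁) (on₂ : OnE x₂ y₂) → x₂ ≡ x₁ → y₂ ≡ y₁ → (1# + 1#) * y₁ ≢ 0# →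
        l * ((1# + 1#) * y₁) ≡ (1# + 1# + 1#) * x₁ * x₁ + a →
        let open Line l x₁ y₁ x₂ in Σ (OnE x₃ y₃) λ on₃ → image x₃ y₃ on₃ ≡ image x₁ y₁ on₁ ⊕ image x₂ y₂ on₂
      doubling l on₁ on₂ refl refl 2y≢0 slope = tangent {l} on₁ 2y≢0 slope

-- Transfer to ℚ and to the chord-and-tangent law of `add`.

module CurvesOverℚ where

  open PolynomialIdentities
  open DiscreteFields
  open Congruences
  open TwoDescent
  open FractionFields
  open Multiples
  open Models
  open import Defs
  open import Data.Fin as Fin using (Fin)
  open import Data.Integer as ℤ using (ℤ; +_; -[1+_]; 0ℤ; 1ℤ)
  import Data.Integer.Divisibility.Signed as Signed
  import Data.Nat.Coprimality as C
  open import Data.Nat.Primality using (Prime)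
  open import Data.Rational as ℚ using (ℚ; 0ℚ; 1ℚ; mkℚ; toℚᵘ; 1/_; ≢-nonZero; ↥_; ↧_)
  import Data.Rational
  import Data.Rational.Properties as ℚₚ
  open import Data.Rational.Unnormalised as ℚᵘ using (mkℚᵘ; *≡*; _≃_)
  import Data.Rational.Unnormalised.Properties as ℚᵘₚ
  import Relation.Binary.PropositionalEquality as ≡
  open ≡ using (_≡_; _≢_)

  module Rationals where
    open ≡ using (refl; sym; trans; cong; cong₂)

    ι : ℤ → ℚ
    ι z = z ℚ./ 1

    toℚᵘ-ι : ∀ z → toℚᵘ (ι z) ≃ mkℚᵘ z 0
    toℚᵘ-ι z = ℚₚ.toℚᵘ-fromℚᵘ (mkℚᵘ z 0)

    ι-+ : ∀ a b → ι (a ℤ.+ b) ≡ ι a ℚ.+ ι b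
    ι-+ a b = ℚₚ.toℚᵘ-injective (begin
      toℚᵘ (ι (a ℤ.+ b))          ≈⟨ toℚᵘ-ι (a ℤ.+ b) ⟩
      mkℚᵘ (a ℤ.+ b) 0            ≈⟨ *≡* (cong (ℤ._* 1ℤ) (cong₂ ℤ._+_ (sym (ℤₚ.*-identityʳ a)) (sym (ℤₚ.*-identityʳ b)))) ⟩
      mkℚᵘ a 0 ℚᵘ.+ mkℚᵘ b 0      ≈⟨ ℚᵘₚ.+-cong (ℚᵘₚ.≃-sym (toℚᵘ-ι a)) (ℚᵘₚ.≃-sym (toℚᵘ-ι b)) ⟩
      toℚᵘ (ι a) ℚᵘ.+ toℚᵘ (ι b)  ≈⟨ ℚᵘₚ.≃-sym (ℚₚ.toℚᵘ-homo-+ (ι a) (ι b)) ⟩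
      toℚᵘ (ι a ℚ.+ ι b)          ∎)
      where open ℚᵘₚ.≃-Reasoning

    ι-* : ∀ a b → ι (a ℤ.* b) ≡ ι a ℚ.* ι b
    ι-* a b = ℚₚ.toℚᵘ-injective (begin
      toℚᵘ (ι (a ℤ.* b))          ≈⟨ toℚᵘ-ι (a ℤ.* b) ⟩
      mkℚᵘ a 0 ℚᵘ.* mkℚᵘ b 0      ≈⟨ ℚᵘₚ.*-cong (ℚᵘₚ.≃-sym (toℚᵘ-ι a)) (ℚᵘₚ.≃-sym (toℚᵘ-ι b)) ⟩
      toℚᵘ (ι a) ℚᵘ.* toℚᵘ (ι b)  ≈⟨ ℚᵘₚ.≃-sym (ℚₚ.toℚᵘ-homo-* (ι a) (ι b)) ⟩
      toℚᵘ (ι a ℚ.* ι b)          ∎)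
      where open ℚᵘₚ.≃-Reasoning

    ι-injective : ∀ {a b} → ι a ≡ ι b → a ≡ b
    ι-injective {a} {b} eq = numerators
      (ℚᵘₚ.≃-trans (ℚᵘₚ.≃-sym (toℚᵘ-ι a)) (ℚᵘₚ.≃-trans (ℚᵘₚ.≃-reflexive (cong toℚᵘ eq)) (toℚᵘ-ι b)))
      where
      numerators : mkℚᵘ a 0 ≃ mkℚᵘ b 0 → a ≡ b
      numerators (*≡* h) = trans (sym (ℤₚ.*-identityʳ a)) (trans h (ℤₚ.*-identityʳ b))

    ↥≡*↧ : ∀ q → q ℚ.* ι (↧ q) ≡ ι (↥ q)
    ↥≡*↧ q@(mkℚ _ _ _) = ℚₚ.toℚᵘ-injective (begin
      toℚᵘ (q ℚ.* ι (↧ q))            ≈⟨ ℚₚ.toℚᵘ-homo-* q (ι (↧ q)) ⟩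
      toℚᵘ q ℚᵘ.* toℚᵘ (ι (↧ q))      ≈⟨ ℚᵘₚ.*-cong (ℚᵘₚ.≃-refl {toℚᵘ q}) (toℚᵘ-ι (↧ q)) ⟩
      toℚᵘ q ℚᵘ.* mkℚᵘ (↧ q) 0        ≈⟨ *≡* (ℤₚ.*-assoc (↥ q) (↧ q) 1ℤ) ⟩
      mkℚᵘ (↥ q) 0                    ≈⟨ ℚᵘₚ.≃-sym (toℚᵘ-ι (↥ q)) ⟩
      toℚᵘ (ι (↥ q))                  ∎)
      where open ℚᵘₚ.≃-Reasoning

    inv : ℚ → ℚ
    inv x with x ℚₚ.≟ 0ℚ
    ... | yes _  = 0ℚ
    ... | no x≢0 = let instance nz = ≢-nonZero x≢0 in 1/ x

    *-inv : ∀ {x} → x ≢ 0ℚ → x ℚ.* inv x ≡ 1ℚ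
    *-inv {x} x≢0 with x ℚₚ.≟ 0ℚ
    ... | yes x≡0 = ⊥-elim (x≢0 x≡0)
    ... | no x≢0′ = let instance nz = ≢-nonZero x≢0′ in ℚₚ.*-inverseʳ x

  ℚ-field : DiscreteField
  ℚ-field = record
    { F = ℚ
    ; _+_ = ℚ._+_
    ; _*_ = ℚ._*_
    ; -_ = ℚ.-_
    ; ι = Rationals.ι
    ; isCommutativeRing = ℚₚ.+-*-isCommutativeRing
    ; ι-+ = Rationals.ι-+
    ; ι-* = Rationals.ι-*
    ; inv = Rationals.inv
    ; *-inv = Rationals.*-inv
    ; _≟_ = ℚₚ._≟_
    }

  ℚ-fractions : FractionField
  ℚ-fractions = record
    { 𝔽 = ℚ-field
    ; ι-injective = Rationals.ι-injective
    ; fraction = fraction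
    }
    where
    fraction : ∀ q → Fraction ℚ-field q
    fraction q@(mkℚ n e-1 c) = record
      { a = n ; e = + suc e-1 ; e≢0 = λ () ; coprime = C.recompute c ; value = Rationals.↥≡*↧ q }

  module _ (E : Weierstrass) (x₁ y₁ x₂ y₂ : ℚ) where
    open Data.Rational using (_+_; _-_; _*_)
    open ≡ using (trans; cong)

    -- Mirrors the case tree of `add`, with each quotient replaced by the linear equation for the
    -- slope that characterises it.
    data AddView : Point → Set where
      vertical   : x₂ - x₁ ≡ 0ℚ → y₁ + y₂ ≡ 0ℚ → AddView O
      degenerate : x₂ - x₁ ≡ 0ℚ → y₁ + y₂ ≢ 0ℚ → 2ℚ * y₁ ≡ 0ℚ → AddView O
      secant     : ∀ l → x₂ - x₁ ≢ 0ℚ → l * (x₂ - x₁) ≡ y₂ - y₁ →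
        AddView (pt (l * l - x₁ - x₂) (l * (x₁ - (l * l - x₁ - x₂)) - y₁))
      tangent    : ∀ l → x₂ - x₁ ≡ 0ℚ → y₁ + y₂ ≢ 0ℚ → 2ℚ * y₁ ≢ 0ℚ → l * (2ℚ * y₁) ≡ 3ℚ * x₁ * x₁ + A E →
        AddView (pt (l * l - x₁ - x₂) (l * (x₁ - (l * l - x₁ - x₂)) - y₁))

    private
      ÷-* : ∀ n m .{{_ : ℚ.NonZero m}} → (n ℚ.÷ m) * m ≡ n
      ÷-* n m = trans (ℚₚ.*-assoc n (1/ m) m) (trans (cong (n *_) (ℚₚ.*-inverseˡ m)) (ℚₚ.*-identityʳ n))

    addView : AddView (add E (pt x₁ y₁) (pt x₂ y₂))
    addView with (x₂ - x₁) ℚₚ.≟ 0ℚ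
    ... | no Δ≢0 = let instance nz = ≢-nonZero Δ≢0 in secant ((y₂ - y₁) ℚ.÷ (x₂ - x₁)) Δ≢0 (÷-* (y₂ - y₁) (x₂ - x₁))
    ... | yes Δ≡0 with (y₁ + y₂) ℚₚ.≟ 0ℚ
    ...   | yes s≡0 = vertical Δ≡0 s≡0
    ...   | no s≢0 with (2ℚ * y₁) ℚₚ.≟ 0ℚ
    ...     | yes 2y≡0 = degenerate Δ≡0 s≢0 2y≡0
    ...     | no 2y≢0 = let instance nz = ≢-nonZero 2y≢0 in tangent ((3ℚ * x₁ * x₁ + A E) ℚ.÷ (2ℚ * y₁)) Δ≡0 s≢0 2y≢0 (÷-* (3ℚ * x₁ * x₁ + A E) (2ℚ * y₁))

  module RankOne (p : ℕ) (model : RankOneModel ℚ-field (A (Ep p))) where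
    open RankOneModel model
    open AbelianGroup G hiding (_-_)
    open IntegerMultiples G using (_·_; _×ℕ_; Independent₂)
    open import Algebra.Properties.Group group using (ε⁻¹≈ε)

    E : Weierstrass
    E = Ep p

    -- A relation, because a bare `Point` need not lie on the curve; it carries the curve equation
    -- along, so that closure under `add` and compatibility with the group are proved together.
    Maps : Point → Carrier → Set
    Maps O         g = ε ≈ g
    Maps (pt x y)  g = Σ (OnE x y) λ on → image x y on ≈ g

    maps-respˡ : ∀ P {g h} → g ≈ h → Maps P g → Maps P h
    maps-respˡ O        g≈h m        = trans m g≈h
    maps-respˡ (pt x y) g≈h (on , m) = on , trans m g≈h

    maps-view : ∀ {x₁ y₁ x₂ y₂ R g₁ g₂} → AddView E x₁ y₁ x₂ y₂ R → Maps (pt x₁ y₁) g₁ → Maps (pt x₂ y₂) g₂ → Maps R (g₁ ∙ g₂)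
    maps-view {x₁} {y₁} {x₂} {y₂} {R} view (on₁ , m₁) (on₂ , m₂) = maps-respˡ R (∙-cong m₁ m₂) (by-view view)
      where
      by-view : ∀ {R} → AddView E x₁ y₁ x₂ y₂ R → Maps R (image x₁ y₁ on₁ ∙ image x₂ y₂ on₂)
      by-view (vertical Δ≡0 s≡0)          = RankOneModel.vertical model x₁ y₁ x₂ y₂ on₁ on₂ Δ≡0 s≡0
      by-view (secant l Δ≢0 slope)        = chord l x₁ y₁ x₂ y₂ on₁ on₂ Δ≢0 slope
      by-view (degenerate Δ≡0 s≢0 2y≡0)   = ⊥-elim (non-degenerate x₁ y₁ x₂ y₂ on₁ on₂ Δ≡0 s≢0 2y≡0)
      by-view (tangent l Δ≡0 s≢0 _ slope) = RankOneModel.tangent model l x₁ y₁ x₂ y₂ on₁ on₂ Δ≡0 s≢0 slope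

    maps-add : ∀ P P′ {g g′} → Maps P g → Maps P′ g′ → Maps (add E P P′) (g ∙ g′)
    maps-add O        P′         m m′ = maps-respˡ P′ (trans (sym (identityˡ _)) (∙-congʳ m)) m′
    maps-add (pt x y) O          m m′ = maps-respˡ (pt x y) (trans (sym (identityʳ _)) (∙-congˡ m′)) m
    maps-add (pt x y) (pt x′ y′) m m′ = maps-view (addView E x y x′ y′) m m′

    maps-neg : ∀ P {g} → Maps P g → Maps (neg P) (g ⁻¹)
    maps-neg O        m        = trans (sym ε⁻¹≈ε) (⁻¹-cong m)
    maps-neg (pt x y) (on , m) = maps-respˡ (pt x (ℚ.- y)) (⁻¹-cong m) (opposite x y on)

    maps-mulℕ : ∀ n P {g} → Maps P g → Maps (mulℕ E n P) (n ×ℕ g)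
    maps-mulℕ zero    P m = refl
    maps-mulℕ (suc n) P m = maps-add P (mulℕ E n P) m (maps-mulℕ n P m)

    maps-mulℤ : ∀ c P {g} → Maps P g → Maps (mulℤ E c P) (c · g)
    maps-mulℤ (+ n)    P m = maps-mulℕ n P m
    maps-mulℤ -[1+ n ] P m = maps-neg (mulℕ E (suc n) P) (maps-mulℕ (suc n) P m)

    maps-O : ∀ P {g} → Maps P g → P ≡ O → g ≈ ε
    maps-O O m _ = sym m

    -- The converse of `maps-O`: no affine point goes to ε, so a relation between images is already
    -- a relation between points.
    maps-O⁻¹ : ∀ P {g} → Maps P g → g ≈ ε → P ≡ O
    maps-O⁻¹ O        _        _   = ≡.refl
    maps-O⁻¹ (pt x y) (on , m) g≈ε = ⊥-elim (image≉ε x y on (trans m g≈ε))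

    element : (P : RatPoint E) → ∃ (Maps (proj₁ P))
    element (O , _)       = ε , refl
    element (pt x y , on) = image x y on , on , refl

    independent : ∀ {x y} (on : OnE x y) → (∀ c → c · image x y on ≈ ε → c ≡ 0ℤ) → Independent E 1 (λ _ → pt x y , on)
    independent {x} {y} on order c h Fin.zero = order (c Fin.zero) (trans (sym (identityʳ _))
      (maps-O _ (maps-add (mulℤ E (c Fin.zero) (pt x y)) O (maps-mulℤ (c Fin.zero) (pt x y) (on , refl)) refl) h))

    not-independent : (P : Fin 2 → RatPoint E) → ¬ Independent E 2 P
    not-independent P ind = dependent (g 0F) (g 1F) independent₂
      where
      g : Fin 2 → Carrier
      g i = proj₁ (element (P i))
      coefficients : ℤ → ℤ → Fin 2 → ℤ
      coefficients c d Fin.zero    = c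
      coefficients c d (Fin.suc _) = d
      maps-multiple : ∀ c i → Maps (mulℤ E c (proj₁ (P i))) (c · g i)
      maps-multiple c i = maps-mulℤ c (proj₁ (P i)) (proj₂ (element (P i)))
      maps-lincomb : ∀ c d → Maps (lincomb E 2 (coefficients c d) (λ i → proj₁ (P i))) (c · g 0F ∙ (d · g 1F ∙ ε))
      maps-lincomb c d = maps-add (mulℤ E c (proj₁ (P 0F))) (add E (mulℤ E d (proj₁ (P 1F))) O) (maps-multiple c 0F)
        (maps-add (mulℤ E d (proj₁ (P 1F))) O (maps-multiple d 1F) refl)
      independent₂ : Independent₂ (g 0F) (g 1F)
      independent₂ c d h = zero-coefficient 0F , zero-coefficient 1F
        where
        zero-coefficient : (i : Fin 2) → coefficients c d i ≡ 0ℤ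
        zero-coefficient = ind (coefficients c d) (maps-O⁻¹ _ (maps-lincomb c d) (trans (∙-congˡ (identityʳ _)) h))

    rank-one : HasRank E 1
    rank-one = from-generator generator , not-independent
      where
      from-generator : (∃ λ x → ∃ λ y → Σ (OnE x y) λ on → ∀ c → c · image x y on ≈ ε → c ≡ 0ℤ) →
        Σ (Fin 1 → RatPoint E) (Independent E 1)
      from-generator (x , y , on , order) = (λ _ → pt x y , on) , independent on order

  module _ (p : ℕ) (p-prime : Prime p) where
    -- Treats both families together, with (r , s) = (3 , 1) or (27 , 4): from r + 5 = 8 s one gets
    -- p + 5 = 8 (5 k + s) = 8 m², and p inherits the residues of r modulo 4 and 5.
    rank-one-from : ∀ r s (k m : ℤ) → + 4 Signed.∣ + r ℤ.+ 1ℤ → + 5 Signed.∣ + r ℤ.* + r ℤ.+ 1ℤ →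
      + r ℤ.+ + 5 ≡ + 8 ℤ.* + s → + p ≡ + 40 ℤ.* k ℤ.+ + r → + 5 ℤ.* k ℤ.+ + s ≡ m ℤ.* m → HasRank (Ep p) 1
    rank-one-from r s k m r≡3 r≡±2 r+5 p≡ m²≡ = RankOne.rank-one p (rankOneModel ℚ-fractions p ℤ.∣ m ∣ admissible p+5≡8m² (A (Ep p)) a≡)
      where
      open ≡ using (refl; sym; trans; cong)
      open ℤ-Solver
      a≡ : A (Ep p) ≡ 0ℚ ℚ.- Rationals.ι (+ 5 ℤ.* + p)
      a≡ = trans (cong (λ z → ℚ.- Rationals.ι z) (ℤₚ.pos-* 5 p)) (sym (ℚₚ.+-identityˡ _))
      admissible : Admissible p
      admissible = record
        { p-prime = p-prime
        ; p≡3[4]  = congruence 4 (+ p ∷ k ∷ + r ∷ []) ($2 :+ # 1 ∷ $0 :- (# 40 :* $1 :+ $2) ∷ [])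
            ($0 :+ # 1) refl (r≡3 ∷ ≡0⇒∣ 4 p-eq ∷ [])
        ; p≡±2[5] = congruence 5 (+ p ∷ k ∷ + r ∷ []) ($2 :* $2 :+ # 1 ∷ $0 :- (# 40 :* $1 :+ $2) ∷ [])
            ($0 :* $0 :+ # 1) refl (r≡±2 ∷ ≡0⇒∣ 5 p-eq ∷ [])
        }
        where
        p-eq : + p ℤ.- (+ 40 ℤ.* k ℤ.+ + r) ≡ 0ℤ
        p-eq = trans (cong (λ t → t ℤ.- (+ 40 ℤ.* k ℤ.+ + r)) p≡) (ℤₚ.+-inverseʳ (+ 40 ℤ.* k ℤ.+ + r))
      p+5≡8m² : + p ℤ.+ + 5 ≡ + 8 ℤ.* (+ ℤ.∣ m ∣ ℤ.* + ℤ.∣ m ∣)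
      p+5≡8m² = trans (certify (+ p ∷ k ∷ + r ∷ + s ∷ m ∷ [])
          ($0 :+ # 5) (# 8 :* ($4 :* $4))
          ( # 1 ∙ $0 ≔ # 40 :* $1 :+ $2 by p≡
          ∷ # 1 ∙ $2 :+ # 5 ≔ # 8 :* $3 by r+5
          ∷ # 8 ∙ # 5 :* $1 :+ $3 ≔ $4 :* $4 by m²≡ ∷ []) refl)
        (cong (+ 8 ℤ.*_) (sym (abs-square m)))

open import Defs
open import Data.Nat using (ℕ)
open import Data.Nat.Divisibility using (_∣_)
open import Data.Nat.Primality using (Prime)
open import Data.Integer using (ℤ; +_; _+_; _*_)
open import Data.Product using (∃; _×_; _,_)
open import Data.Sum using (_⊎_; inj₁; inj₂)
open import Relation.Nullary using (¬_)
open import Relation.Binary.PropositionalEquality using (_≡_; refl)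
open import Data.Integer.Divisibility.Signed using (divides)
open CurvesOverℚ using (rank-one-from)

theorem1p2 : (p : ℕ) → Prime p → ¬ (2 ∣ p) →
    ((∃ λ (k₁ : ℤ) → (+ p ≡ + 40 * k₁ + + 3) × (∃ λ (m : ℤ) → + 5 * k₁ + + 1 ≡ m * m))
    ⊎ (∃ λ (k₂ : ℤ) → (+ p ≡ + 40 * k₂ + + 27) × (∃ λ (m : ℤ) → + 5 * k₂ + + 4 ≡ m * m))) →
    HasRank (Ep p) 1
-- The witnesses are the quotients of r + 1 by 4 and of r² + 1 by 5, for r = 3 and then for r = 27.
theorem1p2 p p-prime _ (inj₁ (k , p≡ , m , m²)) = rank-one-from p p-prime 3 1 k m
  (divides (+ 1) refl) (divides (+ 2) refl) refl p≡ m²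
theorem1p2 p p-prime _ (inj₂ (k , p≡ , m , m²)) = rank-one-from p p-prime 27 4 k m
  (divides (+ 7) refl) (divides (+ 146) refl) refl p≡ m²
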